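{- There is an algorithm which, given a directed or undirected unweighted graph $G$ with $n$ vertices, $m$ edges and diameter $D=3h+z$ (where $h\ge0$, $z\in\{0,1,2\}$), runs in $\tilde O(m^{2/3}n^{4/3})$ time and outputs an estimate $\hat D$ with $2h+z\le\hat D\le D$.
   Context: The diameter is the maximum shortest-path distance over ordered pairs of vertices. $\tilde O$ hides polylogarithmic factors. -}

module Defs where

open import Data.Bool using (if_then_else_; _∧_)
open import Data.Fin using (Fin; zero; suc; toℕ)
open import Data.Nat using (ℕ; zero; suc; _+_; _*_; _∸_; _≤_; _≡ᵇ_)
open import Data.Nat.Logarithm using (⌊log₂_⌋)
open import Data.Product using (_×_; _,_; ∃-syntax; proj₁; proj₂; swap)
open import Data.Sum using (_⊎_)
open import Function using (_∘_)
open import Relation.Binary.PropositionalEquality using (_≡_; _≢_; refl)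
open import Relation.Nullary using (contradiction)

data Kind : Set where
  directed undirected : Kind

SameEdge : Kind → ∀ {n} → Fin n × Fin n → Fin n × Fin n → Set
SameEdge directed   p q = p ≡ q
SameEdge undirected p q = p ≡ q ⊎ swap p ≡ q

-- A finite simple graph with vertices Fin n and m edges.  The edges come in
-- an arbitrary order, and an undirected edge {u , v} is stored once, as
-- either (u , v) or (v , u).  Directed graphs may contain both (u , v) and
-- (v , u).
record Graph (κ : Kind) (n m : ℕ) : Set where
  field
    ends     : Fin m → Fin n × Fin n
    loopless : ∀ e → proj₁ (ends e) ≢ proj₂ (ends e)
    simple   : ∀ e f → SameEdge κ (ends e) (ends f) → e ≡ f

  Adj : Fin n → Fin n → Set
  Adj u v = ∃[ e ] SameEdge κ (ends e) (u , v)

  data Walk : Fin n → Fin n → ℕ → Set where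
    []  : ∀ {u} → Walk u u 0
    _∷_ : ∀ {u v w k} → Adj u v → Walk v w k → Walk u w (suc k)

  IsDistance : Fin n → Fin n → ℕ → Set
  IsDistance u v d = Walk u v d × (∀ k → Walk u v k → d ≤ k)

  -- Holds for no D when some vertex cannot reach another (infinite diameter)
  -- or when n = 0.
  IsDiameter : ℕ → Set
  IsDiameter D =
    (∀ u v → ∃[ d ] IsDistance u v d × d ≤ D) ×
    (∃[ u ] ∃[ v ] IsDistance u v D)

open Graph public using (ends; IsDiameter)

-- Random access machine, logarithmic cost
--
-- A program is a fixed command.  The memory consists of arrays of natural
-- numbers whose names occur literally in the program; as a program mentions
-- only finitely many names, say K of them, this is one RAM memory with cell
-- i of array a at address K * i + a.  Scalar variables are cells at a literal
-- index.  A test succeeds when its value is nonzero.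

infix  20 _!_
infixl 15 _⊛_
infixl 14 _⊕_ _⊖_
infix  13 _[_]≔_
infixr 12 _⨟_

data Expr : Set where
  lit         : ℕ → Expr
  _!_         : ℕ → Expr → Expr
  _⊕_ _⊖_ _⊛_ : Expr → Expr → Expr

data Cmd : Set where
  skip       : Cmd
  _[_]≔_     : ℕ → Expr → Expr → Cmd
  _⨟_        : Cmd → Cmd → Cmd
  ifte       : Expr → Cmd → Cmd → Cmd
  while      : Expr → Cmd → Cmd

Store : Set
Store = ℕ → ℕ → ℕ

_[_,_↦_] : Store → ℕ → ℕ → ℕ → Store
(σ [ a , i ↦ v ]) b j = if (a ≡ᵇ b) ∧ (i ≡ᵇ j) then v else σ b j

⟦_⟧ : Expr → Store → ℕ
⟦ lit v ⟧   σ = v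
⟦ a ! e ⟧   σ = σ a (⟦ e ⟧ σ)
⟦ e₁ ⊕ e₂ ⟧ σ = ⟦ e₁ ⟧ σ + ⟦ e₂ ⟧ σ
⟦ e₁ ⊖ e₂ ⟧ σ = ⟦ e₁ ⟧ σ ∸ ⟦ e₂ ⟧ σ
⟦ e₁ ⊛ e₂ ⟧ σ = ⟦ e₁ ⟧ σ * ⟦ e₂ ⟧ σ

-- Length of the binary representation (1 for the number 0).
size : ℕ → ℕ
size v = suc ⌊log₂ v ⌋

-- Every operation is charged the sizes of the numbers and of the addresses
-- it handles, so large numbers give no free parallelism.
cost : Expr → Store → ℕ
cost (lit v)   σ = size v
cost (a ! e)   σ = cost e σ + size (⟦ e ⟧ σ) + size (⟦ a ! e ⟧ σ)
cost (e₁ ⊕ e₂) σ = cost e₁ σ + cost e₂ σ + size (⟦ e₁ ⟧ σ) + size (⟦ e₂ ⟧ σ)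
cost (e₁ ⊖ e₂) σ = cost e₁ σ + cost e₂ σ + size (⟦ e₁ ⟧ σ) + size (⟦ e₂ ⟧ σ)
cost (e₁ ⊛ e₂) σ = cost e₁ σ + cost e₂ σ + size (⟦ e₁ ⟧ σ) + size (⟦ e₂ ⟧ σ)

-- ⟨ c , σ ⟩⇓ σ′ ∣ t : started in σ, the command c halts in σ′ after time t.
data ⟨_,_⟩⇓_∣_ : Cmd → Store → Store → ℕ → Set where

  ⇓skip : ∀ {σ} → ⟨ skip , σ ⟩⇓ σ ∣ 1

  ⇓assign : ∀ {a i e σ} →
    ⟨ a [ i ]≔ e , σ ⟩⇓ σ [ a , ⟦ i ⟧ σ ↦ ⟦ e ⟧ σ ]
      ∣ (cost i σ + cost e σ + size (⟦ i ⟧ σ) + size (⟦ e ⟧ σ))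

  ⇓seq : ∀ {c₁ c₂ σ₀ σ₁ σ₂ t₁ t₂} →
    ⟨ c₁ , σ₀ ⟩⇓ σ₁ ∣ t₁ → ⟨ c₂ , σ₁ ⟩⇓ σ₂ ∣ t₂ →
    ⟨ c₁ ⨟ c₂ , σ₀ ⟩⇓ σ₂ ∣ (t₁ + t₂)

  ⇓then : ∀ {e c₁ c₂ σ σ′ t} → ⟦ e ⟧ σ ≢ 0 →
    ⟨ c₁ , σ ⟩⇓ σ′ ∣ t →
    ⟨ ifte e c₁ c₂ , σ ⟩⇓ σ′ ∣ (cost e σ + size (⟦ e ⟧ σ) + t)

  ⇓else : ∀ {e c₁ c₂ σ σ′ t} → ⟦ e ⟧ σ ≡ 0 →
    ⟨ c₂ , σ ⟩⇓ σ′ ∣ t →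
    ⟨ ifte e c₁ c₂ , σ ⟩⇓ σ′ ∣ (cost e σ + size (⟦ e ⟧ σ) + t)

  ⇓done : ∀ {e c σ} → ⟦ e ⟧ σ ≡ 0 →
    ⟨ while e c , σ ⟩⇓ σ ∣ (cost e σ + size (⟦ e ⟧ σ))

  ⇓loop : ∀ {e c σ₀ σ₁ σ₂ t₁ t₂} → ⟦ e ⟧ σ₀ ≢ 0 →
    ⟨ c , σ₀ ⟩⇓ σ₁ ∣ t₁ → ⟨ while e c , σ₁ ⟩⇓ σ₂ ∣ t₂ →
    ⟨ while e c , σ₀ ⟩⇓ σ₂ ∣ (cost e σ₀ + size (⟦ e ⟧ σ₀) + (t₁ + t₂))

-- The final store and the running time are functions of the program and the
-- initial store.
⇓-deterministic : ∀ {c σ σ₁ σ₂ t₁ t₂} →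
  ⟨ c , σ ⟩⇓ σ₁ ∣ t₁ → ⟨ c , σ ⟩⇓ σ₂ ∣ t₂ → σ₁ ≡ σ₂ × t₁ ≡ t₂
⇓-deterministic ⇓skip   ⇓skip   = refl , refl
⇓-deterministic ⇓assign ⇓assign = refl , refl
⇓-deterministic (⇓seq p q) (⇓seq p′ q′) with ⇓-deterministic p p′
... | refl , refl with ⇓-deterministic q q′
...   | refl , refl = refl , refl
⇓-deterministic (⇓then _ p) (⇓then _ p′) with ⇓-deterministic p p′
... | refl , refl = refl , refl
⇓-deterministic (⇓then ≢0 _) (⇓else ≡0 _) = contradiction ≡0 ≢0
⇓-deterministic (⇓else ≡0 _) (⇓then ≢0 _) = contradiction ≡0 ≢0
⇓-deterministic (⇓else _ p) (⇓else _ p′) with ⇓-deterministic p p′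
... | refl , refl = refl , refl
⇓-deterministic (⇓done _) (⇓done _) = refl , refl
⇓-deterministic (⇓done ≡0) (⇓loop ≢0 _ _) = contradiction ≡0 ≢0
⇓-deterministic (⇓loop ≢0 _ _) (⇓done ≡0) = contradiction ≡0 ≢0
⇓-deterministic (⇓loop _ p q) (⇓loop _ p′ q′) with ⇓-deterministic p p′
... | refl , refl with ⇓-deterministic q q′
...   | refl , refl = refl , refl

cells : ∀ {m} → (Fin m → ℕ) → ℕ → ℕ
cells {zero}  f j       = 0
cells {suc m} f zero    = f zero
cells {suc m} f (suc j) = cells (f ∘ suc) j

kindFlag : Kind → ℕ
kindFlag directed   = 0
kindFlag undirected = 1

-- Array 0 holds n, m and the kind of the graph, arrays 1 and 2 hold the first
-- and second endpoints of the edges; every other cell is 0.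
input : ∀ {κ n m} → Graph κ n m → Store
input {κ} {n} {m} G 0 0 = n
input {κ} {n} {m} G 0 1 = m
input {κ} {n} {m} G 0 2 = kindFlag κ
input G 1 j = cells (toℕ ∘ proj₁ ∘ ends G) j
input G 2 j = cells (toℕ ∘ proj₂ ∘ ends G) j
input G _ _ = 0

output : Store → ℕ
output σ = σ 3 0

{-# OPTIONS --safe #-}
module Submission where

-- Replace an undirected edge by two arcs and let s ≈ (m/n)^(1/3).  For every
-- vertex x take the s vertices nearest to x, and the s vertices nearest to
-- it in the reversed graph; since only s vertices are wanted, it suffices to
-- search the graph in which every adjacency list is cut after s entries.
-- Let R⁺ x and R⁻ x be the radii of these balls.  A greedy set of about
-- (n/s) log n pivots meets all 2n balls, and full searches from and to the
-- pivots cost about m each.  For every pair x ≠ y, scanning the s² pairs of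
-- ball members for an arc yields min (R⁺ x + R⁻ y) (d x y), because a walk
-- shorter than R⁺ x + R⁻ y crosses from the out-ball of x to the in-ball of y
-- by an arc.  Altogether this takes about n² s² ≈ m^(2/3) n^(4/3) operations.
--
-- Let d a b = D = 3h + z.  If R⁺ a ≤ h, a pivot p in the ball of a has
-- d p b ≥ 2h + z, and symmetrically if R⁻ b ≤ h.  Otherwise the value for the
-- pair a, b is at least min (2h + 2) D ≥ 2h + z.

-- The program knows neither `D` nor `h`. Balls are therefore fixed by their number of vertices, and
-- radii are compared with `h` only in the analysis. Nothing recorded in the output exceeds `D`: a
-- value is a distance from or to a pivot, or at most the distance of a pair, so a single running
-- maximum serves all cases.
--
-- The ball size balances two costs. About n/s pivots with searches of cost m need mn/s, the pairs
-- need n² s², and these agree for s³ = m/n. Collecting a ball from full adjacency lists could cost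
-- m per vertex; cutting the lists at s entries does no harm because a vertex with s neighbours
-- fills the ball by itself. The greedy choice of pivots avoids randomness.
--
-- Time is factored into a constant read off the program text, the price of one operation, and a
-- work measure counted in iterations. All stored numbers are at most n², so the price is of order
-- log n. A second logarithm comes from the number of pivots.

open import Defs
open import Data.Bool using (Bool; true; false; _∨_; if_then_else_; T)
open import Data.Bool.Properties using (∨-conicalˡ; ∨-conicalʳ)
open import Data.Empty using (⊥; ⊥-elim)
open import Data.Fin as Fin using (Fin; toℕ; fromℕ<)
open import Data.Fin.Properties using (toℕ-injective; toℕ<n; toℕ-fromℕ<; injective⇒≤)
open import Data.Nat hiding (_!; _/_; _%_)
open import Data.Nat.DivMod using (_/_; _%_; m/n*n≤m; m≡m%n+[m/n]*n; m%n<n; n/1≡n; n/n≡1; /-monoˡ-≤; /-monoʳ-≤; +-distrib-/-∣ʳ)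
open import Data.Nat.Divisibility using (∣-refl)
open import Data.Nat.Induction using (<-wellFounded)
open import Data.Nat.Logarithm using (⌊log₂_⌋; ⌊log₂⌋-mono-≤; ⌊log₂[2^n]⌋≡n; ⌈log₂_⌉; ⌈log₂⌉-mono-≤)
open import Data.Nat.Logarithm.Core using (⌈log2⌉)
open import Data.Nat.Properties
open import Data.Nat.Tactic.RingSolver using (solve-∀)
open import Data.Product using (_×_; _,_; Σ-syntax; ∃-syntax; proj₁; proj₂; swap)
open import Data.Sum using (_⊎_; inj₁; inj₂; [_,_]) renaming (map to map-⊎)
open import Function using (flip; _∘_)
open import Induction.WellFounded using (Acc; acc)
open import Relation.Binary.Definitions using (tri<; tri≈; tri>)
open import Relation.Binary.PropositionalEquality hiding (J; [_])
open import Relation.Nullary using (yes; no)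

-- Finite sums

sum : ℕ → (ℕ → ℕ) → ℕ
sum zero    f = 0
sum (suc n) f = sum n f + f n

sum-mono-range : ∀ {m n} f → m ≤ n → sum m f ≤ sum n f
sum-mono-range {m} {n} f m≤n with m≤n⇒m<n∨m≡n m≤n
sum-mono-range {m} {n}     f m≤n | inj₂ refl    = ≤-refl
sum-mono-range {m} {suc n} f m≤n | inj₁ (s≤s p) = ≤-trans (sum-mono-range f p) (m≤m+n _ _)

-- Amortised accounting: of a total `N`, `a` is spent and `k` is left; paying `x` then leaves
-- `N ∸ (a + x)`. Counting loops and the queue loop of the search both pass their bound on total
-- work to `run-while` in this form.
budget-step : ∀ {N} k a x → k + a ≡ N → a + x ≤ N → x + (N ∸ (a + x)) ≤ k
budget-step {N} k a x refl le = +-cancelʳ-≤ a _ _ (≤-reflexive (begin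
  x + (N ∸ (a + x)) + a   ≡⟨ lemma x _ a ⟩
  (N ∸ (a + x)) + (a + x) ≡⟨ m∸n+n≡m le ⟩
  k + a                   ∎))
  where
    open ≡-Reasoning
    lemma : ∀ x y z → x + y + z ≡ y + (z + x)
    lemma = solve-∀

-- A syntactic frame condition

writes : Cmd → ℕ → Bool
writes skip           b = false
writes (a [ _ ]≔ _)   b = a ≡ᵇ b
writes (c₁ ⨟ c₂)      b = writes c₁ b ∨ writes c₂ b
writes (ifte _ c₁ c₂) b = writes c₁ b ∨ writes c₂ b
writes (while _ c)    b = writes c b

-- A record, so that unification recovers the command from a proof; from the computed `writes c b`
-- it could not.
record Frame (c : Cmd) (σ σ′ : Store) : Set where
  constructor framed
  field same : ∀ b → writes c b ≡ false → ∀ j → σ′ b j ≡ σ b j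
open Frame public

frame-refl : ∀ {c σ} → Frame c σ σ
frame-refl = framed λ b _ j → refl

frame-trans : ∀ {c σ₀ σ₁ σ₂} → Frame c σ₀ σ₁ → Frame c σ₁ σ₂ → Frame c σ₀ σ₂
frame-trans f g = framed λ b w j → trans (same g b w j) (same f b w j)

⇓-same : ∀ {c σ σ′ t} → ⟨ c , σ ⟩⇓ σ′ ∣ t → ∀ b → writes c b ≡ false → ∀ j → σ′ b j ≡ σ b j
⇓-same ⇓skip b w j = refl
⇓-same (⇓assign {a} {i} {e} {σ}) b w j rewrite w = refl
⇓-same (⇓seq {c₁} {c₂} p q) b w j =
  trans (⇓-same q b (∨-conicalʳ (writes c₁ b) _ w) j) (⇓-same p b (∨-conicalˡ _ _ w) j)
⇓-same (⇓then _ p) b w j = ⇓-same p b (∨-conicalˡ _ _ w) j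
⇓-same (⇓else {c₁ = c₁} _ p) b w j = ⇓-same p b (∨-conicalʳ (writes c₁ b) _ w) j
⇓-same (⇓done _) b w j = refl
⇓-same (⇓loop _ p q) b w j = trans (⇓-same q b w j) (⇓-same p b w j)

⇓-frame : ∀ {c σ σ′ t} → ⟨ c , σ ⟩⇓ σ′ ∣ t → Frame c σ σ′
⇓-frame e = framed (⇓-same e)

-- Syntactic constants of the running time

-- In a store with entries at most 2 ^ ℓ, the value of `e` is at most 2 ^ (`weight e` * ℓ). A
-- product adds bit lengths, a sum may be treated alike because both lengths are positive, and a
-- literal gets the crude `suc v`, still a constant of the text.
weight : Expr → ℕ
weight (lit v)   = suc v
weight (a ! e)   = 1
weight (e₁ ⊕ e₂) = weight e₁ + weight e₂
weight (e₁ ⊖ e₂) = weight e₁ + weight e₂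
weight (e₁ ⊛ e₂) = weight e₁ + weight e₂

costFactor : Expr → ℕ
costFactor (lit v)   = weight (lit v)
costFactor (a ! e)   = costFactor e + weight e + 1
costFactor (e₁ ⊕ e₂) = costFactor e₁ + costFactor e₂ + weight e₁ + weight e₂
costFactor (e₁ ⊖ e₂) = costFactor e₁ + costFactor e₂ + weight e₁ + weight e₂
costFactor (e₁ ⊛ e₂) = costFactor e₁ + costFactor e₂ + weight e₁ + weight e₂

-- Loops count with their text only; the number of iterations belongs to the work measure `X` of
-- `Run`.
factor : Cmd → ℕ
factor skip           = 1
factor (a [ i ]≔ e)   = costFactor i + costFactor e + weight i + weight e
factor (c₁ ⨟ c₂)      = factor c₁ + factor c₂
factor (ifte e c₁ c₂) = costFactor e + weight e + (factor c₁ + factor c₂)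
factor (while e c)    = costFactor e + weight e + factor c

for : ℕ → Expr → Cmd → Cmd
for a e c = a [ lit 0 ]≔ lit 0 ⨟ while (e ⊖ a ! lit 0) (c ⨟ a [ lit 0 ]≔ a ! lit 0 ⊕ lit 1)

-- A program logic for total correctness with time bounds

module Logic (V ℓ : ℕ) (V≤2^ℓ : V ≤ 2 ^ ℓ) (1≤ℓ : 1 ≤ ℓ) where

  Bounded : Store → Set
  Bounded σ = ∀ a i → σ a i ≤ V

  n<2^n : ∀ n → n < 2 ^ n
  n<2^n zero = s≤s z≤n
  n<2^n (suc n) = begin-strict
    suc n           <⟨ s≤s (n<2^n n) ⟩
    suc (2 ^ n)     ≤⟨ +-monoˡ-≤ (2 ^ n) (m^n>0 2 n) ⟩
    2 ^ n + 2 ^ n   ≡⟨ cong (2 ^ n +_) (sym (+-identityʳ _)) ⟩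
    2 ^ suc n       ∎
    where open ≤-Reasoning

  2^-sum : ∀ a b → 1 ≤ a → 1 ≤ b → 2 ^ a + 2 ^ b ≤ 2 ^ (a + b)
  2^-sum (suc a) (suc b) _ _ = begin
    2 * 2 ^ a + 2 * 2 ^ b          ≤⟨ +-mono-≤ (*-monoʳ-≤ 2 (m≤m*n (2 ^ a) (2 ^ b))) (*-monoʳ-≤ 2 (m≤n*m (2 ^ b) (2 ^ a))) ⟩
    2 * (2 ^ a * 2 ^ b) + 2 * (2 ^ a * 2 ^ b) ≡⟨ lemma (2 ^ a) (2 ^ b) ⟩
    (2 * 2 ^ a) * (2 * 2 ^ b)      ≡⟨ sym (^-distribˡ-+-* 2 (suc a) (suc b)) ⟩
    2 ^ (suc a + suc b) ∎
    where
      open ≤-Reasoning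
      instance _ = m^n≢0 2 a
      instance _ = m^n≢0 2 b
      lemma : ∀ x y → 2 * (x * y) + 2 * (x * y) ≡ (2 * x) * (2 * y)
      lemma = solve-∀

  weight≥1 : ∀ e → 1 ≤ weight e
  weight≥1 (lit x) = s≤s z≤n
  weight≥1 (x ! e) = s≤s z≤n
  weight≥1 (e ⊕ e₁) = ≤-trans (weight≥1 e) (m≤m+n _ _)
  weight≥1 (e ⊖ e₁) = ≤-trans (weight≥1 e) (m≤m+n _ _)
  weight≥1 (e ⊛ e₁) = ≤-trans (weight≥1 e) (m≤m+n _ _)

  weightℓ≥1 : ∀ e → 1 ≤ weight e * ℓ
  weightℓ≥1 e = *-mono-≤ (weight≥1 e) 1≤ℓ

  value≤ : ∀ e {σ} → Bounded σ → ⟦ e ⟧ σ ≤ 2 ^ (weight e * ℓ)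
  value≤ (lit v) bd = ≤-trans (<⇒≤ (n<2^n v)) (^-monoʳ-≤ 2 (≤-trans (n≤1+n v)
    (≤-trans (≤-reflexive (sym (*-identityʳ (suc v)))) (*-monoʳ-≤ (suc v) 1≤ℓ))))
  value≤ (a ! e) bd rewrite +-identityʳ ℓ = ≤-trans (bd _ _) V≤2^ℓ
  value≤ (e₁ ⊕ e₂) bd rewrite *-distribʳ-+ ℓ (weight e₁) (weight e₂) =
    ≤-trans (+-mono-≤ (value≤ e₁ bd) (value≤ e₂ bd)) (2^-sum _ _ (weightℓ≥1 e₁) (weightℓ≥1 e₂))
  value≤ (e₁ ⊖ e₂) {σ} bd rewrite *-distribʳ-+ ℓ (weight e₁) (weight e₂) =
    ≤-trans (m∸n≤m (⟦ e₁ ⟧ σ) (⟦ e₂ ⟧ σ)) (≤-trans (value≤ e₁ bd) (^-monoʳ-≤ 2 (m≤m+n (weight e₁ * ℓ) (weight e₂ * ℓ))))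
  value≤ (e₁ ⊛ e₂) bd rewrite *-distribʳ-+ ℓ (weight e₁) (weight e₂)
    | ^-distribˡ-+-* 2 (weight e₁ * ℓ) (weight e₂ * ℓ) = *-mono-≤ (value≤ e₁ bd) (value≤ e₂ bd)

  infix 4 _≼_
  -- `suc ℓ` is the price of handling one number of about ℓ bits. A record keeps `x` inferable,
  -- which `x * suc ℓ` would not.
  record _≼_ (a x : ℕ) : Set where
    constructor ≼-intro
    field ≼-elim : a ≤ x * suc ℓ
  open _≼_ public

  infixl 6 _⊞_
  _⊞_ : ∀ {a b x y} → a ≼ x → b ≼ y → a + b ≼ x + y
  _⊞_ {x = x} {y} (≼-intro p) (≼-intro q) = ≼-intro
    (≤-trans (+-mono-≤ p q) (≤-reflexive (sym (*-distribʳ-+ (suc ℓ) x y))))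

  size≤ : ∀ e {σ} → Bounded σ → size (⟦ e ⟧ σ) ≼ weight e
  size≤ e {σ} bd = ≼-intro (begin
    suc ⌊log₂ (⟦ e ⟧ σ) ⌋          ≤⟨ s≤s (⌊log₂⌋-mono-≤ (value≤ e bd)) ⟩
    suc ⌊log₂ (2 ^ (weight e * ℓ)) ⌋ ≡⟨ cong suc (⌊log₂[2^n]⌋≡n (weight e * ℓ)) ⟩
    suc (weight e * ℓ)             ≤⟨ +-monoˡ-≤ (weight e * ℓ) (weight≥1 e) ⟩
    weight e + weight e * ℓ        ≡⟨ sym (*-suc (weight e) ℓ) ⟩
    weight e * suc ℓ               ∎)
    where open ≤-Reasoning

  cost≤ : ∀ e {σ} → Bounded σ → cost e σ ≼ costFactor e
  cost≤ (lit v) {σ} bd = size≤ (lit v) {σ} bd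
  cost≤ (a ! e) {σ} bd = cost≤ e bd ⊞ size≤ e bd ⊞ size≤ (a ! e) bd
  cost≤ (e₁ ⊕ e₂) bd = cost≤ e₁ bd ⊞ cost≤ e₂ bd ⊞ size≤ e₁ bd ⊞ size≤ e₂ bd
  cost≤ (e₁ ⊖ e₂) bd = cost≤ e₁ bd ⊞ cost≤ e₂ bd ⊞ size≤ e₁ bd ⊞ size≤ e₂ bd
  cost≤ (e₁ ⊛ e₂) bd = cost≤ e₁ bd ⊞ cost≤ e₂ bd ⊞ size≤ e₁ bd ⊞ size≤ e₂ bd

  -- Total correctness together with a time bound: X measures the work up to
  -- the constant determined by the text of c and the cost of one operation.
  record Run (c : Cmd) (σ : Store) (X : ℕ) (Q : Store → Set) : Set where
    constructor ran
    field
      {final} : Store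
      {time}  : ℕ
      exec    : ⟨ c , σ ⟩⇓ final ∣ time
      time≤   : time ≼ factor c * X
      bounded : Bounded final
      post    : Q final

  _≼⟫_ : ∀ {a x y} → a ≼ x → x ≤ y → a ≼ y
  ≼-intro p ≼⟫ q = ≼-intro (≤-trans p (*-monoˡ-≤ (suc ℓ) q))

  weaken : ∀ {c σ X Y Q R} → X ≤ Y → (∀ σ′ → Q σ′ → R σ′) → Run c σ X Q → Run c σ Y R
  weaken {c} p f (ran e t b q) = ran e (t ≼⟫ *-monoʳ-≤ (factor c) p) b (f _ q)

  relax : ∀ {c σ X Y Q} → X ≤ Y → Run c σ X Q → Run c σ Y Q
  relax p = weaken p λ _ q → q

  weaken-frame : ∀ {c σ X Y Q R} → X ≤ Y → (∀ σ′ → Frame c σ σ′ → Q σ′ → R σ′) → Run c σ X Q → Run c σ Y R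
  weaken-frame {c} p f (ran e t b q) = ran e (t ≼⟫ *-monoʳ-≤ (factor c) p) b (f _ (⇓-frame e) q)

  Bounded-upd : ∀ {σ} a i {v} → Bounded σ → v ≤ V → Bounded (σ [ a , i ↦ v ])
  Bounded-upd a i bd v≤ b j with (a ≡ᵇ b) | i ≡ᵇ j
  ... | true  | true  = v≤
  ... | true  | false = bd b j
  ... | false | true  = bd b j
  ... | false | false = bd b j

  private
    scale : ∀ {a} x X → 1 ≤ X → a ≼ x → a ≼ x * X
    scale x X 1≤X p = p ≼⟫ ≤-trans (≤-reflexive (sym (*-identityʳ x))) (*-monoʳ-≤ x 1≤X)

    add : ∀ {a b} x y X → a ≼ x * X → b ≼ y * X → a + b ≼ (x + y) * X
    add x y X p q = (p ⊞ q) ≼⟫ ≤-reflexive (sym (*-distribʳ-+ X x y))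

  run-skip : ∀ {σ X Q} → 1 ≤ X → Bounded σ → Q σ → Run skip σ X Q
  run-skip {X = X} 1≤X bd q = ran ⇓skip (scale 1 X 1≤X (≼-intro (s≤s z≤n))) bd q

  run-assign : ∀ {a i e σ X Q} iv v → ⟦ i ⟧ σ ≡ iv → ⟦ e ⟧ σ ≡ v → v ≤ V → 1 ≤ X → Bounded σ →
    Q (σ [ a , iv ↦ v ]) → Run (a [ i ]≔ e) σ X Q
  run-assign {a} {i} {e} {σ} {X} iv v refl refl v≤ 1≤X bd q =
    ran ⇓assign (scale (factor (a [ i ]≔ e)) X 1≤X (cost≤ i bd ⊞ cost≤ e bd ⊞ size≤ i bd ⊞ size≤ e bd)) (Bounded-upd a iv bd v≤) q

  run-seq : ∀ {c₁ c₂ σ X Q R} → Run c₁ σ X Q →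
    (∀ σ′ → Bounded σ′ → Frame c₁ σ σ′ → Q σ′ → Run c₂ σ′ X R) → Run (c₁ ⨟ c₂) σ X R
  run-seq {c₁} {c₂} {X = X} (ran e t b q) k with k _ b (⇓-frame e) q
  ... | ran e′ t′ b′ r = ran (⇓seq e e′) (add (factor c₁) (factor c₂) X t t′) b′ r

  -- The intermediate assertion is that the continuation runs from the updated store, so
  -- straight-line code is executed symbolically and no assertion between assignments has to be
  -- stated.
  assign-then : ∀ {a i e c σ X Q} iv v → ⟦ i ⟧ σ ≡ iv → ⟦ e ⟧ σ ≡ v → v ≤ V → 1 ≤ X → Bounded σ →
    (Bounded (σ [ a , iv ↦ v ]) → Run c (σ [ a , iv ↦ v ]) X Q) → Run (a [ i ]≔ e ⨟ c) σ X Q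
  assign-then {a} {i} {e} {c} {σ} {X} {Q} iv v p q v≤ 1≤X bd k =
    run-seq {a [ i ]≔ e} {c} {σ} {X} {λ σ′ → Run c σ′ X Q} {Q}
      (run-assign iv v p q v≤ 1≤X bd (k (Bounded-upd a iv bd v≤))) (λ _ _ _ r → r)

  run-if : ∀ {e c₁ c₂ σ X Q} → 1 ≤ X → Bounded σ →
    (⟦ e ⟧ σ ≢ 0 → Run c₁ σ X Q) → (⟦ e ⟧ σ ≡ 0 → Run c₂ σ X Q) → Run (ifte e c₁ c₂) σ X Q
  run-if {e} {c₁} {c₂} {σ} {X} 1≤X bd f g with ⟦ e ⟧ σ ≟ 0
  ... | yes z with g z
  ...   | ran x t b q = ran (⇓else z x)
            (add (costFactor e + weight e) (factor c₁ + factor c₂) X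
              (scale (costFactor e + weight e) X 1≤X (cost≤ e bd ⊞ size≤ e bd))
              (t ≼⟫ *-monoˡ-≤ X (m≤n+m (factor c₂) (factor c₁)))) b q
  run-if {e} {c₁} {c₂} {σ} {X} 1≤X bd f g | no nz with f nz
  ...   | ran x t b q = ran (⇓then nz x)
            (add (costFactor e + weight e) (factor c₁ + factor c₂) X
              (scale (costFactor e + weight e) X 1≤X (cost≤ e bd ⊞ size≤ e bd))
              (t ≼⟫ *-monoˡ-≤ X (m≤m+n (factor c₁) (factor c₂)))) b q

  -- The first argument of the invariant is the work that may still be done.
  run-while : ∀ {e c σ} (I : ℕ → Store → Set) k → Bounded σ → I k σ →
    (∀ k σ′ → Bounded σ′ → Frame c σ σ′ → ⟦ e ⟧ σ′ ≢ 0 → I k σ′ →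
      ∃[ x ] 1 ≤ x × Run c σ′ x (λ σ″ → ∃[ k′ ] x + k′ ≤ k × I k′ σ″)) →
    Run (while e c) σ (suc k) (λ σ′ → ⟦ e ⟧ σ′ ≡ 0 × (∃[ k′ ] I k′ σ′))
  run-while {e} {c} {σ₀} I k bd i step = go k k ≤-refl σ₀ bd (frame-refl {c}) i
    where
      g = costFactor e + weight e
      go : ∀ fuel k → k ≤ fuel → ∀ σ → Bounded σ → Frame c σ₀ σ → I k σ →
           Run (while e c) σ (suc k) (λ σ′ → ⟦ e ⟧ σ′ ≡ 0 × (∃[ k′ ] I k′ σ′))
      go fuel k k≤ σ bd fr i with ⟦ e ⟧ σ ≟ 0
      -- The extra 1 in `suc k` pays for this last, failing test.
      ... | yes z = ran (⇓done z)
              (scale g (suc k) (s≤s z≤n) (cost≤ e bd ⊞ size≤ e bd) ≼⟫ *-monoˡ-≤ (suc k) (m≤m+n g (factor c))) bd (z , k , i)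
      ... | no nz with step k σ bd fr nz i
      ...   | suc x , s≤s _ , ran ex t b (k′ , le , i′) with fuel | k≤
      -- The body works at least 1, so an exhausted budget excludes another iteration, and the
      -- recursion on `fuel` ends.
      ...     | zero | z≤n = ⊥-elim (n≮0 le)
      ...     | suc fuel′ | k≤′ with go fuel′ k′ (≤-pred (≤-trans (≤-trans (s≤s (m≤n+m k′ x)) le) k≤′)) _ b (frame-trans {c} fr (⇓-frame {c} ex)) i′
      ...       | ran ex′ t′ b′ q = ran (⇓loop nz ex ex′) total b′ q
        where
          f = g + factor c
          total : _ ≼ f * suc k
          total = (scale g (suc x) (s≤s z≤n) (cost≤ e bd ⊞ size≤ e bd) ⊞ (t ⊞ t′)) ≼⟫ (begin
            g * suc x + (factor c * suc x + f * suc k′)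
              ≡⟨ lemma g (factor c) (suc x) (suc k′) ⟩
            f * (suc x + suc k′)
              ≤⟨ *-monoʳ-≤ f (≤-trans (≤-reflexive (+-suc (suc x) k′)) (s≤s le)) ⟩
            f * suc k ∎)
            where
              open ≤-Reasoning
              lemma : ∀ a b x y → a * x + (b * x + (a + b) * y) ≡ (a + b) * (x + y)
              lemma = solve-∀

  -- The invariant is indexed by the counter, and the budget for `run-while` is the part of
  -- `sum N X` still ahead. The bound `e` has to evaluate to `N` in every store that differs from
  -- the initial one only in arrays written by the loop.
  run-for : ∀ {a e c σ} (X : ℕ → ℕ) N (I : ℕ → Store → Set) →
    writes c a ≡ false → N ≤ V → Bounded σ →
    (∀ σ′ → Frame (for a e c) σ σ′ → ⟦ e ⟧ σ′ ≡ N) →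
    I 0 (σ [ a , 0 ↦ 0 ]) →
    (∀ i σ′ → i < N → σ′ a 0 ≡ i → Bounded σ′ → Frame (for a e c) σ σ′ → I i σ′ →
      1 ≤ X i × Run c σ′ (X i) (λ σ″ → I (suc i) (σ″ [ a , 0 ↦ suc i ]))) →
    Run (for a e c) σ (suc (sum N X)) (I N)
  run-for {a} {e} {c} {σ} X N I w N≤V bd guard init step =
    assign-then 0 0 refl refl z≤n (s≤s z≤n) bd λ bd₀ →
    weaken ≤-refl finish
      (run-while Inv (sum N X) bd₀ (0 , z≤n , at0 , +-identityʳ _ , fr₀ , init) body)
    where
      σ₀ = σ [ a , 0 ↦ 0 ]
      loop = c ⨟ a [ lit 0 ]≔ a ! lit 0 ⊕ lit 1
      Inv : ℕ → Store → Set
      Inv k σ′ = ∃[ i ] i ≤ N × σ′ a 0 ≡ i × k + sum i X ≡ sum N X × Frame (for a e c) σ σ′ × I i σ′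

      counter-set : ∀ (τ : Store) v → (τ [ a , 0 ↦ v ]) a 0 ≡ v
      counter-set τ v with a ≡ᵇ a in eq
      ... | true  = refl
      ... | false = ⊥-elim (subst T eq (≡⇒≡ᵇ a a refl))

      at0 : σ₀ a 0 ≡ 0
      at0 = counter-set σ 0

      fr₀ : Frame (for a e c) σ σ₀
      fr₀ = framed λ b wf j → ⇓-same (⇓assign {a} {lit 0} {lit 0} {σ}) b (∨-conicalˡ _ _ wf) j

      finish : ∀ σ′ → (⟦ e ⊖ a ! lit 0 ⟧ σ′ ≡ 0 × (∃[ k ] Inv k σ′)) → I N σ′
      finish σ′ (z , k , i , i≤N , at , _ , fr , inv) rewrite at | guard σ′ fr =
        subst (λ j → I j σ′) (≤-antisym i≤N (m∸n≡0⇒m≤n z)) inv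

      body : ∀ k σ′ → Bounded σ′ → Frame loop σ₀ σ′ → ⟦ e ⊖ a ! lit 0 ⟧ σ′ ≢ 0 → Inv k σ′ →
        ∃[ x ] 1 ≤ x × Run loop σ′ x (λ σ″ → ∃[ k′ ] x + k′ ≤ k × Inv k′ σ″)
      body k σ′ bd′ _ nz (i , i≤N , at , budget , fr , inv)
        with m≤n⇒m<n∨m≡n i≤N
      ... | inj₂ refl = ⊥-elim (nz (trans (cong₂ _∸_ (guard σ′ fr) at) (n∸n≡0 N)))
      ... | inj₁ i<N with step i σ′ i<N at bd′ fr inv
      ...   | 1≤x , r = X i , 1≤x , run-seq r λ σ″ bd″ fr″ inv″ →
              let at″ = trans (same fr″ a w 0) at in
              run-assign 0 (suc i) refl (trans (cong (_+ 1) at″) (+-comm i 1)) (≤-trans i<N N≤V) 1≤x bd″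
                (sum N X ∸ sum (suc i) X , enough , suc i , i<N , counter-set σ″ (suc i) ,
                 m∸n+n≡m (sum-mono-range X i<N) ,
                 framed (λ b wf j → trans (⇓-same (⇓assign {a} {lit 0} {lit (suc i)} {σ″}) b (∨-conicalˡ _ _ wf) j)
                    (trans (same fr″ b (∨-conicalˡ _ _ (∨-conicalʳ (a ≡ᵇ b) _ wf)) j) (same fr b wf j))) ,
                 inv″)
        where
          enough : X i + (sum N X ∸ sum (suc i) X) ≤ k
          enough = budget-step k (sum i X) (X i) budget (sum-mono-range X i<N)

below-suc : ∀ {j n} (P : ℕ → Set) → (∀ j → j < n → P j) → P n → j < suc n → P j
below-suc P p r j<1+n with m≤n⇒m<n∨m≡n (≤-pred j<1+n)
... | inj₁ j<n  = p _ j<n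
... | inj₂ refl = r

-- Updates of functions, definitionally the action of a store update on one array.

upd : (ℕ → ℕ) → ℕ → ℕ → ℕ → ℕ
upd f i x j = if i ≡ᵇ j then x else f j

upd-elim : ∀ f i x j (P : ℕ → Set) → (i ≡ j → P x) → (i ≢ j → P (f j)) → P (upd f i x j)
upd-elim f i x j P p q with i ≡ᵇ j in eq
... | true  = p (≡ᵇ⇒≡ i j (subst T (sym eq) _))
... | false = q λ i≡j → subst T eq (≡⇒≡ᵇ i j i≡j)

upd-same : ∀ f i x → upd f i x i ≡ x
upd-same f i x = upd-elim f i x i (_≡ x) (λ _ → refl) (λ i≢i → ⊥-elim (i≢i refl))

upd-other : ∀ f {i} x {j} → i ≢ j → upd f i x j ≡ f j
upd-other f {i} x {j} i≢j = upd-elim f i x j (_≡ f j) (λ e → ⊥-elim (i≢j e)) (λ _ → refl)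

sum-cong : ∀ n {f g} → (∀ i → i < n → f i ≡ g i) → sum n f ≡ sum n g
sum-cong zero    h = refl
sum-cong (suc n) h = cong₂ _+_ (sum-cong n λ i i<n → h i (m≤n⇒m≤1+n i<n)) (h n ≤-refl)

sum-mono : ∀ n {f g} → (∀ i → i < n → f i ≤ g i) → sum n f ≤ sum n g
sum-mono zero    h = z≤n
sum-mono (suc n) h = +-mono-≤ (sum-mono n λ i i<n → h i (m≤n⇒m≤1+n i<n)) (h n ≤-refl)

sum-const : ∀ n c → sum n (λ _ → c) ≡ n * c
sum-const zero    c = refl
sum-const (suc n) c = trans (cong (_+ c) (sum-const n c)) (+-comm (n * c) c)

sum-bound : ∀ n {f} c → (∀ i → i < n → f i ≤ c) → sum n f ≤ n * c
sum-bound n c h = ≤-trans (sum-mono n h) (≤-reflexive (sum-const n c))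

sum-+ : ∀ n f g → sum n (λ i → f i + g i) ≡ sum n f + sum n g
sum-+ zero    f g = refl
sum-+ (suc n) f g = trans (cong (_+ (f n + g n)) (sum-+ n f g)) (lemma (sum n f) (sum n g) (f n) (g n))
  where
    lemma : ∀ a b c d → a + b + (c + d) ≡ a + c + (b + d)
    lemma = solve-∀

sum-swap : ∀ m n (f : ℕ → ℕ → ℕ) → sum m (λ i → sum n (f i)) ≡ sum n (λ j → sum m (λ i → f i j))
sum-swap zero    n f = sym (trans (sum-const n 0) (*-zeroʳ n))
sum-swap (suc m) n f = trans (cong (_+ sum n (f m)) (sum-swap m n f)) (sym (sum-+ n _ (f m)))

sum-upd : ∀ n f {i} x → i < n → sum n (upd f i x) + f i ≡ sum n f + x
sum-upd (suc n) f {i} x i<1+n with i ≟ n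
... | yes refl rewrite upd-same f n x = begin
    sum n (upd f n x) + x + f n ≡⟨ cong (λ s → s + x + f n) (sum-cong n λ j j<n → upd-other f x (λ n≡j → <⇒≢ j<n (sym n≡j))) ⟩
    sum n f + x + f n           ≡⟨ lemma (sum n f) x (f n) ⟩
    sum n f + f n + x           ∎
    where
      open ≡-Reasoning
      lemma : ∀ a b c → a + b + c ≡ a + c + b
      lemma = solve-∀
... | no i≢n = begin
    sum n (upd f i x) + upd f i x n + f i ≡⟨ cong (λ y → sum n (upd f i x) + y + f i) (upd-other f x i≢n) ⟩
    sum n (upd f i x) + f n + f i         ≡⟨ lemma (sum n (upd f i x)) (f n) (f i) ⟩
    sum n (upd f i x) + f i + f n         ≡⟨ cong (_+ f n) (sum-upd n f x (≤∧≢⇒< (≤-pred i<1+n) i≢n)) ⟩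
    sum n f + x + f n                     ≡⟨ lemma (sum n f) x (f n) ⟩
    sum n f + f n + x                     ∎
    where
      open ≡-Reasoning
      lemma : ∀ a b c → a + b + c ≡ a + c + b
      lemma = solve-∀

-- Injections, counting and row-major addresses

InjectiveBelow : ℕ → (ℕ → ℕ) → Set
InjectiveBelow k q = ∀ i j → i < k → j < k → q i ≡ q j → i ≡ j

-- Induction on `k` after setting `f` to 0 at the last index `q k`: injectivity leaves the other
-- terms alone, and the sum over `n` drops by exactly `f (q k)`.
sum-injective : ∀ n k f q → (∀ i → i < k → q i < n) → InjectiveBelow k q → sum k (f ∘ q) ≤ sum n f
sum-injective n zero    f q q<n inj = z≤n
sum-injective n (suc k) f q q<n inj = begin
  sum k (f ∘ q) + f (q k)  ≡⟨ cong (_+ f (q k)) (sum-cong k λ i i<k → sym (upd-other f 0 λ eq → <⇒≢ i<k (sym (inj k i ≤-refl (m≤n⇒m≤1+n i<k) eq)))) ⟩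
  sum k (f′ ∘ q) + f (q k) ≤⟨ +-monoˡ-≤ (f (q k)) (sum-injective n k f′ q (λ i i<k → q<n i (m≤n⇒m≤1+n i<k)) λ i j i<k j<k → inj i j (m≤n⇒m≤1+n i<k) (m≤n⇒m≤1+n j<k)) ⟩
  sum n f′ + f (q k)       ≡⟨ sum-upd n f 0 (q<n k ≤-refl) ⟩
  sum n f + 0              ≡⟨ +-identityʳ _ ⟩
  sum n f                  ∎
  where
    open ≤-Reasoning
    f′ = upd f (q k) 0

term≤sum : ∀ n f {i} → i < n → f i ≤ sum n f
term≤sum n f {i} i<n = ≤-trans (sum-injective n 1 f (λ _ → i) (λ _ _ → i<n) (λ { zero zero _ _ _ → refl ; (suc _) _ (s≤s ()) _ _ ; zero (suc _) _ (s≤s ()) _ })) ≤-refl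

-- Positions inherit injectivity from the values found there. Bounds on queue lengths, truncated
-- lists and the number of arcs all take this shape.
pigeonhole : ∀ {a b} (t q : ℕ → ℕ) → InjectiveBelow a t →
  (∀ j → j < a → ∃[ p ] p < b × q p ≡ t j) → a ≤ b
pigeonhole {a} {b} t q inj pos = injective⇒≤ {f = f} f-inj
  where
    f : Fin a → Fin b
    f i = fromℕ< (proj₁ (proj₂ (pos (toℕ i) (toℕ<n i))))
    f-inj : ∀ {i j} → f i ≡ f j → i ≡ j
    f-inj {i} {j} eq with pos (toℕ i) (toℕ<n i) | pos (toℕ j) (toℕ<n j)
    ... | p , p<b , e | p′ , p′<b , e′ = toℕ-injective (inj _ _ (toℕ<n i) (toℕ<n j)
      (trans (sym e) (trans (cong q p≡p′) e′)))
      where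
        p≡p′ : p ≡ p′
        p≡p′ = trans (sym (toℕ-fromℕ< p<b)) (trans (cong toℕ eq) (toℕ-fromℕ< p′<b))

row-below : ∀ w {u u′ i j} → u < u′ → i < w → u * w + i < u′ * w + j
row-below w {u} {u′} {i} {j} u<u′ i<w = begin-strict
  u * w + i  <⟨ +-monoʳ-< (u * w) i<w ⟩
  u * w + w  ≡⟨ +-comm (u * w) w ⟩
  suc u * w  ≤⟨ *-monoˡ-≤ w u<u′ ⟩
  u′ * w     ≤⟨ m≤m+n _ j ⟩
  u′ * w + j ∎
  where open ≤-Reasoning

row-injective : ∀ w {u u′ i j} → i < w → j < w → u * w + i ≡ u′ * w + j → u ≡ u′ × i ≡ j
row-injective w {u} {u′} {i} {j} i<w j<w eq with <-cmp u u′
... | tri≈ _ refl _ = refl , +-cancelˡ-≡ (u * w) i j eq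
... | tri< u<u′ _ _ = ⊥-elim (<⇒≢ (row-below w u<u′ i<w) eq)
... | tri> _ _ u′<u = ⊥-elim (<⇒≢ (row-below w u′<u j<w) (sym eq))

-- Walks

Rel₂ : Set₁
Rel₂ = ℕ → ℕ → Set

-- Walks grow at the far end, as breadth-first search extends them, whereas `Walk` grows at the near
-- end. Vertices are plain numbers, as in memory.
data Path (A : Rel₂) (x : ℕ) : ℕ → ℕ → Set where
  nil  : Path A x x 0
  snoc : ∀ {u v k} → Path A x u k → A u v → Path A x v (suc k)

path-map : ∀ {A B : Rel₂} → (∀ {u v} → A u v → B u v) → ∀ {x y k} → Path A x y k → Path B x y k
path-map f nil        = nil
path-map f (snoc p e) = snoc (path-map f p) (f e)

infixr 5 _++ᵖ_
_++ᵖ_ : ∀ {A x y z k l} → Path A x y k → Path A y z l → Path A x z (l + k)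
p ++ᵖ nil      = p
p ++ᵖ snoc q e = snoc (p ++ᵖ q) e

path-cons : ∀ {A x y z k} → A x y → Path A y z k → Path A x z (suc k)
path-cons e nil        = snoc nil e
path-cons e (snoc p f) = snoc (path-cons e p) f

path-reverse : ∀ {A x y k} → Path A x y k → Path (flip A) y x k
path-reverse nil        = nil
path-reverse (snoc p e) = path-cons e (path-reverse p)

path-split : ∀ {A x y} i j → Path A x y (j + i) → ∃[ u ] Path A x u i × Path A u y j
path-split i zero    p          = _ , p , nil
path-split i (suc j) (snoc p e) with path-split i j p
... | u , p₁ , p₂ = u , p₁ , snoc p₂ e

-- Breadth-first search.  The array d holds distances plus one, 0 meaning
-- unvisited, and q is the queue, of which t cells have been filled.

module BFS (n : ℕ) (deg : ℕ → ℕ) (nb : ℕ → ℕ → ℕ) (x : ℕ) where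

  Nb : Rel₂
  Nb u v = ∃[ j ] j < deg u × nb u j ≡ v

  -- `mono` is the level order of the queue. `small` keeps levels below positions; it bounds the
  -- numbers stored and later the radii.
  record Queue (d q : ℕ → ℕ) (t : ℕ) : Set where
    field
      q<n   : ∀ i → i < t → q i < n
      inj   : InjectiveBelow t q
      vis   : ∀ v → v < n → d v ≢ 0 → ∃[ i ] i < t × q i ≡ v
      walk  : ∀ i → i < t → ∃[ k ] d (q i) ≡ suc k × Path Nb x (q i) k
      mono  : ∀ i j → i ≤ j → j < t → d (q i) ≤ d (q j)
      small : ∀ i → i < t → d (q i) ≤ suc i
      0<t   : 0 < t
      q0    : q 0 ≡ x

    t≤n : t ≤ n
    t≤n = pigeonhole q (λ i → i) inj λ j j<t → q j , q<n j j<t , refl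

    visited : ∀ i → i < t → d (q i) ≢ 0
    visited i i<t eq with walk i i<t
    ... | k , e , _ with trans (sym eq) e
    ... | ()

  -- The two-level property: with the head at `i`, nothing queued lies more than one level beyond
  -- it. The guard `i < t` lets it survive the moment when the queue is exhausted.
  Near : (d q : ℕ → ℕ) (t i : ℕ) → Set
  Near d q t i = i < t → ∀ j → j < t → d (q j) ≤ suc (d (q i))

  Reached : (d : ℕ → ℕ) (u v : ℕ) → Set
  Reached d u v = d v ≢ 0 × d v ≤ suc (d u)

  Done : (d q : ℕ → ℕ) (i : ℕ) → Set
  Done d q i = ∀ j → j < i → ∀ l → l < deg (q j) → Reached d (q j) (nb (q j) l)

  Part : (d : ℕ → ℕ) (u l : ℕ) → Set
  Part d u l = ∀ l′ → l′ < l → Reached d u (nb u l′)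

  near-suc : ∀ {d q t i} → Queue d q t → Near d q t i → Near d q t (suc i)
  near-suc {d} {q} {t} {i} Qu nr i<t j j<t =
    ≤-trans (nr (<⇒≤ i<t) j j<t) (s≤s (Queue.mono Qu i (suc i) (n≤1+n i) i<t))

  done-suc : ∀ {d q i} → Done d q i → Part d (q i) (deg (q i)) → Done d q (suc i)
  done-suc {i = i} dn pt j j<1+i with m≤n⇒m<n∨m≡n (≤-pred j<1+i)
  ... | inj₁ j<i  = dn j j<i
  ... | inj₂ refl = pt

  already : ∀ {d q t i v} → Queue d q t → Near d q t i → i < t → v < n → d v ≢ 0 → Reached d (q i) v
  already {d} {q} {t} {i} {v} Qu nr i<t v<n nz with Queue.vis Qu v v<n nz
  ... | j , j<t , refl = nz , nr i<t j j<t

  module Discover {d q t i v} (Qu : Queue d q t) (nr : Near d q t i) (i<t : i < t)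
      (v<n : v < n) (new : d v ≡ 0) where
    open Queue Qu

    d′ q′ : ℕ → ℕ
    d′ = upd d v (suc (d (q i)))
    q′ = upd q t v

    old-d : ∀ {w} → d w ≢ 0 → d′ w ≡ d w
    old-d nz = upd-other d {v} (suc (d (q i))) λ { refl → nz new }

    old-q : ∀ {j} → j < t → q′ j ≡ q j
    old-q j<t = upd-other q {t} v λ { refl → <-irrefl refl j<t }

    old-dq : ∀ {j} → j < t → d′ (q′ j) ≡ d (q j)
    old-dq j<t rewrite old-q j<t = old-d (visited _ j<t)

    new-dq : d′ (q′ t) ≡ suc (d (q i))
    new-dq rewrite upd-same q t v = upd-same d v _

    reached : ∀ {u w} → d u ≢ 0 → Reached d u w → Reached d′ u w
    reached nz (w≢0 , le) rewrite old-d w≢0 | old-d nz = w≢0 , le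

    reached-new : Reached d′ (q i) v
    reached-new rewrite upd-same d v (suc (d (q i))) | old-d (visited i i<t) = (λ ()) , ≤-refl

    done : Done d q i → Done d′ q′ i
    done dn j j<i rewrite old-q (<-trans j<i i<t) = λ l l<deg → reached (visited j (<-trans j<i i<t)) (dn j j<i l l<deg)

    near : Near d′ q′ (suc t) i
    near _ j j<1+t rewrite old-dq i<t =
      below-suc (λ j → d′ (q′ j) ≤ suc (d (q i)))
        (λ j j<t → ≤-trans (≤-reflexive (old-dq j<t)) (nr i<t j j<t)) (≤-reflexive new-dq) j<1+t

    queue : Nb (q i) v → Queue d′ q′ (suc t)
    queue edge = record
      { q<n   = λ j → below-suc (λ j → q′ j < n)
                  (λ j j<t → subst (_< n) (sym (old-q j<t)) (q<n j j<t))
                  (subst (_< n) (sym (upd-same q t v)) v<n)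
      ; inj   = λ a b a< b< → below-suc (λ a → q′ a ≡ q′ b → a ≡ b)
                  (λ a a<t → below-suc (λ b → q′ a ≡ q′ b → a ≡ b)
                     (λ b b<t eq → inj a b a<t b<t (trans (sym (old-q a<t)) (trans eq (old-q b<t))))
                     (λ eq → ⊥-elim (visited a a<t (trans (cong d (trans (sym (old-q a<t)) (trans eq (upd-same q t v)))) new)))
                     b<)
                  (below-suc (λ b → q′ t ≡ q′ b → t ≡ b)
                     (λ b b<t eq → ⊥-elim (visited b b<t (trans (cong d (trans (sym (old-q b<t)) (trans (sym eq) (upd-same q t v)))) new)))
                     (λ _ → refl) b<)
                  a<
      ; vis   = λ w w<n nz → vis′ w w<n nz
      ; walk  = λ j → below-suc (λ j → ∃[ k ] d′ (q′ j) ≡ suc k × Path Nb x (q′ j) k)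
                  (λ j j<t → let k , e , p = walk j j<t in
                     k , trans (old-dq j<t) e , subst (λ y → Path Nb x y k) (sym (old-q j<t)) p)
                  (let k , e , p = walk i i<t in
                     suc k , trans new-dq (cong suc e) ,
                     subst (λ y → Path Nb x y (suc k)) (sym (upd-same q t v)) (snoc p edge))
      ; mono  = λ a b a≤b b< → below-suc (λ b → a ≤ b → d′ (q′ a) ≤ d′ (q′ b))
                  (λ b b<t a≤b → subst₂ _≤_ (sym (old-dq (≤-<-trans a≤b b<t))) (sym (old-dq b<t)) (mono a b a≤b b<t))
                  (λ a≤t → ≤-trans (near (m≤n⇒m≤1+n i<t) a (s≤s a≤t)) (≤-reflexive (trans (cong suc (old-dq i<t)) (sym new-dq))))
                  b< a≤b
      ; small = λ j → below-suc (λ j → d′ (q′ j) ≤ suc j)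
                  (λ j j<t → ≤-trans (≤-reflexive (old-dq j<t)) (small j j<t))
                  (≤-trans (≤-reflexive new-dq) (s≤s (≤-trans (small i i<t) i<t)))
      ; 0<t   = s≤s z≤n
      ; q0    = trans (old-q 0<t) q0
      }
      where
        vis′ : ∀ w → w < n → d′ w ≢ 0 → ∃[ j ] j < suc t × q′ j ≡ w
        vis′ w w<n nz with v ≟ w
        ... | yes refl = t , ≤-refl , upd-same q t v
        ... | no v≢w with vis w w<n (λ e → nz (trans (upd-other d _ v≢w) e))
        ... | j , j<t , e = j , m≤n⇒m≤1+n j<t , trans (old-q j<t) e

  start : ∀ {d q} → (∀ v → v < n → d v ≡ 0) → x < n → Queue (upd d x 1) (upd q 0 x) 1
  start {d} {q} zero-d x<n = record
    { q<n   = λ { zero _ → x<n ; (suc _) (s≤s ()) }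
    ; inj   = λ { zero zero _ _ _ → refl ; zero (suc _) _ (s≤s ()) _ ; (suc _) _ (s≤s ()) _ _ }
    ; vis   = λ v v<n nz → 0 , s≤s z≤n , upd-elim d x 1 v (λ y → y ≢ 0 → x ≡ v) (λ e _ → e) (λ _ nz → ⊥-elim (nz (zero-d v v<n))) nz
    ; walk  = λ { zero _ → 0 , upd-same d x 1 , nil ; (suc _) (s≤s ()) }
    ; mono  = λ { zero zero _ _ → ≤-refl ; _ (suc _) _ (s≤s ()) }
    ; small = λ { zero _ → ≤-reflexive (upd-same d x 1) ; (suc _) (s≤s ()) }
    ; 0<t   = s≤s z≤n
    ; q0    = refl
    }

  record Result (d q : ℕ → ℕ) (t : ℕ) : Set where
    field
      queue    : Queue d q t
      complete : ∀ {v k} → Path Nb x v k → ∃[ i ] i < t × q i ≡ v × d v ≤ suc k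

  -- Induction along a walk: a processed vertex has all its neighbours queued, at most one level
  -- further, and at the end every queued vertex is processed.
  result : ∀ {d q t} → Queue d q t → Done d q t → (∀ u j → u < n → j < deg u → nb u j < n) → Result d q t
  result {d} {q} {t} Qu dn nb<n = record { queue = Qu ; complete = complete }
    where
      open Queue Qu
      complete : ∀ {v k} → Path Nb x v k → ∃[ i ] i < t × q i ≡ v × d v ≤ suc k
      complete nil = 0 , 0<t , q0 , subst (λ y → d y ≤ 1) q0 (small 0 0<t)
      complete (snoc p (l , l<deg , refl)) with complete p
      ... | i , i<t , refl , le with dn i i<t l l<deg
      ... | nz , le′ with vis _ (nb<n _ l (q<n i i<t) l<deg) nz
      ... | j , j<t , e = j , j<t , e , ≤-trans le′ (s≤s le)

-- Adjacency lists, cut off after the first lim entries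

record EdgeList (n w : ℕ) (tl hd : ℕ → ℕ) : Set where
  field
    tl<n   : ∀ e → e < w → tl e < n
    hd<n   : ∀ e → e < w → hd e < n
    simple : ∀ e f → e < w → f < w → tl e ≡ tl f → hd e ≡ hd f → e ≡ f

Edge : ℕ → (ℕ → ℕ) → (ℕ → ℕ) → Rel₂
Edge w tl hd u v = ∃[ e ] e < w × tl e ≡ u × hd e ≡ v

module Adjacency (n w lim : ℕ) (tl hd : ℕ → ℕ) (E : EdgeList n w tl hd) where
  open EdgeList E

  -- `kept` is what truncation preserves: an arc is missing only if the list of its tail is full.
  -- The clause `lim < w` rules this out for `lim = w`, so one routine also serves the full
  -- searches.
  record Lists (e : ℕ) (deg adj : ℕ → ℕ) : Set where
    field
      deg≤e   : ∀ u → u < n → deg u ≤ e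
      deg≤lim : ∀ u → u < n → deg u ≤ lim
      total   : sum n deg ≤ e
      source  : ∀ u j → u < n → j < deg u → ∃[ f ] f < e × tl f ≡ u × hd f ≡ adj (u * w + j)
      inj     : ∀ u → u < n → InjectiveBelow (deg u) (λ j → adj (u * w + j))
      kept    : ∀ f → f < e → (∃[ j ] j < deg (tl f) × adj (tl f * w + j) ≡ hd f)
                            ⊎ (deg (tl f) ≡ lim × lim < w)

  lists-zero : ∀ {deg adj} → (∀ u → u < n → deg u ≡ 0) → Lists 0 deg adj
  lists-zero {deg} z = record
    { deg≤e   = λ u u<n → ≤-reflexive (z u u<n)
    ; deg≤lim = λ u u<n → ≤-trans (≤-reflexive (z u u<n)) z≤n
    ; total   = ≤-trans (sum-bound n 0 λ u u<n → ≤-reflexive (z u u<n)) (≤-reflexive (*-zeroʳ n))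
    ; source  = λ u j u<n j<deg → ⊥-elim (n≮0 (subst (j <_) (z u u<n) j<deg))
    ; inj     = λ u u<n i j i< → ⊥-elim (n≮0 (subst (i <_) (z u u<n) i<))
    ; kept    = λ _ ()
    }

  lists-cong : ∀ {e deg deg′ adj adj′} → (∀ u → deg′ u ≡ deg u) → (∀ a → adj′ a ≡ adj a) →
    Lists e deg adj → Lists e deg′ adj′
  lists-cong {e} dg ad L = record
    { deg≤e   = λ u u<n → subst (_≤ e) (sym (dg u)) (deg≤e u u<n)
    ; deg≤lim = λ u u<n → subst (_≤ lim) (sym (dg u)) (deg≤lim u u<n)
    ; total   = subst (_≤ e) (sum-cong n λ u _ → sym (dg u)) total
    ; source  = λ u j u<n j< → let f , f< , t , h = source u j u<n (subst (j <_) (dg u) j<) in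
                  f , f< , t , trans h (sym (ad _))
    ; inj     = λ u u<n i j i< j< eq → inj u u<n i j (subst (i <_) (dg u) i<) (subst (j <_) (dg u) j<)
                  (trans (sym (ad _)) (trans eq (ad _)))
    ; kept    = λ f f< → map-⊎ (λ (j , j< , h) → j , subst (j <_) (sym (dg _)) j< , trans (ad _) h)
                  (λ (full , lt) → trans (dg _) full , lt) (kept f f<)
    }
    where open Lists L

  lists-skip : ∀ {e deg adj} → Lists e deg adj → e < w → lim ≤ deg (tl e) → Lists (suc e) deg adj
  lists-skip {e} L e<w full = record
    { deg≤e   = λ u u<n → m≤n⇒m≤1+n (deg≤e u u<n)
    ; deg≤lim = deg≤lim
    ; total   = m≤n⇒m≤1+n total
    ; source  = λ u j u<n j< → let f , f< , p = source u j u<n j< in f , m≤n⇒m≤1+n f< , p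
    ; inj     = inj
    ; kept    = λ f → below-suc _ kept
        (inj₂ (≤-antisym (deg≤lim _ (tl<n e e<w)) full ,
               ≤-<-trans (≤-trans full (deg≤e _ (tl<n e e<w))) e<w))
    }
    where open Lists L

  module Add {e deg adj} (L : Lists e deg adj) (e<w : e < w) (room : deg (tl e) < lim) where
    open Lists L
    u₀ = tl e
    deg′ adj′ : ℕ → ℕ
    deg′ = upd deg u₀ (suc (deg u₀))
    adj′ = upd adj (u₀ * w + deg u₀) (hd e)

    u₀<n = tl<n e e<w
    deg₀<w : deg u₀ < w
    deg₀<w = ≤-<-trans (deg≤e u₀ u₀<n) e<w

    old-adj : ∀ {u j} → u < n → j < deg u → adj′ (u * w + j) ≡ adj (u * w + j)
    old-adj {u} {j} u<n j<deg = upd-other adj {u₀ * w + deg u₀} (hd e) λ eq →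
      let u≡ , j≡ = row-injective w {u₀} {u} deg₀<w (<-trans j<deg (≤-<-trans (deg≤e u u<n) e<w)) eq in
      <-irrefl (trans (sym j≡) (cong deg u≡)) j<deg

    new-adj : adj′ (u₀ * w + deg u₀) ≡ hd e
    new-adj = upd-same adj (u₀ * w + deg u₀) (hd e)

    deg-elim : ∀ {u} (P : ℕ → ℕ → Set) → P u₀ (suc (deg u₀)) → (u₀ ≢ u → P u (deg u)) → P u (deg′ u)
    deg-elim {u} P p r = upd-elim deg u₀ _ u (P u) (λ { refl → p }) r

    -- Simplicity of the graph keeps the entries of a list distinct; counting `s` different
    -- neighbours in `crowded` rests on this.
    fresh : ∀ j → j < deg u₀ → adj (u₀ * w + j) ≢ hd e
    fresh j j< eq with source u₀ j u₀<n j<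
    ... | f , f<e , t , h = <⇒≢ f<e (simple f e (<-trans f<e e<w) e<w t (trans h eq))

    lists-add : Lists (suc e) deg′ adj′
    lists-add = record
      { deg≤e   = λ u u<n → deg-elim (λ _ x → x ≤ suc e) (s≤s (deg≤e u₀ u₀<n)) (λ _ → m≤n⇒m≤1+n (deg≤e u u<n))
      ; deg≤lim = λ u u<n → deg-elim (λ _ x → x ≤ lim) room (λ _ → deg≤lim u u<n)
      ; total   = +-cancelʳ-≤ (deg u₀) _ _ (≤-trans (≤-reflexive (sum-upd n deg (suc (deg u₀)) u₀<n))
                    (≤-trans (≤-reflexive (+-suc (sum n deg) (deg u₀))) (+-monoˡ-≤ (deg u₀) (s≤s total))))
      ; source  = λ u j u<n → deg-elim (λ u x → j < x → ∃[ f ] f < suc e × tl f ≡ u × hd f ≡ adj′ (u * w + j))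
                    (below-suc (λ j → ∃[ f ] f < suc e × tl f ≡ u₀ × hd f ≡ adj′ (u₀ * w + j))
                      (λ j j< → old u₀ j u₀<n j<) (e , ≤-refl , refl , sym new-adj))
                    (λ _ → old u j u<n)
      ; inj     = λ u u<n i j → deg-elim (λ u x → i < x → j < x → adj′ (u * w + i) ≡ adj′ (u * w + j) → i ≡ j)
                    (λ i< j< → below-suc (λ i → adj′ (u₀ * w + i) ≡ adj′ (u₀ * w + j) → i ≡ j)
                      (λ i i< → below-suc (λ j → adj′ (u₀ * w + i) ≡ adj′ (u₀ * w + j) → i ≡ j)
                         (λ j j< → old-inj u₀ u₀<n i j i< j<)
                         (λ eq → ⊥-elim (fresh i i< (trans (sym (old-adj u₀<n i<)) (trans eq new-adj)))) j<)
                      (below-suc (λ j → adj′ (u₀ * w + deg u₀) ≡ adj′ (u₀ * w + j) → deg u₀ ≡ j)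
                         (λ j j< eq → ⊥-elim (fresh j j< (trans (sym (old-adj u₀<n j<)) (trans (sym eq) new-adj))))
                         (λ _ → refl) j<)
                      i<)
                    (λ _ → old-inj u u<n i j)
      ; kept    = λ f → below-suc (λ f → (∃[ j ] j < deg′ (tl f) × adj′ (tl f * w + j) ≡ hd f) ⊎ (deg′ (tl f) ≡ lim × lim < w))
                    old-kept
                    (inj₁ (deg u₀ , deg-elim (λ _ x → deg u₀ < x) ≤-refl (λ ne → ⊥-elim (ne refl)) , new-adj))
      }
      where
        old : ∀ u j → u < n → j < deg u → ∃[ f ] f < suc e × tl f ≡ u × hd f ≡ adj′ (u * w + j)
        old u j u<n j< with source u j u<n j<
        ... | f , f< , t , h = f , m≤n⇒m≤1+n f< , t , trans h (sym (old-adj u<n j<))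
        old-inj : ∀ u → u < n → ∀ i j → i < deg u → j < deg u → adj′ (u * w + i) ≡ adj′ (u * w + j) → i ≡ j
        old-inj u u<n i j i< j< eq = inj u u<n i j i< j< (trans (sym (old-adj u<n i<)) (trans eq (old-adj u<n j<)))
        old-kept : ∀ f → f < e → _
        old-kept f f<e with kept f f<e
        ... | inj₁ (j , j< , h) = inj₁ (j , deg-elim (λ u x → j < deg u → j < x) m≤n⇒m≤1+n (λ _ j< → j<) j< ,
                                        trans (old-adj (tl<n f (<-trans f<e e<w)) j<) h)
        ... | inj₂ (eq , lt) = inj₂ (deg-elim (λ u x → deg u ≡ lim → x ≡ lim) (λ eq → ⊥-elim (<⇒≢ room eq)) (λ _ eq → eq) eq , lt)

-- Balls

-- The radius is `dist (s ∸ 1)`, attained by the last entry. All strictly nearer vertices belong to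
-- the ball; at the radius itself membership depends on the order of the lists.
record Ball (A : Rel₂) (n s x : ℕ) (row dist : ℕ → ℕ) : Set where
  field
    row<n  : ∀ j → j < s → row j < n
    inj    : InjectiveBelow s row
    dist≤n : ∀ j → j < s → dist j ≤ n
    walk   : ∀ j → j < s → Path A x (row j) (dist j)
    radius : ∀ j → j < s → dist j ≤ dist (s ∸ 1)
    pos    : 1 ≤ dist (s ∸ 1)
    cover  : ∀ {u i} → Path A x u i → i < dist (s ∸ 1) → ∃[ j ] j < s × row j ≡ u × dist j ≤ i

module SearchLists (n w lim : ℕ) (tl hd : ℕ → ℕ) (E : EdgeList n w tl hd) {deg adj : ℕ → ℕ}
    (L : Adjacency.Lists n w lim tl hd E w deg adj) {x : ℕ} (x<n : x < n) where
  open BFS n deg (λ u j → adj (u * w + j)) x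
  open EdgeList E
  open Adjacency.Lists L

  nb<n : ∀ u j → u < n → j < deg u → adj (u * w + j) < n
  nb<n u j u<n j< with source u j u<n j<
  ... | f , f<w , _ , h = subst (_< n) h (hd<n f f<w)

  Nb-path : ∀ {v k} → Path Nb x v k → Path (Edge w tl hd) x v k × v < n
  Nb-path nil = nil , x<n
  Nb-path (snoc p (j , j< , refl)) with Nb-path p
  ... | p′ , u<n = snoc p′ (source _ j u<n j<) , nb<n _ j u<n j<

  distance : w ≤ lim → ∀ {d q t} → Result d q t → ∀ {v k} → Path (Edge w tl hd) x v k →
    d v ∸ 1 ≤ k × Path (Edge w tl hd) x v (d v ∸ 1)
  distance w≤lim {d} {q} {t} R {v} {k} p with complete (path-map Edge⇒Nb p)
    where
      open Result R
      Edge⇒Nb : ∀ {u v} → Edge w tl hd u v → Nb u v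
      Edge⇒Nb (f , f<w , refl , refl) with kept f f<w
      ... | inj₁ r       = r
      ... | inj₂ (_ , l) = ⊥-elim (<⇒≱ l w≤lim)
  ... | i , i<t , refl , le with Queue.walk (Result.queue R) i i<t
  ... | l , e , p′ rewrite e = ≤-pred le , proj₁ (Nb-path p′)

module Truncated (n w s : ℕ) (tl hd : ℕ → ℕ) (E : EdgeList n w tl hd) {deg adj : ℕ → ℕ}
    (L : Adjacency.Lists n w s tl hd E w deg adj) (2≤s : 2 ≤ s) (s≤n : s ≤ n)
    {x : ℕ} (x<n : x < n) (connected : ∀ y → y < n → ∃[ k ] Path (Edge w tl hd) x y k)
    {d q : ℕ → ℕ} {t : ℕ} (R : BFS.Result n deg (λ u j → adj (u * w + j)) x d q t) where
  open BFS n deg (λ u j → adj (u * w + j)) x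
  open EdgeList E
  open Adjacency.Lists L using (deg≤lim; source; kept) renaming (inj to adj-inj)
  open Result R
  open Queue queue

  private
    A = Edge w tl hd

  open SearchLists n w s tl hd E L x<n using (Nb-path)

  -- If a neighbour of u was cut off, then u has s neighbours in the truncated
  -- graph, too many to fit into a queue prefix shorter than s.
  crowded : ∀ {i b} → i < t → b < s → (∀ {v} → Nb (q i) v → ∃[ p ] p < b × q p ≡ v) →
    ∀ {v} → A (q i) v → Nb (q i) v
  crowded {i} {b} i<t b<s pos (f , f<w , src , refl) with kept f f<w
  ... | inj₁ (j , j< , h) = subst (λ u → Nb u (hd f)) src (j , j< , h)
  ... | inj₂ (full , _) = ⊥-elim (<⇒≱ b<s (≤-trans (≤-reflexive (trans (sym full) (cong deg src)))
          (pigeonhole (λ j → adj (q i * w + j)) q (adj-inj (q i) (q<n i i<t)) λ j j< → pos (j , j< , refl))))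

  -- Had the search ended with fewer than `s` queued vertices, no queued vertex could have lost an
  -- arc. The queue would then be closed under all arcs and, by connectedness, contain all `n ≥ s`
  -- vertices.
  s≤t : s ≤ t
  s≤t with s ≤? t
  ... | yes p = p
  ... | no ¬p = ⊥-elim (¬p (≤-trans s≤n
          (pigeonhole (λ v → v) q (λ _ _ _ _ e → e) λ v v<n → reach (proj₂ (connected v v<n)))))
    where
      reach : ∀ {v k} → Path A x v k → ∃[ p ] p < t × q p ≡ v
      reach nil = 0 , 0<t , q0
      reach (snoc p e) with reach p
      ... | i , i<t , refl = let j , j<t , e′ , _ = complete (snoc (proj₂ (proj₂ (walk i i<t))) (crowded i<t (≰⇒> ¬p)
                                     (λ e → let j , j<t , e′ , _ = complete (snoc (proj₂ (proj₂ (walk i i<t))) e) in j , j<t , e′) e)) in j , j<t , e′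

  private
    s₁ = s ∸ 1
    s₁<s : s₁ < s
    s₁<s = ≤-reflexive (trans (sym (+-comm s₁ 1)) (m∸n+n≡m (<⇒≤ 2≤s)))

  early : ∀ {i k} → i < t → d (q i) ≤ suc k → k < d (q s₁) ∸ 1 → i < s₁
  early {i} {k} i<t le lt with i <? s₁
  ... | yes p = p
  ... | no ¬p = ⊥-elim (<⇒≱ lt (≤-trans (∸-monoˡ-≤ 1 (mono s₁ i (≮⇒≥ ¬p) i<t)) (∸-monoˡ-≤ 1 le)))

  -- Induction along a walk in the full graph. Below the radius, the truncated neighbours of a
  -- vertex on it are queued before position `s ∸ 1`. They are fewer than `s`, so by `crowded` its
  -- list was not cut and the next arc of the walk is present.
  cover : ∀ {u k} → Path A x u k → k < d (q s₁) ∸ 1 → ∃[ j ] j < s × q j ≡ u × d (q j) ∸ 1 ≤ k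
  cover nil lt = 0 , <⇒≤ 2≤s , q0 , ∸-monoˡ-≤ 1 (small 0 0<t)
  cover {k = suc k} (snoc p e) lt with cover p (<-trans ≤-refl lt)
  ... | i , i<s , refl , le = finish (complete (snoc (trunc-path i i<s) (crowded i<t s₁<s (λ e → prefix e) e)))
    where
      i<t = <-≤-trans i<s s≤t
      trunc-path : ∀ i → i < s → Path Nb x (q i) (d (q i) ∸ 1)
      trunc-path i i<s with walk i (<-≤-trans i<s s≤t)
      ... | k , e , p rewrite e = p
      near : ∀ {v} → Nb (q i) v → ∃[ j ] j < s₁ × q j ≡ v × d (q j) ≤ suc (suc k)
      near e with complete (snoc (trunc-path i i<s) e)
      ... | j , j<t , refl , le′ = j , early j<t (≤-trans le′ (s≤s (s≤s le))) lt , refl , ≤-trans le′ (s≤s (s≤s le))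
      prefix : ∀ {v} → Nb (q i) v → ∃[ p ] p < s₁ × q p ≡ v
      prefix e = let j , j< , e′ , _ = near e in j , j< , e′
      finish : ∀ {v} → ∃[ j ] j < t × q j ≡ v × d v ≤ suc (suc (d (q i) ∸ 1)) → ∃[ j ] j < s × q j ≡ v × d (q j) ∸ 1 ≤ suc k
      finish (j , j<t , refl , le′) = j , <-trans (early j<t le″ lt) s₁<s , refl , ∸-monoˡ-≤ 1 le″
        where le″ = ≤-trans le′ (s≤s (s≤s le))

  ball : Ball A n s x q (λ j → d (q j) ∸ 1)
  ball = record
    { row<n  = λ j j<s → q<n j (<-≤-trans j<s s≤t)
    ; inj    = λ i j i<s j<s → inj i j (<-≤-trans i<s s≤t) (<-≤-trans j<s s≤t)
    ; dist≤n = λ j j<s → ≤-trans (∸-monoˡ-≤ 1 (small j (<-≤-trans j<s s≤t))) (≤-trans (<⇒≤ j<s) s≤n)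
    ; walk   = λ j j<s → let k , e , p = walk j (<-≤-trans j<s s≤t) in
                 subst (λ y → Path A x (q j) (y ∸ 1)) (sym e) (proj₁ (Nb-path p))
    ; radius = λ j j<s → ∸-monoˡ-≤ 1 (mono j s₁ (≤-pred (≤-trans j<s (≤-reflexive (sym (trans (+-comm 1 s₁) (m∸n+n≡m (<⇒≤ 2≤s))))))) (<-≤-trans s₁<s s≤t))
    ; pos    = pos
    ; cover  = cover
    }
    where
      pos : 1 ≤ d (q s₁) ∸ 1
      pos with walk s₁ (<-≤-trans s₁<s s≤t)
      ... | suc k , e , _ rewrite e = s≤s z≤n
      -- Level 0 would make the last of at least two distinct entries equal to the source.
      ... | zero , e , p = ⊥-elim (<⇒≢ (∸-monoˡ-≤ 1 2≤s) (inj 0 s₁ 0<t (<-≤-trans s₁<s s≤t) (trans q0 (stay p))))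
        where
          stay : ∀ {y} → Path Nb x y 0 → x ≡ y
          stay nil = refl

ball-map : ∀ {A B : Rel₂} {n s x row dist} → (∀ {u v} → A u v → B u v) → (∀ {u v} → B u v → A u v) →
  Ball A n s x row dist → Ball B n s x row dist
ball-map f g B = record
  { row<n = row<n ; inj = inj ; dist≤n = dist≤n ; walk = λ j j<s → path-map f (walk j j<s)
  ; radius = radius ; pos = pos ; cover = λ p → cover (path-map g p) }
  where open Ball B

ball-cong : ∀ {A n s x row row′ dist dist′} → 1 ≤ s → (∀ j → j < s → row′ j ≡ row j) → (∀ j → j < s → dist′ j ≡ dist j) →
  Ball A n s x row dist → Ball A n s x row′ dist′
ball-cong {A} {n} {s} {x} {row} {row′} {dist} {dist′} 1≤s r d B = record
  { row<n  = λ j j<s → subst (_< n) (sym (r j j<s)) (row<n j j<s)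
  ; inj    = λ i j i<s j<s e → inj i j i<s j<s (trans (sym (r i i<s)) (trans e (r j j<s)))
  ; dist≤n = λ j j<s → subst (_≤ n) (sym (d j j<s)) (dist≤n j j<s)
  ; walk   = λ j j<s → subst₂ (Path A x) (sym (r j j<s)) (sym (d j j<s)) (walk j j<s)
  ; radius = λ j j<s → subst₂ _≤_ (sym (d j j<s)) (sym (d (s ∸ 1) last<s)) (radius j j<s)
  ; pos    = subst (1 ≤_) (sym (d (s ∸ 1) last<s)) pos
  ; cover  = λ {u} {i} p lt → let j , j<s , e , le = cover p (subst (i <_) (d (s ∸ 1) last<s) lt) in
               j , j<s , trans (r j j<s) e , subst (_≤ i) (sym (d j j<s)) le
  }
  where
    open Ball B
    last<s : s ∸ 1 < s
    last<s = ≤-reflexive (trans (+-comm 1 (s ∸ 1)) (m∸n+n≡m 1≤s))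

-- The estimate for one pair of vertices

-- A partial minimum during the double scan, with `P` holding of the index pairs already tried. It
-- is known to stay below the distance only once all pairs are tried; `real` is what makes the final
-- value large for a pair that is far apart.
record Estimate (A : Rel₂) (s x y : ℕ) (rx dx ry dy : ℕ → ℕ) (P : ℕ → ℕ → Set) (e : ℕ) : Set where
  field
    cap   : e ≤ dx (s ∸ 1) + dy (s ∸ 1)
    tried : ∀ i j → P i j → i < s → j < s → A (rx i) (ry j) → e ≤ dx i + dy j + 1
    real  : e ≡ dx (s ∸ 1) + dy (s ∸ 1) ⊎ Path A x y e

estimate-weaken : ∀ {A s x y rx dx ry dy e} {P P′ : ℕ → ℕ → Set} →
  (∀ i j → i < s → j < s → P′ i j → P i j) →
  Estimate A s x y rx dx ry dy P e → Estimate A s x y rx dx ry dy P′ e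
estimate-weaken f est = record
  { cap = cap ; tried = λ i j p i<s j<s → tried i j (f i j i<s j<s p) i<s j<s ; real = real }
  where open Estimate est

-- `e ∸ (e ∸ c)` is the minimum of `e` and `c`, computed without a test.
∸∸≤ : ∀ e c → e ∸ (e ∸ c) ≤ c
∸∸≤ e c = m≤n+o⇒m∸n≤o e (e ∸ c) (≤-trans (m≤n+m∸n e c) (≤-reflexive (+-comm c _)))

estimate-step : ∀ {A n s x y rx dx ry dy e i j mat} {P : ℕ → ℕ → Set} →
  Ball A n s x rx dx → Ball (flip A) n s y ry dy → i < s → j < s →
  (mat ≢ 0 → A (rx i) (ry j)) → (A (rx i) (ry j) → mat ≢ 0) →
  Estimate A s x y rx dx ry dy P e →
  Estimate A s x y rx dx ry dy (λ i′ j′ → P i′ j′ ⊎ (i′ ≡ i × j′ ≡ j)) (e ∸ (e ∸ (dx i + dy j + 1 + (1 ∸ mat) * e)))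
estimate-step {A} {x = x} {y} {rx} {dx} {ry} {dy} {e} {i} {j} {zero} BX BY i<s j<s to from est
  rewrite m≤n⇒m∸n≡0 (≤-trans (≤-reflexive (sym (+-identityʳ e))) (m≤n+m (e + 0) (dx i + dy j + 1))) = record
  { cap   = cap
  ; tried = λ { i′ j′ (inj₁ p) i<s j<s → tried i′ j′ p i<s j<s
              ; i′ j′ (inj₂ (refl , refl)) i<s j<s a → ⊥-elim (from a refl) }
  ; real  = real
  }
  where open Estimate est
estimate-step {A} {x = x} {y} {rx} {dx} {ry} {dy} {e} {i} {j} {suc mat} BX BY i<s j<s to from est
  rewrite 0∸n≡0 mat | +-identityʳ (dx i + dy j + 1) = record
  { cap   = ≤-trans (m∸n≤m e (e ∸ c)) cap
  ; tried = λ { i′ j′ (inj₁ p) i<s j<s a → ≤-trans (m∸n≤m e (e ∸ c)) (tried i′ j′ p i<s j<s a)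
              ; i′ j′ (inj₂ (refl , refl)) i<s j<s a → ∸∸≤ e c }
  ; real  = either (≤-total e c)
  }
  where
    open Estimate est
    c = dx i + dy j + 1
    found : Path A x y c
    found = subst (Path A x y) (lemma (dx i) (dy j))
      (snoc (Ball.walk BX i i<s) (to λ ()) ++ᵖ path-reverse (Ball.walk BY j j<s))
      where
        lemma : ∀ a b → b + suc a ≡ a + b + 1
        lemma = solve-∀
    either : e ≤ c ⊎ c ≤ e → e ∸ (e ∸ c) ≡ _ ⊎ Path A x y (e ∸ (e ∸ c))
    either (inj₁ e≤c) rewrite m≤n⇒m∸n≡0 e≤c = real
    either (inj₂ c≤e) rewrite m∸[m∸n]≡n c≤e = inj₂ found

path-first : ∀ {A : Rel₂} {u y} k → Path A u y (suc k) → ∃[ v ] A u v × Path A v y k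
path-first zero    (snoc nil e) = _ , e , nil
path-first (suc k) (snoc p e)   with path-first k p
... | v , e′ , p′ = v , e′ , snoc p′ e

-- If `e` exceeded `k`, the walk would be shorter than the sum of the radii by `cap`, hence split as
-- `i + 1 + j` with `i` and `j` below the respective radii. `cover` places the ends of the middle
-- arc in the two balls, and that pair was tried. `x ≢ y` excludes the empty walk, which has no arc.
estimate-valid : ∀ {A n s x y rx dx ry dy e} → Ball A n s x rx dx → Ball (flip A) n s y ry dy → x ≢ y →
  (∀ {P : ℕ → ℕ → Set} → (∀ i j → i < s → j < s → P i j) → Estimate A s x y rx dx ry dy P e → ∀ k → Path A x y k → e ≤ k)
estimate-valid {A} {s = s} {x} {y} {rx} {dx} {ry} {dy} {e} BX BY x≢y allP est k p with e ≤? k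
... | yes e≤k = e≤k
... | no e≰k = ⊥-elim (contra k p (<-≤-trans (≰⇒> e≰k) cap) (≰⇒> e≰k))
  where
    open Estimate est
    module X = Ball BX
    module Y = Ball BY
    Rx = dx (s ∸ 1)
    Ry = dy (s ∸ 1)

    through : ∀ i j → Path A x y (suc j + i) → i < Rx → j < Ry → suc j + i < e → ⊥
    through i j p i<Rx j<Ry lt with path-split i (suc j) p
    ... | u , p₁ , p₂ with path-first j p₂
    ... | v , edge , p₃ with X.cover p₁ i<Rx | Y.cover (path-reverse p₃) j<Ry
    ... | a , a<s , refl , da | b , b<s , refl , db =
      <⇒≱ lt (≤-trans (tried a b (allP a b a<s b<s) a<s b<s edge)
        (≤-trans (+-monoˡ-≤ 1 (+-mono-≤ da db)) (≤-reflexive (lemma i j))))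
      where
        lemma : ∀ i j → i + j + 1 ≡ suc j + i
        lemma = solve-∀

    contra : ∀ k → Path A x y k → k < Rx + Ry → k < e → ⊥
    contra zero nil _ _ = x≢y refl
    contra (suc k) p lt lt′ with k <? Rx
    -- The arc is taken as late as the out-radius permits: last of all if the prefix fits, which
    -- needs `Ry ≥ 1`, and otherwise after `Rx ∸ 1` steps, which leaves fewer than `Ry`.
    ... | yes k<Rx = through k 0 p k<Rx Y.pos lt′
    ... | no k≮Rx = through r j (subst (Path A x y) k≡ p) (≤-reflexive sr) j<Ry (subst (_< e) k≡ lt′)
      where
        r = Rx ∸ 1
        j = k ∸ r
        sr : suc r ≡ Rx
        sr = trans (+-comm 1 r) (m∸n+n≡m X.pos)
        r≤k : r ≤ k
        r≤k = ≤-trans (m∸n≤m Rx 1) (≮⇒≥ k≮Rx)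
        k≡ : suc k ≡ suc j + r
        k≡ = cong suc (sym (m∸n+n≡m r≤k))
        j<Ry : j < Ry
        j<Ry = +-cancelʳ-< r j Ry (≤-pred (subst₂ _<_ k≡ (trans (cong (_+ Ry) (sym sr)) (cong suc (+-comm r Ry))) lt))

-- Greedy hitting sets

eq01 : ℕ → ℕ → ℕ
eq01 a b = if a ≡ᵇ b then 1 else 0

eq01-elim : ∀ a b (P : ℕ → Set) → (a ≡ b → P 1) → (a ≢ b → P 0) → P (eq01 a b)
eq01-elim a b P = upd-elim (λ _ → 0) a 1 b P

sum-eq01 : ∀ n {r} → r < n → sum n (eq01 r) ≡ 1
sum-eq01 n {r} r<n = trans (sym (+-identityʳ _)) (trans (sum-upd n (λ _ → 0) 1 r<n) (cong (_+ 1) (trans (sum-const n 0) (*-zeroʳ n))))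

module Greedy (n s F : ℕ) (row : ℕ → ℕ → ℕ)
    (row<n : ∀ i j → i < F → j < s → row i j < n)
    (row-inj : ∀ i → i < F → InjectiveBelow s (row i)) where

  occurrences : ℕ → ℕ → ℕ → ℕ
  occurrences k i u = sum k (λ j → eq01 (row i j) u)

  -- `1 ∸ hit i` is 1 exactly for unhit rows, so this counts the occurrences of `u` in the unhit
  -- rows among the first `k`.
  coverage : (ℕ → ℕ) → ℕ → ℕ → ℕ
  coverage hit k u = sum k (λ i → (1 ∸ hit i) * occurrences s i u)

  missed : (ℕ → ℕ) → ℕ → ℕ
  missed hit k = sum k (λ i → 1 ∸ hit i)

  sum-*ˡ : ∀ k c f → sum k (λ i → c * f i) ≡ c * sum k f
  sum-*ˡ zero    c f = sym (*-zeroʳ c)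
  sum-*ˡ (suc k) c f = trans (cong (_+ c * f k) (sum-*ˡ k c f)) (sym (*-distribˡ-+ c (sum k f) (f k)))

  -- Double counting: after exchanging the sums, each unhit row contributes its `s` entries.
  coverage-total : ∀ hit → sum n (coverage hit F) ≡ missed hit F * s
  coverage-total hit = begin
    sum n (λ u → sum F (λ i → (1 ∸ hit i) * occurrences s i u)) ≡⟨ sum-swap n F (λ u i → (1 ∸ hit i) * occurrences s i u) ⟩
    sum F (λ i → sum n (λ u → (1 ∸ hit i) * occurrences s i u)) ≡⟨ sum-cong F (λ i i<F → trans (sum-*ˡ n (1 ∸ hit i) (occurrences s i)) (trans (cong ((1 ∸ hit i) *_) (one i i<F)) (*-comm (1 ∸ hit i) s))) ⟩
    sum F (λ i → s * (1 ∸ hit i))                               ≡⟨ sum-*ˡ F s (λ i → 1 ∸ hit i) ⟩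
    s * missed hit F                                            ≡⟨ *-comm s _ ⟩
    missed hit F * s ∎
    where
      open ≡-Reasoning
      one : ∀ i → i < F → sum n (occurrences s i) ≡ s
      one i i<F = trans (sum-swap n s (λ u j → eq01 (row i j) u))
        (trans (sum-cong s λ j j<s → sum-eq01 n (row<n i j i<F j<s)) (trans (sum-const s 1) (*-identityʳ s)))

  average : ∀ hit p → (∀ u → u < n → coverage hit F u ≤ coverage hit F p) →
    missed hit F * s ≤ n * coverage hit F p
  average hit p best = ≤-trans (≤-reflexive (sym (coverage-total hit))) (sum-bound n _ best)

  occurrences-none : ∀ i p k → (∀ j → j < k → row i j ≢ p) → occurrences k i p ≡ 0
  occurrences-none i p k h = trans (sum-cong k λ j j<k → eq01-elim (row i j) p (_≡ 0) (λ e → ⊥-elim (h j j<k e)) (λ _ → refl))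
    (trans (sum-const k 0) (*-zeroʳ k))

  occurrences≤1 : ∀ i p → i < F → ∀ k → k ≤ s → occurrences k i p ≤ 1
  occurrences≤1 i p i<F zero    _   = z≤n
  occurrences≤1 i p i<F (suc k) k<s with row i k ≟ p
  ... | no ne = ≤-trans (+-mono-≤ (occurrences≤1 i p i<F k (<⇒≤ k<s))
                  (eq01-elim (row i k) p (_≤ 0) (λ e → ⊥-elim (ne e)) (λ _ → z≤n))) ≤-refl
  ... | yes refl = ≤-trans (+-monoˡ-≤ (eq01 (row i k) (row i k)) (≤-reflexive (occurrences-none i p k
                     λ j j<k e → <⇒≢ j<k (row-inj i i<F j k (<-trans j<k k<s) k<s e))))
                     (eq01-elim (row i k) p (_≤ 1) (λ _ → ≤-refl) (λ _ → z≤n))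

  coverage-bound : ∀ hit u k → k ≤ F → coverage hit k u ≤ k
  coverage-bound hit u k k≤F = ≤-trans (sum-bound k 1 λ i i<k →
    *-mono-≤ (m∸n≤m 1 (hit i)) (occurrences≤1 i u (<-≤-trans i<k k≤F) s ≤-refl)) (≤-reflexive (*-identityʳ k))

  -- Row by row: a row unhit afterwards avoids `p`, and a row that contains `p` does so once, so no
  -- row is charged beyond its own unit.
  progress : ∀ hit hit′ p → (∀ i → i < F → hit′ i ≡ 0 → hit i ≡ 0 × (∀ j → j < s → row i j ≢ p)) →
    missed hit′ F + coverage hit F p ≤ missed hit F
  progress hit hit′ p h = ≤-trans (≤-reflexive (sym (sum-+ F _ _))) (sum-mono F pointwise)
    where
      pointwise : ∀ i → i < F → (1 ∸ hit′ i) + (1 ∸ hit i) * occurrences s i p ≤ 1 ∸ hit i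
      pointwise i i<F with hit′ i | h i i<F
      ... | suc y | _ rewrite 0∸n≡0 y = ≤-trans (*-monoʳ-≤ (1 ∸ hit i) (occurrences≤1 i p i<F s ≤-refl))
                          (≤-trans (≤-reflexive (*-identityʳ _)) ≤-refl)
      ... | zero | h′ with h′ refl
      ... | z , none rewrite z | occurrences-none i p s none = ≤-refl

-- The number of greedy rounds is a harmonic sum.

harmonic : ℕ → ℕ → ℕ
harmonic n U = sum U (λ i → n / suc i + 1)

-- At least `c` terms disappear, each at least `n / U + 1`; the summand 1 makes up for rounding
-- down. Since `c` is at least the average `U s / n`, the sum falls by `s` or more, so
-- `harmonic n U / s` bounds the number of rounds.
harmonic-step : ∀ n s U U′ c .{{_ : NonZero U}} → U′ + c ≤ U → U * s ≤ n * c → harmonic n U′ + s ≤ harmonic n U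
harmonic-step n s U U′ c h avg = ≤-trans (+-monoʳ-≤ (harmonic n U′) s≤) (≤-trans (steps c U′ h) (sum-mono-range _ h))
  where
    open ≤-Reasoning
    r = n / U + 1
    steps : ∀ c U′ → U′ + c ≤ U → harmonic n U′ + c * r ≤ harmonic n (U′ + c)
    steps zero    U′ _ rewrite +-identityʳ U′ | +-identityʳ (harmonic n U′) = ≤-refl
    steps (suc c) U′ le rewrite +-suc U′ c = begin
      harmonic n U′ + (r + c * r)       ≡⟨ lemma (harmonic n U′) r (c * r) ⟩
      harmonic n U′ + c * r + r         ≤⟨ +-mono-≤ (steps c U′ (<⇒≤ le)) (+-monoˡ-≤ 1 (/-monoʳ-≤ n le)) ⟩
      harmonic n (U′ + c) + (n / suc (U′ + c) + 1) ∎
      where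
        lemma : ∀ a b c → a + (b + c) ≡ a + c + b
        lemma = solve-∀
    n≤ : n ≤ r * U
    n≤ = begin
      n                     ≡⟨ m≡m%n+[m/n]*n n U ⟩
      n % U + n / U * U     ≤⟨ +-monoˡ-≤ _ (<⇒≤ (m%n<n n U)) ⟩
      U + n / U * U         ≡⟨ cong (_* U) (+-comm 1 (n / U)) ⟩
      r * U                 ∎
    s≤ : s ≤ c * r
    s≤ = *-cancelˡ-≤ U (begin
      U * s       ≤⟨ avg ⟩
      n * c       ≤⟨ *-monoˡ-≤ c n≤ ⟩
      r * U * c   ≡⟨ lemma r U c ⟩
      U * (c * r) ∎)
      where
        lemma : ∀ a b c → a * b * c ≡ b * (c * a)
        lemma = solve-∀

-- Dyadic blocks: the `2 ^ k` terms with divisors above `2 ^ k` and up to `2 ^ (k + 1)` are at most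
-- `n / 2 ^ k` each, so every doubling adds at most `n`.
quotients : ∀ n k → sum (2 ^ k) (λ i → n / suc i) ≤ n * suc k
quotients n zero = ≤-reflexive (trans (n/1≡n n) (sym (*-identityʳ n)))
quotients n (suc k) = begin
  sum (2 ^ k + (2 ^ k + 0)) f      ≡⟨ cong (λ y → sum (2 ^ k + y) f) (+-identityʳ _) ⟩
  sum (2 ^ k + 2 ^ k) f            ≤⟨ doubling (2 ^ k) ⟩
  sum (2 ^ k) f + 2 ^ k * (n / 2 ^ k) ≤⟨ +-mono-≤ (quotients n k) (≤-trans (≤-reflexive (*-comm (2 ^ k) _)) (m/n*n≤m n (2 ^ k))) ⟩
  n * suc k + n                    ≡⟨ trans (+-comm _ n) (sym (*-suc n (suc k))) ⟩
  n * suc (suc k)                  ∎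
  where
    open ≤-Reasoning
    f : ℕ → ℕ
    f i = n / suc i
    instance _ = m^n≢0 2 k
    doubling : ∀ j → sum (2 ^ k + j) f ≤ sum (2 ^ k) f + j * (n / 2 ^ k)
    doubling zero rewrite +-identityʳ (2 ^ k) = m≤m+n _ _
    doubling (suc j) rewrite +-suc (2 ^ k) j = begin
      sum (2 ^ k + j) f + n / suc (2 ^ k + j)
        ≤⟨ +-mono-≤ (doubling j) (/-monoʳ-≤ n (m≤n⇒m≤1+n (m≤m+n (2 ^ k) j))) ⟩
      sum (2 ^ k) f + j * (n / 2 ^ k) + n / 2 ^ k
        ≡⟨ lemma (sum (2 ^ k) f) (j * (n / 2 ^ k)) (n / 2 ^ k) ⟩
      sum (2 ^ k) f + (n / 2 ^ k + j * (n / 2 ^ k)) ∎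
      where
        lemma : ∀ a b c → a + b + c ≡ a + (c + b)
        lemma = solve-∀

harmonic-bound : ∀ n U k → U ≤ 2 ^ k → harmonic n U ≤ n * suc k + U
harmonic-bound n U k U≤ = begin
  harmonic n U                              ≡⟨ sum-+ U (λ i → n / suc i) (λ _ → 1) ⟩
  sum U (λ i → n / suc i) + sum U (λ _ → 1) ≤⟨ +-mono-≤ (≤-trans (sum-mono-range _ U≤) (quotients n k)) (≤-reflexive (trans (sum-const U 1) (*-identityʳ U))) ⟩
  n * suc k + U                             ∎
  where open ≤-Reasoning

n≤2^⌈log₂n⌉ : ∀ n → n ≤ 2 ^ ⌈log₂ n ⌉
n≤2^⌈log₂n⌉ n = go n (<-wellFounded n)
  where
    go : ∀ n (ac : Acc _<_ n) → n ≤ 2 ^ ⌈log2⌉ n ac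
    go 0 _ = z≤n
    go 1 _ = ≤-refl
    go (suc (suc n)) (acc rs) = begin
      suc (suc n)                         ≡⟨ cong (suc ∘ suc) (sym (⌊n/2⌋+⌈n/2⌉≡n n)) ⟩
      suc (suc (⌊ n /2⌋ + ⌈ n /2⌉))       ≤⟨ s≤s (s≤s (+-monoˡ-≤ ⌈ n /2⌉ (⌊n/2⌋≤⌈n/2⌉ n))) ⟩
      suc (suc (⌈ n /2⌉ + ⌈ n /2⌉))       ≡⟨ lemma ⌈ n /2⌉ ⟩
      2 * suc ⌈ n /2⌉                     ≤⟨ *-monoʳ-≤ 2 (go (suc ⌈ n /2⌉) _) ⟩
      2 * 2 ^ ⌈log2⌉ (suc ⌈ n /2⌉) _      ∎
      where
        open ≤-Reasoning
        lemma : ∀ x → suc (suc (x + x)) ≡ 2 * suc x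
        lemma = solve-∀

-- From graphs in memory to lists of arcs

cells-toℕ : ∀ {m} (f : Fin m → ℕ) e → cells f (toℕ e) ≡ f e
cells-toℕ f Fin.zero    = refl
cells-toℕ f (Fin.suc e) = cells-toℕ (f ∘ Fin.suc) e

cells-bound : ∀ {m b} (f : Fin m → ℕ) → (∀ e → f e ≤ b) → ∀ j → cells f j ≤ b
cells-bound {zero}  f h j       = z≤n
cells-bound {suc m} f h zero    = h Fin.zero
cells-bound {suc m} f h (suc j) = cells-bound (f ∘ Fin.suc) (h ∘ Fin.suc) j

glue : ℕ → (ℕ → ℕ) → (ℕ → ℕ) → ℕ → ℕ
glue m f g e with e <? m
... | yes _ = f e
... | no  _ = g (e ∸ m)

glue-below : ∀ {m f g e} → e < m → glue m f g e ≡ f e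
glue-below {m} {e = e} e<m with e <? m
... | yes _   = refl
... | no  e≮m = ⊥-elim (e≮m e<m)

glue-above : ∀ {m f g e} → m ≤ e → glue m f g e ≡ g (e ∸ m)
glue-above {m} {e = e} m≤e with e <? m
... | yes e<m = ⊥-elim (<⇒≱ e<m m≤e)
... | no  _   = refl

module Arcs {κ : Kind} {n m : ℕ} (G : Graph κ n m) where
  open Graph G using (loopless; simple; Adj; Walk; []; _∷_; IsDistance)

  -- Arc m + e is edge e of an undirected graph, traversed backwards.
  arcs : ℕ
  arcs = m + kindFlag κ * m

  end₁ end₂ tl hd : ℕ → ℕ
  end₁ = cells (toℕ ∘ proj₁ ∘ ends G)
  end₂ = cells (toℕ ∘ proj₂ ∘ ends G)
  tl = glue m end₁ end₂
  hd = glue m end₂ end₁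

  data Origin (e : ℕ) : Set where
    stored   : (f : Fin m) → e ≡ toℕ f → tl e ≡ toℕ (proj₁ (ends G f)) → hd e ≡ toℕ (proj₂ (ends G f)) → Origin e
    reversed : (f : Fin m) → e ≡ m + toℕ f → κ ≡ undirected →
               tl e ≡ toℕ (proj₂ (ends G f)) → hd e ≡ toℕ (proj₁ (ends G f)) → Origin e

  at : ∀ (f : Fin m → ℕ) {e} (e<m : e < m) → cells f e ≡ f (fromℕ< e<m)
  at f e<m = trans (cong (cells f) (sym (toℕ-fromℕ< e<m))) (cells-toℕ f (fromℕ< e<m))

  upper : ∀ κ′ → κ ≡ κ′ → ∀ e → e < m + kindFlag κ′ * m → m ≤ e → κ ≡ undirected × e ∸ m < m
  upper directed   eq e e<w m≤e = ⊥-elim (<⇒≱ e<w (≤-trans (≤-reflexive (+-identityʳ m)) m≤e))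
  upper undirected eq e e<w m≤e = eq , +-cancelˡ-< m (e ∸ m) m
    (subst₂ _<_ (sym (m+[n∸m]≡n m≤e)) (cong (m +_) (+-identityʳ m)) e<w)

  origin : ∀ e → e < arcs → Origin e
  origin e e<w with e <? m
  ... | yes e<m = stored (fromℕ< e<m) (sym (toℕ-fromℕ< e<m))
                    (trans (glue-below {m} {end₁} {end₂} e<m) (at _ e<m)) (trans (glue-below {m} {end₂} {end₁} e<m) (at _ e<m))
  ... | no e≮m with upper κ refl e e<w (≮⇒≥ e≮m)
  ...   | un , lt = reversed (fromℕ< lt) (trans (sym (m+[n∸m]≡n (≮⇒≥ e≮m))) (cong (m +_) (sym (toℕ-fromℕ< lt)))) un
                    (trans (glue-above {m} {end₁} {end₂} (≮⇒≥ e≮m)) (at _ lt)) (trans (glue-above {m} {end₂} {end₁} (≮⇒≥ e≮m)) (at _ lt))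

  same-ends : ∀ κ {p q : Fin n × Fin n} → toℕ (proj₁ p) ≡ toℕ (proj₁ q) → toℕ (proj₂ p) ≡ toℕ (proj₂ q) → SameEdge κ p q
  same-ends directed   a b = cong₂ _,_ (toℕ-injective a) (toℕ-injective b)
  same-ends undirected a b = inj₁ (cong₂ _,_ (toℕ-injective a) (toℕ-injective b))

  swapped-ends : ∀ {κ′ : Kind} {p q : Fin n × Fin n} → κ′ ≡ undirected →
    toℕ (proj₂ p) ≡ toℕ (proj₁ q) → toℕ (proj₁ p) ≡ toℕ (proj₂ q) → SameEdge κ′ p q
  swapped-ends refl a b = inj₂ (cong₂ _,_ (toℕ-injective a) (toℕ-injective b))

  -- If an arc coincided with a reversed one, simplicity would identify the two edges and make the
  -- edge a loop. Hence the doubled list is again simple.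
  not-both : ∀ {e f} → κ ≡ undirected → toℕ (proj₁ (ends G e)) ≡ toℕ (proj₂ (ends G f)) →
    toℕ (proj₂ (ends G e)) ≡ toℕ (proj₁ (ends G f)) → ⊥
  not-both {e} {f} un a b with simple e f (swapped-ends un b a)
  ... | refl = loopless e (toℕ-injective a)

  edgeList : EdgeList n arcs tl hd
  edgeList = record { tl<n = tl<n ; hd<n = hd<n ; simple = simple′ }
    where
      tl<n : ∀ e → e < arcs → tl e < n
      tl<n e e<w with origin e e<w
      ... | stored f _ a _     = subst (_< n) (sym a) (toℕ<n _)
      ... | reversed f _ _ a _ = subst (_< n) (sym a) (toℕ<n _)
      hd<n : ∀ e → e < arcs → hd e < n
      hd<n e e<w with origin e e<w
      ... | stored f _ _ b     = subst (_< n) (sym b) (toℕ<n _)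
      ... | reversed f _ _ _ b = subst (_< n) (sym b) (toℕ<n _)
      simple′ : ∀ e f → e < arcs → f < arcs → tl e ≡ tl f → hd e ≡ hd f → e ≡ f
      simple′ e f e<w f<w p q with origin e e<w | origin f f<w
      ... | stored e′ i a b | stored f′ j c d = trans i (trans (cong toℕ (simple e′ f′
              (same-ends κ (trans (sym a) (trans p c)) (trans (sym b) (trans q d))))) (sym j))
      ... | reversed e′ i _ a b | reversed f′ j _ c d = trans i (trans (cong (λ x → m + toℕ x) (simple e′ f′
              (same-ends κ (trans (sym b) (trans q d)) (trans (sym a) (trans p c))))) (sym j))
      ... | stored e′ i a b | reversed f′ j un c d =
              ⊥-elim (not-both {e′} {f′} un (trans (sym a) (trans p c)) (trans (sym b) (trans q d)))
      ... | reversed e′ i un a b | stored f′ j c d =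
              ⊥-elim (not-both {f′} {e′} un (trans (sym c) (trans (sym p) a)) (trans (sym d) (trans (sym q) b)))

  Arc : Rel₂
  Arc = Edge arcs tl hd

  adj⇒arc : ∀ κ′ → κ ≡ κ′ → ∀ {u v} e → SameEdge κ′ (ends G e) (u , v) → Arc (toℕ u) (toℕ v)
  adj⇒arc κ′ eq {u} {v} e same-edge = go κ′ eq same-edge
    where
      forward : ends G e ≡ (u , v) → Arc (toℕ u) (toℕ v)
      forward refl = toℕ e , <-≤-trans (toℕ<n e) (m≤m+n m _) ,
        trans (glue-below {m} {end₁} {end₂} (toℕ<n e)) (cells-toℕ _ e) , trans (glue-below {m} {end₂} {end₁} (toℕ<n e)) (cells-toℕ _ e)
      backward : κ ≡ undirected → swap (ends G e) ≡ (u , v) → Arc (toℕ u) (toℕ v)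
      backward refl refl = m + toℕ e , +-monoʳ-< m (<-≤-trans (toℕ<n e) (m≤m+n m 0)) ,
        trans (glue-above {m} {end₁} {end₂} (m≤m+n m _)) (trans (cong end₂ (m+n∸m≡n m _)) (cells-toℕ _ e)) ,
        trans (glue-above {m} {end₂} {end₁} (m≤m+n m _)) (trans (cong end₁ (m+n∸m≡n m _)) (cells-toℕ _ e))
      go : ∀ κ′ → κ ≡ κ′ → SameEdge κ′ (ends G e) (u , v) → Arc (toℕ u) (toℕ v)
      go directed   _  p        = forward p
      go undirected _  (inj₁ p) = forward p
      go undirected un (inj₂ p) = backward un p

  arc⇒adj : ∀ {u v} → Arc (toℕ u) (toℕ v) → Adj u v
  arc⇒adj {u} {v} (e , e<w , p , q) with origin e e<w
  ... | stored f _ a b      = f , same-ends κ (trans (sym a) p) (trans (sym b) q)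
  ... | reversed f _ un a b = f , swapped-ends un (trans (sym a) p) (trans (sym b) q)

  walk⇒path : ∀ {u v k} → Walk u v k → Path Arc (toℕ u) (toℕ v) k
  walk⇒path []               = nil
  walk⇒path ((e , s) ∷ walk) = path-cons (adj⇒arc κ refl e s) (walk⇒path walk)

  walk-snoc : ∀ {u v x k} → Walk u v k → Adj v x → Walk u x (suc k)
  walk-snoc []        b = b ∷ []
  walk-snoc (a ∷ wlk) b = a ∷ walk-snoc wlk b

  path⇒walk : ∀ {u y k} → Path Arc (toℕ u) y k → ∃[ v ] toℕ v ≡ y × Walk u v k
  path⇒walk nil = _ , refl , []
  path⇒walk (snoc p (e , e<w , a , refl)) with path⇒walk p
  ... | v , refl , wlk = x , x≡ , walk-snoc wlk (arc⇒adj (e , e<w , a , sym x≡))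
    where
      hd<n = EdgeList.hd<n edgeList e e<w
      x = fromℕ< hd<n
      x≡ : toℕ x ≡ hd e
      x≡ = toℕ-fromℕ< hd<n

  connected : ∀ {D} → IsDiameter G D → ∀ x y → x < n → y < n → ∃[ k ] k ≤ D × Path Arc x y k
  connected (all , _) x y x<n y<n with all (fromℕ< x<n) (fromℕ< y<n)
  ... | d , (wlk , _) , d≤D = d , d≤D , subst₂ (λ a b → Path Arc a b d) (toℕ-fromℕ< x<n) (toℕ-fromℕ< y<n) (walk⇒path wlk)

  extremal : ∀ {D u v} → IsDistance u v D → ∀ k → Path Arc (toℕ u) (toℕ v) k → D ≤ k
  extremal (_ , shortest) k p with path⇒walk p
  ... | v′ , eq , wlk with toℕ-injective eq
  ... | refl = shortest k wlk

  arcs≤2m : arcs ≤ 2 * m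
  arcs≤2m = +-monoʳ-≤ m (*-monoˡ-≤ m (flag≤1 κ))
    where
      flag≤1 : ∀ κ → kindFlag κ ≤ 1
      flag≤1 directed   = z≤n
      flag≤1 undirected = ≤-refl

edges≤square : ∀ {n w tl hd} → EdgeList n w tl hd → w ≤ n * n
edges≤square {n} {w} {tl} {hd} E = pigeonhole (λ e → tl e * n + hd e) (λ i → i)
  (λ e f e<w f<w eq → let p , q = row-injective n {tl e} {tl f} (hd<n e e<w) (hd<n f f<w) eq in simple e f e<w f<w p q)
  λ e e<w → _ , subst (tl e * n + hd e <_) (+-identityʳ (n * n)) (row-below n {j = 0} (tl<n e e<w) (hd<n e e<w)) , refl
  where open EdgeList E

-- With two vertices or more, each one reaches another and so is the tail of some arc. The bound is
-- what makes the smallest ball size 2 satisfy `s³ n ≤ 8 w`.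
vertices≤edges : ∀ {n w tl hd} → 2 ≤ n → (∀ x y → x < n → y < n → ∃[ k ] Path (Edge w tl hd) x y k) → n ≤ w
vertices≤edges {n} {w} {tl} {hd} 2≤n conn = pigeonhole (λ u → u) tl (λ _ _ _ _ e → e) leaves
  where
    first : ∀ {u y k} → u ≢ y → Path (Edge w tl hd) u y k → ∃[ e ] e < w × tl e ≡ u
    first {k = zero}  ne nil = ⊥-elim (ne refl)
    first {k = suc k} ne p with path-first k p
    ... | _ , (e , e<w , t , _) , _ = e , e<w , t
    leaves : ∀ u → u < n → ∃[ e ] e < w × tl e ≡ u
    leaves zero    u<n = first (λ ()) (proj₂ (conn 0 1 u<n 2≤n))
    leaves (suc u) u<n = first (λ ()) (proj₂ (conn (suc u) 0 u<n (<⇒≤ 2≤n)))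

-- The program.  Scalars live in cell 0 of arrays of their own, so that the
-- frame condition separates them.

INP END₁ END₂ OUT W S TL HD MAT DEG ADJ DIR LIM EDGE U NEXT CLEAR DIST QUEUE FRONT BACK NB SRC
  BALL RAD CENTRE COPY COUNT HIT MISSED PIVOT ROW COL EST Y : ℕ
INP = 0
END₁ = 1
END₂ = 2
OUT = 3
W = 4
S = 5
TL = 6
HD = 7
MAT = 8
DEG = 9
ADJ = 10
DIR = 11
LIM = 12
EDGE = 13
U = 14
NEXT = 15
CLEAR = 16
DIST = 17
QUEUE = 18
FRONT = 19
BACK = 20
NB = 21
SRC = 22
BALL = 23
RAD = 24
CENTRE = 25
COPY = 26
COUNT = 27
HIT = 28
MISSED = 29
PIVOT = 30
ROW = 31
COL = 32
EST = 33
Y = 34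

infix 21 #_
#_ : ℕ → Expr
# a = a ! lit 0

infix 13 _≔_
_≔_ : ℕ → Expr → Cmd
a ≔ e = a [ lit 0 ]≔ e

#n #m #kind : Expr
#n = INP ! lit 0
#m = INP ! lit 1
#kind = INP ! lit 2

-- Only `DEG` is cleared: entries of `ADJ` from an earlier build lie beyond the new degrees. Rows of
-- width `W` have room for any list and cost nothing but larger addresses.
build : Cmd
build =
  for CLEAR #n (DEG [ # CLEAR ]≔ lit 0) ⨟
  for EDGE (# W)
    (ifte (# DIR)
       (U ≔ HD ! # EDGE ⨟ NEXT ≔ TL ! # EDGE)
       (U ≔ TL ! # EDGE ⨟ NEXT ≔ HD ! # EDGE) ⨟
     ifte (# LIM ⊖ DEG ! # U)
       (ADJ [ # U ⊛ # W ⊕ DEG ! # U ]≔ # NEXT ⨟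
        DEG [ # U ]≔ DEG ! # U ⊕ lit 1)
       skip)

visit : Cmd
visit =
  NEXT ≔ ADJ ! (# U ⊛ # W ⊕ # NB) ⨟
  ifte (DIST ! # NEXT)
    skip
    (QUEUE [ # BACK ]≔ # NEXT ⨟
     BACK ≔ # BACK ⊕ lit 1 ⨟
     DIST [ # NEXT ]≔ DIST ! # U ⊕ lit 1)

pop : Cmd
pop =
  U ≔ QUEUE ! # FRONT ⨟
  for NB (DEG ! # U) visit ⨟
  FRONT ≔ # FRONT ⊕ lit 1

-- The search is never stopped early. On truncated lists a complete search costs about `n s`, which
-- is affordable for all `2n` centres.
bfs : Cmd
bfs =
  for CLEAR #n (DIST [ # CLEAR ]≔ lit 0) ⨟
  DIST [ # SRC ]≔ lit 1 ⨟
  QUEUE [ lit 0 ]≔ # SRC ⨟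
  FRONT ≔ lit 0 ⨟
  BACK ≔ lit 1 ⨟
  while (# BACK ⊖ # FRONT) pop

-- `MAT` is not cleared; like `HIT` it relies on memory that starts at 0.
prepare : Cmd
prepare =
  for EDGE (# W)
    (ifte (#m ⊖ # EDGE)
      (TL [ # EDGE ]≔ END₁ ! # EDGE ⨟ HD [ # EDGE ]≔ END₂ ! # EDGE)
      (TL [ # EDGE ]≔ END₂ ! (# EDGE ⊖ #m) ⨟ HD [ # EDGE ]≔ END₁ ! (# EDGE ⊖ #m))) ⨟
  for EDGE (# W) (MAT [ TL ! # EDGE ⊛ #n ⊕ HD ! # EDGE ]≔ lit 1)

-- Row x of BALL and RAD lists the out-ball of x, row n + y the in-ball of y.
copy : Cmd
copy =
  for COPY (# S)
    (BALL [ (# DIR ⊛ #n ⊕ # CENTRE) ⊛ # S ⊕ # COPY ]≔ QUEUE ! # COPY ⨟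
     RAD [ (# DIR ⊛ #n ⊕ # CENTRE) ⊛ # S ⊕ # COPY ]≔ DIST ! (QUEUE ! # COPY) ⊖ lit 1)

balls : Cmd
balls =
  LIM ≔ # S ⨟
  for DIR (lit 2)
    (build ⨟ for CENTRE #n (SRC ≔ # CENTRE ⨟ bfs ⨟ copy))

entry : Expr
entry = BALL ! (# ROW ⊛ # S ⊕ # COL)

count : Cmd
count =
  for CLEAR #n (COUNT [ # CLEAR ]≔ lit 0) ⨟
  for ROW (#n ⊕ #n) (for COL (# S) (COUNT [ entry ]≔ COUNT ! entry ⊕ (lit 1 ⊖ HIT ! # ROW)))

choose : Cmd
choose =
  PIVOT ≔ lit 0 ⨟
  for CENTRE #n (ifte (COUNT ! # CENTRE ⊖ COUNT ! # PIVOT) (PIVOT ≔ # CENTRE) skip)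

-- OUT becomes the maximum of its value and the distance found.
explore : Cmd
explore =
  for DIR (lit 2)
    (build ⨟ SRC ≔ # PIVOT ⨟ bfs ⨟
     for CENTRE #n (OUT ≔ # OUT ⊕ ((DIST ! # CENTRE ⊖ lit 1) ⊖ # OUT)))

-- Truncated differences in both directions add up to 0 exactly for equal numbers, which replaces an
-- equality test.
mark : Cmd
mark =
  MISSED ≔ lit 0 ⨟
  for ROW (#n ⊕ #n)
    (for COL (# S) (ifte ((# PIVOT ⊖ entry) ⊕ (entry ⊖ # PIVOT)) skip (HIT [ # ROW ]≔ lit 1)) ⨟
     MISSED ≔ # MISSED ⊕ (lit 1 ⊖ HIT ! # ROW))

-- The limit `W` switches truncation off, as no list is longer. Out-balls and in-balls are hit by
-- one common set of pivots, hence the initial count `2n`.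
greedy : Cmd
greedy =
  LIM ≔ # W ⨟
  MISSED ≔ #n ⊕ #n ⨟
  while (# MISSED) (count ⨟ choose ⨟ explore ⨟ mark)

outCell inCell : Expr → Expr
outCell j = # CENTRE ⊛ # S ⊕ j
inCell  j = (#n ⊕ # Y) ⊛ # S ⊕ j

-- If there is no arc, the last summand keeps the candidate above EST.
candidate : Expr
candidate = RAD ! outCell (# ROW) ⊕ RAD ! inCell (# COL) ⊕ lit 1
  ⊕ (lit 1 ⊖ MAT ! (BALL ! outCell (# ROW) ⊛ #n ⊕ BALL ! inCell (# COL))) ⊛ # EST

pair : Cmd
pair =
  EST ≔ RAD ! outCell (# S ⊖ lit 1) ⊕ RAD ! inCell (# S ⊖ lit 1) ⨟
  for ROW (# S) (for COL (# S) (EST ≔ # EST ⊖ (# EST ⊖ candidate))) ⨟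
  OUT ≔ # OUT ⊕ (# EST ⊖ # OUT)

pairs : Cmd
pairs = for CENTRE #n (for Y #n (ifte ((# CENTRE ⊖ # Y) ⊕ (# Y ⊖ # CENTRE)) pair skip))

-- The smallest `s ≥ 2` with `s³ n ≥ W`. Linear search is cheap enough because `s ≤ n`, and the
-- lower limit 2 makes all radii positive.
parameters : Cmd
parameters =
  W ≔ #m ⊕ #kind ⊛ #m ⨟
  S ≔ lit 2 ⨟
  while (# W ⊖ # S ⊛ # S ⊛ # S ⊛ #n) (S ≔ # S ⊕ lit 1)

-- A single vertex has no ball of size 2; the untouched output cell then holds 0, the diameter.
program : Cmd
program = ifte (#n ⊖ lit 1) (parameters ⨟ prepare ⨟ balls ⨟ greedy ⨟ pairs) skip

-- Correctness and cost of building lists and of searching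

pick : ℕ → (ℕ → ℕ) → (ℕ → ℕ) → ℕ → ℕ
pick zero    f g = f
pick (suc _) f g = g

edges-pick : ∀ {n w tl hd} → EdgeList n w tl hd → ∀ δ → EdgeList n w (pick δ tl hd) (pick δ hd tl)
edges-pick E zero    = E
edges-pick E (suc _) = record { tl<n = hd<n ; hd<n = tl<n ; simple = λ e f e< f< p q → simple e f e< f< q p }
  where open EdgeList E

pick-zero : ∀ {δ x} → x ≡ δ → x ≡ 0 → ∀ f g (e : ℕ) → pick δ f g e ≡ f e
pick-zero refl refl f g e = refl

pick-suc : ∀ {δ x} → x ≡ δ → x ≢ 0 → ∀ f g (e : ℕ) → pick δ f g e ≡ g e
pick-suc {zero}  refl nz f g e = ⊥-elim (nz refl)
pick-suc {suc _} refl nz f g e = refl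

module Procedures (V ℓ : ℕ) (V≤2^ℓ : V ≤ 2 ^ ℓ) (1≤ℓ : 1 ≤ ℓ)
    (n w s : ℕ) (tl hd : ℕ → ℕ) (E : EdgeList n w tl hd) (1≤n : 1 ≤ n) (n≤V : n ≤ V) (w≤V : w ≤ V) where
  open Logic V ℓ V≤2^ℓ 1≤ℓ public

  -- Stated for five arrays instead of a store: updates of other arrays leave these unchanged by
  -- computation, so a proof carries over without transport.
  record EnvOf (inp wid siz tls hds : ℕ → ℕ) : Set where
    field
      n≡  : inp 0 ≡ n
      w≡  : wid 0 ≡ w
      s≡  : siz 0 ≡ s
      tl≡ : ∀ e → e < w → tls e ≡ tl e
      hd≡ : ∀ e → e < w → hds e ≡ hd e
  open EnvOf public

  Env : Store → Set
  Env σ = EnvOf (σ INP) (σ W) (σ S) (σ TL) (σ HD)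

  env-frame : ∀ {c σ σ′} → Frame c σ σ′ →
    writes c INP ≡ false → writes c W ≡ false → writes c S ≡ false → writes c TL ≡ false → writes c HD ≡ false → Env σ → Env σ′
  env-frame fr a b s c d env = record
    { n≡  = trans (same fr INP a 0) (n≡ env)
    ; w≡  = trans (same fr W b 0) (w≡ env)
    ; s≡  = trans (same fr S s 0) (s≡ env)
    ; tl≡ = λ e e<w → trans (same fr TL c e) (tl≡ env e e<w)
    ; hd≡ = λ e e<w → trans (same fr HD d e) (hd≡ env e e<w)
    }

  run-for-uniform : ∀ {a e c σ} N (I : ℕ → Store → Set) →
    writes c a ≡ false → N ≤ V → Bounded σ →
    (∀ σ′ → Frame (for a e c) σ σ′ → ⟦ e ⟧ σ′ ≡ N) →
    I 0 (σ [ a , 0 ↦ 0 ]) → ∀ X → 1 ≤ X →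
    (∀ i σ′ → i < N → σ′ a 0 ≡ i → Bounded σ′ → Frame (for a e c) σ σ′ → I i σ′ →
      Run c σ′ X (λ σ″ → I (suc i) (σ″ [ a , 0 ↦ suc i ]))) →
    Run (for a e c) σ (suc (N * X)) (I N)
  run-for-uniform N I w N≤V bd guard init X 1≤X step =
    relax (s≤s (≤-reflexive (sum-const N X)))
      (run-for (λ _ → X) N I w N≤V bd guard init λ i σ′ i<N at bd′ fr inv → 1≤X , step i σ′ i<N at bd′ fr inv)

  1≤V : 1 ≤ V
  1≤V = ≤-trans 1≤n n≤V

  module Lists (δ lim : ℕ) = Adjacency n w lim (pick δ tl hd) (pick δ hd tl) (edges-pick E δ)

  run-build : ∀ {σ} δ lim → Bounded σ → Env σ → σ DIR 0 ≡ δ → σ LIM 0 ≡ lim →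
    Run build σ (suc (n + w)) (λ σ′ → Lists.Lists δ lim w (σ′ DEG) (σ′ ADJ))
  run-build {σ} δ lim bd env δ≡ lim≡ =
    run-seq
      (relax (s≤s (≤-trans (≤-reflexive (*-identityʳ n)) (m≤m+n n w)))
        (run-for-uniform n (λ i σ′ → ∀ u → u < i → σ′ DEG u ≡ 0) refl n≤V bd
          (λ σ′ fr → trans (same fr INP refl 0) (n≡ env))
          (λ _ ()) 1 ≤-refl
          λ i σ′ i<n at bd′ fr inv →
            run-assign i 0 at refl z≤n ≤-refl bd′
              λ u u<1+i → upd-elim (σ′ DEG) i 0 u (_≡ 0) (λ _ → refl)
                (λ i≢u → inv u (≤∧≢⇒< (≤-pred u<1+i) (i≢u ∘ sym)))))
      λ σ₁ bd₁ fr₁ zero₁ →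
    let env₁ = env-frame fr₁ refl refl refl refl refl env in
      relax (s≤s (≤-trans (≤-reflexive (*-identityʳ w)) (m≤n+m w n)))
        (run-for-uniform w (λ e σ′ → Lists.Lists δ lim e (σ′ DEG) (σ′ ADJ)) refl w≤V bd₁
          (λ σ′ fr → trans (same fr W refl 0) (w≡ env₁))
          (Lists.lists-zero δ lim zero₁) 1 ≤-refl
          λ e σ′ e<w at bd′ fr inv → body e σ′ e<w at bd′ (env-frame fr refl refl refl refl refl env₁)
            (trans (same fr DIR refl 0) (trans (same fr₁ DIR refl 0) δ≡))
            (trans (same fr LIM refl 0) (trans (same fr₁ LIM refl 0) lim≡)) inv)
    where
      open EdgeList (edges-pick E δ)
      add : Cmd
      add = ifte (# LIM ⊖ DEG ! # U) (ADJ [ # U ⊛ # W ⊕ DEG ! # U ]≔ # NEXT ⨟ DEG [ # U ]≔ DEG ! # U ⊕ lit 1) skip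

      insert : ∀ e σ′ → e < w → Bounded σ′ → Env σ′ → σ′ LIM 0 ≡ lim →
        σ′ U 0 ≡ pick δ tl hd e → σ′ NEXT 0 ≡ pick δ hd tl e →
        Lists.Lists δ lim e (σ′ DEG) (σ′ ADJ) →
        Run add σ′ 1 (λ σ″ → Lists.Lists δ lim (suc e) (σ″ DEG) (σ″ ADJ))
      insert e σ′ e<w bd′ env′ lim≡′ u≡ v≡ inv = run-if ≤-refl bd′
        (λ nz → assign-then _ _ (cong₂ (λ a b → a * b + σ′ DEG a) u≡ (w≡ env′)) v≡ (subst (_≤ V) v≡ (bd′ NEXT 0)) ≤-refl bd′ λ bd₂ →
          run-assign _ _ u≡ (trans (cong (λ a → σ′ DEG a + 1) u≡) (+-comm _ 1))
            (≤-trans (s≤s (Lists.Lists.deg≤e inv _ (tl<n e e<w))) (≤-trans e<w w≤V)) ≤-refl bd₂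
            (Lists.Add.lists-add δ lim inv e<w
              (≰⇒> λ le → nz (trans (cong₂ _∸_ lim≡′ (cong (σ′ DEG) u≡)) (m≤n⇒m∸n≡0 le)))))
        (λ z → run-skip ≤-refl bd′ (Lists.lists-skip δ lim inv e<w
          (m∸n≡0⇒m≤n (trans (sym (cong₂ _∸_ lim≡′ (cong (σ′ DEG) u≡))) z))))


      body : ∀ e σ′ → e < w → σ′ EDGE 0 ≡ e → Bounded σ′ → Env σ′ → σ′ DIR 0 ≡ δ → σ′ LIM 0 ≡ lim →
        Lists.Lists δ lim e (σ′ DEG) (σ′ ADJ) →
        Run _ σ′ 1 (λ σ″ → Lists.Lists δ lim (suc e) (σ″ DEG) (σ″ ADJ))
      body e σ′ e<w at bd′ env′ δ≡′ lim≡′ inv =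
        run-seq {Q = λ σ″ → Env σ″ × σ″ LIM 0 ≡ lim × σ″ U 0 ≡ pick δ tl hd e × σ″ NEXT 0 ≡ pick δ hd tl e
                          × Lists.Lists δ lim e (σ″ DEG) (σ″ ADJ)}
          (run-if ≤-refl bd′
            (λ nz → assign-then 0 _ refl (trans (cong (σ′ HD) at) (trans (hd≡ env′ e e<w) (sym (pick-suc δ≡′ nz tl hd e))))
                      (≤-trans (<⇒≤ (tl<n e e<w)) n≤V) ≤-refl bd′ λ bd₂ →
                    run-assign 0 _ refl (trans (cong (σ′ TL) at) (trans (tl≡ env′ e e<w) (sym (pick-suc δ≡′ nz hd tl e))))
                      (≤-trans (<⇒≤ (hd<n e e<w)) n≤V) ≤-refl bd₂ (env′ , lim≡′ , refl , refl , inv))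
            (λ z → assign-then 0 _ refl (trans (cong (σ′ TL) at) (trans (tl≡ env′ e e<w) (sym (pick-zero δ≡′ z tl hd e))))
                      (≤-trans (<⇒≤ (tl<n e e<w)) n≤V) ≤-refl bd′ λ bd₂ →
                    run-assign 0 _ refl (trans (cong (σ′ HD) at) (trans (hd≡ env′ e e<w) (sym (pick-zero δ≡′ z hd tl e))))
                      (≤-trans (<⇒≤ (hd<n e e<w)) n≤V) ≤-refl bd₂ (env′ , lim≡′ , refl , refl , inv)))
          λ σ″ bd″ fr″ (env″ , lim≡″ , u≡ , v≡ , inv″) → insert e σ″ e<w bd″ env″ lim≡″ u≡ v≡ inv″

  module RunBFS {σ : Store} (x : ℕ) (bd : Bounded σ) (n≡ : σ INP 0 ≡ n) (w≡ : σ W 0 ≡ w)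
      (src≡ : σ SRC 0 ≡ x) (x<n : x < n)
      (nb<n : ∀ u j → u < n → j < σ DEG u → σ ADJ (u * w + j) < n) where

    deg : ℕ → ℕ
    deg = σ DEG
    nb : ℕ → ℕ → ℕ
    nb u j = σ ADJ (u * w + j)
    open BFS n deg nb x

    work : ℕ → ℕ
    work u = deg u + 1

    total : ℕ
    total = sum n work

    record Static (degs adj wid : ℕ → ℕ) : Set where
      field
        deg≡ : ∀ u → degs u ≡ deg u
        adj≡ : ∀ a → adj a ≡ σ ADJ a
        wid≡ : wid 0 ≡ w
    open Static

    static-frame : ∀ {c τ τ′} → Frame c τ τ′ → writes c DEG ≡ false → writes c ADJ ≡ false → writes c W ≡ false →
      Static (τ DEG) (τ ADJ) (τ W) → Static (τ′ DEG) (τ′ ADJ) (τ′ W)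
    static-frame fr a b c st = record
      { deg≡ = λ u → trans (same fr DEG a u) (deg≡ st u)
      ; adj≡ = λ i → trans (same fr ADJ b i) (adj≡ st i)
      ; wid≡ = trans (same fr W c 0) (wid≡ st)
      }

    -- The last conjunct is the amortisation. Each popped vertex has spent its degree plus one, and
    -- as queue entries are distinct the sum never exceeds `total`.
    Loop : ℕ → Store → Set
    Loop k τ = ∃[ i ] τ FRONT 0 ≡ i × i ≤ τ BACK 0 × Queue (τ DIST) (τ QUEUE) (τ BACK 0) ×
      Near (τ DIST) (τ QUEUE) (τ BACK 0) i × Done (τ DIST) (τ QUEUE) i ×
      k + sum i (work ∘ τ QUEUE) ≡ total

    -- `q₀` and `t₀` are the queue and its length when the head was popped. Discoveries only append,
    -- so cells below `t₀` persist and `q₀ i` remains the vertex being scanned.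
    Scan : (q₀ : ℕ → ℕ) (t₀ i l : ℕ) → Store → Set
    Scan q₀ t₀ i l τ = t₀ ≤ τ BACK 0 × Queue (τ DIST) (τ QUEUE) (τ BACK 0) ×
      Near (τ DIST) (τ QUEUE) (τ BACK 0) i × Done (τ DIST) (τ QUEUE) i ×
      Part (τ DIST) (q₀ i) l × (∀ j → j < t₀ → τ QUEUE j ≡ q₀ j)

    part-suc : ∀ {d u l} → Part d u l → Reached d u (nb u l) → Part d u (suc l)
    part-suc {d} {u} pt r l′ l′< = below-suc (λ l → Reached d u (nb u l)) pt r l′<

    run-visit : ∀ q₀ t₀ i l τ → i < t₀ → q₀ i < n → l < deg (q₀ i) → Bounded τ → Static (τ DEG) (τ ADJ) (τ W) →
      τ U 0 ≡ q₀ i → τ NB 0 ≡ l → Scan q₀ t₀ i l τ → Run visit τ 1 (Scan q₀ t₀ i (suc l))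
    run-visit q₀ t₀ i l τ i<t₀ u<n l< bdτ st u≡ l≡ (t₀≤t , Qu , nr , dn , pt , old) =
      assign-then 0 v refl
        (trans (adj≡ st _) (cong (σ ADJ) (cong₂ _+_ (cong₂ _*_ u≡ (wid≡ st)) l≡)))
        (≤-trans (<⇒≤ v<n) n≤V) ≤-refl bdτ λ bd₁ →
      run-if ≤-refl bd₁
        (λ nz → run-skip ≤-refl bd₁ (t₀≤t , Qu , nr , dn ,
          part-suc {τ DIST} {q₀ i} {l} pt (subst (λ u → Reached (τ DIST) u v) (old i i<t₀) (already Qu nr i<t v<n nz)) , old))
        λ z → let module D = Discover Qu nr i<t v<n z in
          assign-then t v refl refl (≤-trans (<⇒≤ v<n) n≤V) ≤-refl bd₁ λ bd₂ →
          assign-then 0 (suc t) refl (+-comm t 1)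
            -- The enlarged queue still consists of distinct vertices. This bounds `BACK` and,
            -- through `small`, the new level stored next.
            (≤-trans (Queue.t≤n (D.queue edge)) n≤V) ≤-refl bd₂ λ bd₃ →
          run-assign v (suc (τ DIST (τ QUEUE i))) refl
            (trans (cong (λ u → τ DIST u + 1) (trans u≡ (sym (old i i<t₀)))) (+-comm _ 1))
            (≤-trans (s≤s (Queue.small Qu i i<t)) (≤-trans (s≤s i<t) (≤-trans (Queue.t≤n (D.queue edge)) n≤V))) ≤-refl bd₃
            (m≤n⇒m≤1+n t₀≤t , D.queue edge , D.near , D.done dn ,
             part-suc {D.d′} {q₀ i} {l} (λ l′ l′< → D.reached (λ e → Queue.visited Qu i i<t (trans (cong (τ DIST) (old i i<t₀)) e)) (pt l′ l′<))
               (subst (λ u → Reached D.d′ u v) (old i i<t₀) D.reached-new) ,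
             λ j j<t₀ → trans (D.old-q (<-≤-trans j<t₀ t₀≤t)) (old j j<t₀))
      where
        t = τ BACK 0
        v = nb (q₀ i) l
        v<n : v < n
        v<n = nb<n (q₀ i) l u<n l<
        i<t : i < t
        i<t = <-≤-trans i<t₀ t₀≤t
        edge : Nb (τ QUEUE i) v
        edge = subst (λ u → Nb u v) (sym (old i i<t₀)) (l , l< , refl)

    run-pop : ∀ k τ → Bounded τ → Static (τ DEG) (τ ADJ) (τ W) → τ BACK 0 ∸ τ FRONT 0 ≢ 0 → Loop k τ →
      ∃[ y ] 1 ≤ y × Run pop τ y (λ τ′ → ∃[ k′ ] y + k′ ≤ k × Loop k′ τ′)
    run-pop k τ bdτ st nz (i , refl , i≤t , Qu , nr , dn , budget) =
      work u , m≤n+m 1 (deg u) ,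
      assign-then 0 u refl refl (≤-trans (<⇒≤ u<n) n≤V) 1≤work bdτ λ bd₁ →
      run-seq
        (relax (≤-reflexive (trans (cong suc (*-identityʳ (deg u))) (+-comm 1 (deg u))))
          (run-for-uniform (deg u) (Scan q t i) refl (≤-trans (≤-reflexive (sym (deg≡ st u))) (bdτ DEG u)) bd₁
            (λ τ′ fr → trans (cong (τ′ DEG) (same fr U refl 0)) (trans (same fr DEG refl u) (deg≡ st u)))
            (≤-refl , Qu , nr , dn , (λ _ ()) , λ _ _ → refl) 1 ≤-refl
            λ l τ′ l< at bd′ fr inv →
                (run-visit q t i l τ′ i<t u<n l< bd′ (static-frame fr refl refl refl st) (same fr U refl 0) at inv)))
        λ τ′ bd′ fr (t≤t′ , Qu′ , nr′ , dn′ , pt , old) →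
      let i<t′ = <-≤-trans i<t t≤t′
          s≡ : sum (suc i) (work ∘ τ′ QUEUE) ≡ sum i (work ∘ q) + work u
          s≡ = sum-cong (suc i) {work ∘ τ′ QUEUE} {work ∘ q} λ j j< → cong work (old j (≤-<-trans (≤-pred j<) i<t))
          le : sum i (work ∘ q) + work u ≤ total
          le = ≤-trans (≤-reflexive (sym s≡)) (sum-injective n (suc i) work (τ′ QUEUE)
                 (λ j j< → Queue.q<n Qu′ j (≤-<-trans (≤-pred j<) i<t′))
                 λ a b a< b< → Queue.inj Qu′ a b (≤-<-trans (≤-pred a<) i<t′) (≤-<-trans (≤-pred b<) i<t′))
      in
      run-assign 0 (suc i) refl (trans (cong (_+ 1) (same fr FRONT refl 0)) (+-comm i 1))
        (≤-trans i<t′ (bd′ BACK 0)) 1≤work bd′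
        (total ∸ (sum i (work ∘ q) + work u) , budget-step k _ _ budget le ,
         suc i , refl , i<t′ , Qu′ , near-suc Qu′ nr′ ,
         done-suc {τ′ DIST} {τ′ QUEUE} {i} dn′ (subst (λ u → Part (τ′ DIST) u (deg u)) (sym (old i i<t)) pt) ,
         trans (cong ((total ∸ (sum i (work ∘ q) + work u)) +_) s≡) (m∸n+n≡m le))
      where
        t = τ BACK 0
        q = τ QUEUE
        u = q i
        i<t : i < t
        i<t = ≰⇒> λ le → nz (m≤n⇒m∸n≡0 le)
        u<n : u < n
        u<n = Queue.q<n Qu i i<t
        1≤work : 1 ≤ work u
        1≤work = m≤n+m 1 (deg u)

    total≡ : total ≡ sum n deg + n
    total≡ = trans (sum-+ n deg (λ _ → 1)) (cong (sum n deg +_) (trans (sum-const n 1) (*-identityʳ n)))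

    run-bfs : Run bfs σ (suc (sum n deg + n)) (λ τ → Result (τ DIST) (τ QUEUE) (τ BACK 0))
    run-bfs =
      run-seq
        (relax (s≤s (≤-trans (≤-reflexive (*-identityʳ n)) (m≤n+m n _)))
          (run-for-uniform n (λ i σ′ → ∀ u → u < i → σ′ DIST u ≡ 0) refl n≤V bd
            (λ σ′ fr → trans (same fr INP refl 0) n≡)
            (λ _ ()) 1 ≤-refl
            λ i σ′ i<n at bd′ fr inv →
              run-assign i 0 at refl z≤n ≤-refl bd′
                λ u u<1+i → upd-elim (σ′ DIST) i 0 u (_≡ 0) (λ _ → refl)
                  (λ i≢u → inv u (≤∧≢⇒< (≤-pred u<1+i) (i≢u ∘ sym)))))
        λ σ₁ bd₁ fr₁ zero₁ →
      let src≡₁ = trans (same fr₁ SRC refl 0) src≡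
          st₁ : Static (σ₁ DEG) (σ₁ ADJ) (σ₁ W)
          st₁ = record { deg≡ = same fr₁ DEG refl ; adj≡ = same fr₁ ADJ refl ; wid≡ = trans (same fr₁ W refl 0) w≡ }
          Qu = start {σ₁ DIST} {σ₁ QUEUE} zero₁ x<n
      in
      assign-then x 1 src≡₁ refl 1≤V (s≤s z≤n) bd₁ λ bd₂ →
      assign-then 0 x refl src≡₁ (≤-trans (<⇒≤ x<n) n≤V) (s≤s z≤n) bd₂ λ bd₃ →
      assign-then 0 0 refl refl z≤n (s≤s z≤n) bd₃ λ bd₄ →
      assign-then 0 1 refl refl 1≤V (s≤s z≤n) bd₄ λ bd₅ →
      weaken (s≤s (≤-reflexive total≡)) finish
        (run-while Loop total bd₅
          (0 , refl , z≤n , Qu , (λ { _ zero _ → n≤1+n _ ; _ (suc _) (s≤s ()) }) , (λ _ ()) , +-identityʳ _)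
          λ k τ bdτ fr nz lp → run-pop k τ bdτ (static-frame fr refl refl refl st₁) nz lp)
      where
        finish : ∀ τ → (τ BACK 0 ∸ τ FRONT 0 ≡ 0 × ∃[ k ] Loop k τ) → Result (τ DIST) (τ QUEUE) (τ BACK 0)
        finish τ (z , k , i , refl , i≤t , Qu , nr , dn , _) =
          result Qu (subst (Done (τ DIST) (τ QUEUE)) (≤-antisym i≤t (m∸n≡0⇒m≤n z)) dn) nb<n

-- The phases of the algorithm on a list of arcs

module Algorithm (V ℓ : ℕ) (V≤2^ℓ : V ≤ 2 ^ ℓ) (1≤ℓ : 1 ≤ ℓ)
    (n w s : ℕ) (tl hd : ℕ → ℕ) (E : EdgeList n w tl hd) (2≤s : 2 ≤ s) (s≤n : s ≤ n)
    (2n≤V : n + n ≤ V) (w≤V : w ≤ V) (D : ℕ)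
    (conn : ∀ x y → x < n → y < n → ∃[ k ] k ≤ D × Path (Edge w tl hd) x y k) where

  n≤V : n ≤ V
  n≤V = ≤-trans (m≤m+n n n) 2n≤V

  s≤V : s ≤ V
  s≤V = ≤-trans s≤n n≤V

  1≤s : 1 ≤ s
  1≤s = <⇒≤ 2≤s

  1≤n : 1 ≤ n
  1≤n = ≤-trans 1≤s s≤n

  open Procedures V ℓ V≤2^ℓ 1≤ℓ n w s tl hd E 1≤n n≤V w≤V

  Arc : ℕ → Rel₂
  Arc δ = Edge w (pick δ tl hd) (pick δ hd tl)

  arc-flip : ∀ {u v} → Arc 0 u v → Arc 1 v u
  arc-flip (e , e<w , p , q) = e , e<w , q , p

  connected : ∀ δ x y → x < n → y < n → ∃[ k ] k ≤ D × Path (Arc δ) x y k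
  connected zero    x y x<n y<n = conn x y x<n y<n
  connected (suc δ) x y x<n y<n with conn y x y<n x<n
  ... | k , k≤D , p = k , k≤D , path-map arc-flip (path-reverse p)

  BallAt : (ball rad : ℕ → ℕ) (δ x : ℕ) → Set
  BallAt ball rad δ x = Ball (Arc δ) n s x (λ j → ball ((δ * n + x) * s + j)) (λ j → rad ((δ * n + x) * s + j))

  Balls : ℕ → (ball rad : ℕ → ℕ) → Set
  Balls r ball rad = ∀ δ x → x < n → δ * n + x < r → BallAt ball rad δ x

  Copied : (r : ℕ) (ball rad ball₀ rad₀ q d : ℕ → ℕ) (k : ℕ) → Set
  Copied r ball rad ball₀ rad₀ q d k =
    (∀ a → a < r * s → ball a ≡ ball₀ a × rad a ≡ rad₀ a) ×
    (∀ j → j < k → ball (r * s + j) ≡ q j × rad (r * s + j) ≡ d (q j) ∸ 1)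

  run-copy : ∀ {τ} δ x → Bounded τ → Env τ → τ DIR 0 ≡ δ → τ CENTRE 0 ≡ x →
    Run copy τ (suc s) (λ σ′ → Copied (δ * n + x) (σ′ BALL) (σ′ RAD) (τ BALL) (τ RAD) (τ QUEUE) (τ DIST) s)
  run-copy {τ} δ x bd env δ≡ x≡ =
    relax (s≤s (≤-reflexive (*-identityʳ s)))
      (run-for-uniform s (λ k σ′ → Copied r (σ′ BALL) (σ′ RAD) (τ BALL) (τ RAD) (τ QUEUE) (τ DIST) k) refl s≤V bd
        (λ σ′ fr → trans (same fr S refl 0) (s≡ env))
        ((λ _ _ → refl , refl) , λ _ ()) 1 ≤-refl
        λ k σ′ k<s at bd′ fr (below , row) →
          let env′ = env-frame fr refl refl refl refl refl env
              a = r * s + k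
              a≡ : (σ′ DIR 0 * σ′ INP 0 + σ′ CENTRE 0) * σ′ S 0 + σ′ COPY 0 ≡ a
              a≡ = cong₂ _+_ (cong₂ _*_ (cong₂ _+_ (cong₂ _*_ (trans (same fr DIR refl 0) δ≡) (n≡ env′))
                     (trans (same fr CENTRE refl 0) x≡)) (s≡ env′)) at
              q≡ : σ′ QUEUE (σ′ COPY 0) ≡ τ QUEUE k
              q≡ = trans (cong (σ′ QUEUE) at) (same fr QUEUE refl k)
              d≡ : σ′ DIST (σ′ QUEUE (σ′ COPY 0)) ∸ 1 ≡ τ DIST (τ QUEUE k) ∸ 1
              d≡ = cong (_∸ 1) (trans (cong (σ′ DIST) q≡) (same fr DIST refl _))
          in
          assign-then a (τ QUEUE k) a≡ q≡ (bd QUEUE k) ≤-refl bd′ λ bd″ →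
          run-assign a (τ DIST (τ QUEUE k) ∸ 1) a≡ d≡ (≤-trans (m∸n≤m _ 1) (bd DIST _)) ≤-refl bd″
            ((λ b b< → let b≢ = λ e → <⇒≢ (<-≤-trans b< (m≤m+n (r * s) k)) (sym e) in
               trans (upd-other (σ′ BALL) {a} (τ QUEUE k) {b} b≢) (proj₁ (below b b<)) ,
               trans (upd-other (σ′ RAD) {a} (τ DIST (τ QUEUE k) ∸ 1) {b} b≢) (proj₂ (below b b<))) ,
             λ j → below-suc (λ j → upd (σ′ BALL) a (τ QUEUE k) (r * s + j) ≡ τ QUEUE j ×
                                    upd (σ′ RAD) a (τ DIST (τ QUEUE k) ∸ 1) (r * s + j) ≡ τ DIST (τ QUEUE j) ∸ 1)
               (λ j j<k → let ne = λ e → <⇒≢ j<k (sym (+-cancelˡ-≡ (r * s) k j e)) in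
                 trans (upd-other (σ′ BALL) {a} (τ QUEUE k) {r * s + j} ne) (proj₁ (row j j<k)) ,
                 trans (upd-other (σ′ RAD) {a} (τ DIST (τ QUEUE k) ∸ 1) {r * s + j} ne) (proj₂ (row j j<k)))
               (upd-same (σ′ BALL) a _ , upd-same (σ′ RAD) a _)))
    where
      r = δ * n + x

  balls-suc : ∀ {δ x ball rad ball₀ rad₀ q d} → x < n →
    Copied (δ * n + x) ball rad ball₀ rad₀ q d s → Ball (Arc δ) n s x q (λ j → d (q j) ∸ 1) →
    Balls (δ * n + x) ball₀ rad₀ → Balls (suc (δ * n + x)) ball rad
  balls-suc {δ} {x} {ball} {rad} {ball₀} {rad₀} {q} {d} x<n (below , row) B Bs δ′ x′ x′<n lt with m≤n⇒m<n∨m≡n (≤-pred lt)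
  ... | inj₁ r′<r = ball-cong 1≤s (λ j j<s → proj₁ (below _ (cell j j<s))) (λ j j<s → proj₂ (below _ (cell j j<s))) (Bs δ′ x′ x′<n r′<r)
    where
      cell : ∀ j → j < s → (δ′ * n + x′) * s + j < (δ * n + x) * s
      cell j j<s = subst ((δ′ * n + x′) * s + j <_) (+-identityʳ _) (row-below s {j = 0} r′<r j<s)
  ... | inj₂ eq with row-injective n {δ′} {δ} x′<n x<n eq
  ... | refl , refl = ball-cong 1≤s (λ j j<s → proj₁ (row j j<s)) (λ j j<s → proj₂ (row j j<s)) B

  bfsWork ballWork : ℕ
  bfsWork = suc (n * s + n)
  ballWork = suc (2 * (suc (n * bfsWork) + suc (n + w)))

  2≤V : 2 ≤ V
  2≤V = ≤-trans 2≤s s≤V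

  run-balls : ∀ {σ} → Bounded σ → Env σ → Run balls σ ballWork (λ σ′ → Balls (2 * n) (σ′ BALL) (σ′ RAD))
  run-balls {σ} bd env =
    assign-then 0 s refl (s≡ env) s≤V (s≤s z≤n) bd λ bd₀ →
    run-for-uniform 2 (λ δ σ′ → Balls (δ * n) (σ′ BALL) (σ′ RAD)) refl 2≤V bd₀ (λ _ _ → refl)
      (λ δ x x<n ()) _ (s≤s z≤n)
      λ δ σ₁ δ<2 at₁ bd₁ fr₁ Bs →
    let env₁ = env-frame fr₁ refl refl refl refl refl env in
    run-seq (relax (m≤n+m (suc (n + w)) (suc (n * bfsWork)))
              (run-build δ s bd₁ env₁ at₁ (same fr₁ LIM refl 0))) λ σ₂ bd₂ fr₂ L →
    let env₂ = env-frame fr₂ refl refl refl refl refl env₁ in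
    weaken (m≤m+n _ _) (λ σ′ → subst (λ r → Balls r (σ′ BALL) (σ′ RAD)) (+-comm (δ * n) n))
      (run-for-uniform n (λ x σ′ → Balls (δ * n + x) (σ′ BALL) (σ′ RAD)) refl n≤V bd₂
        (λ σ′ fr → trans (same fr INP refl 0) (n≡ env₂))
        (λ δ′ x′ x′<n lt → ball-cong 1≤s (λ j _ → same fr₂ BALL refl _) (λ j _ → same fr₂ RAD refl _)
                             (Bs δ′ x′ x′<n (subst (δ′ * n + x′ <_) (+-identityʳ (δ * n)) lt)))
        bfsWork (s≤s z≤n)
        λ x σ₃ x<n at₃ bd₃ fr₃ Bs₃ →
          centre δ x x<n at₃ bd₃ (env-frame fr₃ refl refl refl refl refl env₂)
            (trans (same fr₃ DIR refl 0) (trans (same fr₂ DIR refl 0) at₁))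
            (Lists.lists-cong δ s (same fr₃ DEG refl) (same fr₃ ADJ refl) L) Bs₃)
    where
      centre : ∀ δ x {τ} → x < n → τ CENTRE 0 ≡ x → Bounded τ → Env τ → τ DIR 0 ≡ δ →
        Lists.Lists δ s w (τ DEG) (τ ADJ) → Balls (δ * n + x) (τ BALL) (τ RAD) →
        Run (SRC ≔ # CENTRE ⨟ bfs ⨟ copy) τ bfsWork (λ σ′ → Balls (δ * n + suc x) (σ′ BALL) (σ′ RAD))
      centre δ x {τ} x<n x≡ bdτ envτ δ≡ L Bs =
        assign-then 0 x refl x≡ (≤-trans (<⇒≤ x<n) n≤V) (s≤s z≤n) bdτ λ bd₁ →
        -- Here truncation pays: the degrees are at most `s`, so one search costs about `n s`
        -- instead of `w`.
        run-seq (relax (s≤s (+-monoˡ-≤ n (sum-bound n s (Lists.Lists.deg≤lim L))))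
                  (RunBFS.run-bfs x bd₁ (n≡ envτ) (w≡ envτ) refl x<n
                    (SearchLists.nb<n n w s (pick δ tl hd) (pick δ hd tl) (edges-pick E δ) L x<n)))
          λ σ₂ bd₂ fr₂ R →
        let B = Truncated.ball n w s (pick δ tl hd) (pick δ hd tl) (edges-pick E δ) L 2≤s s≤n x<n
                  (λ y y<n → let k , _ , p = connected δ x y x<n y<n in k , p) R in
        weaken (s≤s (≤-trans (≤-trans (≤-reflexive (sym (*-identityˡ s))) (*-monoˡ-≤ s 1≤n)) (m≤m+n _ n)))
          (λ σ′ cp → subst (λ r → Balls r (σ′ BALL) (σ′ RAD)) (sym (+-suc (δ * n) x))
             (balls-suc {d = σ₂ DIST} x<n cp B λ δ′ x′ x′<n lt → ball-cong 1≤s (λ j _ → same fr₂ BALL refl _) (λ j _ → same fr₂ RAD refl _) (Bs δ′ x′ x′<n lt)))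
          (run-copy δ x bd₂ (env-frame fr₂ refl refl refl refl refl envτ)
            (trans (same fr₂ DIR refl 0) δ≡) (trans (same fr₂ CENTRE refl 0) x≡))

  F : ℕ
  F = n + n

  max≤ : ∀ {a b c} → a ≤ c → b ≤ c → a + (b ∸ a) ≤ c
  max≤ {a} {b} a≤c b≤c with ≤-total a b
  ... | inj₁ a≤b = ≤-trans (≤-reflexive (m+[n∸m]≡n a≤b)) b≤c
  ... | inj₂ b≤a = ≤-trans (≤-reflexive (trans (cong (a +_) (m≤n⇒m∸n≡0 b≤a)) (+-identityʳ a))) a≤c

  differ≡0 : ∀ {a b} → (a ∸ b) + (b ∸ a) ≡ 0 → a ≡ b
  differ≡0 {a} {b} z = ≤-antisym (m∸n≡0⇒m≤n (m+n≡0⇒m≡0 (a ∸ b) z)) (m∸n≡0⇒m≤n (m+n≡0⇒n≡0 (a ∸ b) z))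

  differ≢0 : ∀ {a b} → (a ∸ b) + (b ∸ a) ≢ 0 → a ≢ b
  differ≢0 {a} nz refl = nz (cong₂ _+_ (n∸n≡0 a) (n∸n≡0 a))

  -- `M` bounds the distances both from `p` and to `p`. It is instantiated with the output, so a
  -- small output would give short walks through `p`.
  record Central (p M : ℕ) : Set where
    field
      from : ∀ v → v < n → ∃[ k ] k ≤ M × Path (Arc 0) p v k
      into : ∀ v → v < n → ∃[ k ] k ≤ M × Path (Arc 1) p v k

  central-mono : ∀ {p M M′} → M ≤ M′ → Central p M → Central p M′
  central-mono le C = record
    { from = λ v v<n → let k , k≤ , P = from v v<n in k , ≤-trans k≤ le , P
    ; into = λ v v<n → let k , k≤ , P = into v v<n in k , ≤-trans k≤ le , P
    }
    where open Central C

  instance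
    s≢0 : NonZero s
    s≢0 = >-nonZero 1≤s

  sweepWork exploreWork roundWork greedyWork pairWork pairsWork : ℕ
  sweepWork = suc (F * suc s)
  exploreWork = suc (2 * suc (n + w))
  roundWork = exploreWork + sweepWork
  greedyWork = suc (roundWork * (harmonic n F / s))
  pairWork = suc (s * suc s)
  pairsWork = suc (n * suc (n * pairWork))

  EdgeMatrix : (ℕ → ℕ) → Set
  EdgeMatrix mat = ∀ u v → u < n → v < n → (mat (u * n + v) ≢ 0 → Arc 0 u v) × (Arc 0 u v → mat (u * n + v) ≢ 0)

  -- Greedy pivots and their searches

  module Rounds (β ρ : ℕ → ℕ) (Bs : Balls (2 * n) β ρ) where

    row : ℕ → ℕ → ℕ
    row i j = β (i * s + j)

    row-ball : ∀ i → i < F → ∃[ δ ] ∃[ x ] Ball (Arc δ) n s x (row i) (λ j → ρ (i * s + j))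
    row-ball i i<F with i <? n
    ... | yes i<n = 0 , i , Bs 0 i i<n (<-≤-trans i<n (m≤m+n n _))
    ... | no  i≮n = 1 , i ∸ n , subst (λ i → Ball (Arc 1) n s (i₀ ∸ n) (row i) (λ j → ρ (i * s + j))) i≡ (Bs 1 (i ∸ n) x<n r<)
      where
        i₀ = i
        n≤i = ≮⇒≥ i≮n
        i≡ : 1 * n + (i ∸ n) ≡ i
        i≡ = trans (cong (_+ (i ∸ n)) (+-identityʳ n)) (m+[n∸m]≡n n≤i)
        x<n : i ∸ n < n
        x<n = +-cancelˡ-< n (i ∸ n) n (subst (_< n + n) (sym (m+[n∸m]≡n n≤i)) i<F)
        r< : 1 * n + (i ∸ n) < 2 * n
        r< = subst₂ _<_ (sym i≡) (cong (n +_) (sym (+-identityʳ n))) i<F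

    row<n : ∀ i j → i < F → j < s → row i j < n
    row<n i j i<F j<s = Ball.row<n (proj₂ (proj₂ (row-ball i i<F))) j j<s

    row-inj : ∀ i → i < F → InjectiveBelow s (row i)
    row-inj i i<F = Ball.inj (proj₂ (proj₂ (row-ball i i<F)))

    open Greedy n s F row row<n row-inj

    SameBalls : Store → Set
    SameBalls τ = ∀ a → τ BALL a ≡ β a

    n≤sweep : n ≤ F * suc s
    n≤sweep = ≤-trans (m≤m+n n n) (≤-trans (≤-reflexive (sym (*-identityʳ F))) (*-monoʳ-≤ F (s≤s z≤n)))

    entry≡ : ∀ {τ i j} → Env τ → SameBalls τ → τ ROW 0 ≡ i → τ COL 0 ≡ j → ⟦ entry ⟧ τ ≡ row i j
    entry≡ env sb i≡ j≡ = trans (sb _) (cong β (cong₂ _+_ (cong₂ _*_ i≡ (s≡ env)) j≡))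

    run-count : ∀ {τ} → Bounded τ → Env τ → SameBalls τ →
      Run count τ sweepWork (λ τ′ → ∀ u → u < n → τ′ COUNT u ≡ coverage (τ HIT) F u)
    run-count {τ} bd env sb =
      run-seq
        (relax (s≤s (≤-trans (≤-reflexive (*-identityʳ n)) n≤sweep))
          (run-for-uniform n (λ i σ′ → ∀ u → u < i → σ′ COUNT u ≡ 0) refl n≤V bd
            (λ σ′ fr → trans (same fr INP refl 0) (n≡ env))
            (λ _ ()) 1 ≤-refl
            λ i σ′ i<n at bd′ fr inv →
              run-assign i 0 at refl z≤n ≤-refl bd′
                λ u u<1+i → upd-elim (σ′ COUNT) i 0 u (_≡ 0) (λ _ → refl)
                  (λ i≢u → inv u (≤∧≢⇒< (≤-pred u<1+i) (i≢u ∘ sym)))))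
        λ σ₁ bd₁ fr₁ zero₁ →
      let env₁ = env-frame fr₁ refl refl refl refl refl env in
      run-for-uniform F (λ i σ′ → ∀ u → u < n → σ′ COUNT u ≡ coverage (τ HIT) i u) refl 2n≤V bd₁
        (λ σ′ fr → cong₂ _+_ (trans (same fr INP refl 0) (n≡ env₁)) (trans (same fr INP refl 0) (n≡ env₁)))
        zero₁ (suc s) (s≤s z≤n)
        λ i σ₂ i<F at₂ bd₂ fr₂ inv₂ →
          let env₂ = env-frame fr₂ refl refl refl refl refl env₁ in
          relax (s≤s (≤-reflexive (*-identityʳ s)))
            (run-for-uniform s (λ j σ′ → ∀ u → u < n → σ′ COUNT u ≡ partial i j u) refl s≤V bd₂
              (λ σ′ fr → trans (same fr S refl 0) (s≡ env₂))
              (λ u u<n → trans (inv₂ u u<n) (sym (trans (cong (coverage (τ HIT) i u +_) (*-zeroʳ (1 ∸ τ HIT i))) (+-identityʳ _))))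
              1 ≤-refl
              λ j σ₃ j<s at₃ bd₃ fr₃ inv₃ →
                let env₃ = env-frame fr₃ refl refl refl refl refl env₂
                    row≡ = trans (same fr₃ ROW refl 0) at₂
                    sb₃ = λ a → trans (same fr₃ BALL refl a) (trans (same fr₂ BALL refl a) (trans (same fr₁ BALL refl a) (sb a)))
                    b≡ = entry≡ {σ₃} env₃ sb₃ row≡ at₃
                    b<n = row<n i j i<F j<s
                    hit≡ : σ₃ HIT (σ₃ ROW 0) ≡ τ HIT i
                    hit≡ = trans (cong (σ₃ HIT) row≡) (trans (same fr₃ HIT refl i) (trans (same fr₂ HIT refl i) (same fr₁ HIT refl i)))
                in
                run-assign (row i j) (partial i (suc j) (row i j)) b≡
                  (trans (cong₂ _+_ (trans (cong (σ₃ COUNT) b≡) (inv₃ _ b<n)) (cong (1 ∸_) hit≡)) (sym (partial-here i j)))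
                  (≤-trans (partial≤ i (suc j) (row i j) i<F j<s) 2n≤V) ≤-refl bd₃
                  λ u u<n → upd-elim (σ₃ COUNT) (row i j) _ u (_≡ partial i (suc j) u)
                    (λ { refl → refl })
                    (λ ne → trans (inv₃ u u<n) (sym (partial-there i j u ne))))
      where
        partial : ℕ → ℕ → ℕ → ℕ
        partial i j u = coverage (τ HIT) i u + (1 ∸ τ HIT i) * occurrences j i u

        partial-here : ∀ i j → partial i (suc j) (row i j) ≡ partial i j (row i j) + (1 ∸ τ HIT i)
        partial-here i j = trans (cong (λ y → coverage (τ HIT) i b + (1 ∸ τ HIT i) * (occurrences j i b + y)) one)
          (lemma (coverage (τ HIT) i b) (1 ∸ τ HIT i) (occurrences j i b))
          where
            b = row i j
            one : eq01 b b ≡ 1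
            one = eq01-elim b b (_≡ 1) (λ _ → refl) (λ ne → ⊥-elim (ne refl))
            lemma : ∀ c h o → c + h * (o + 1) ≡ c + h * o + h
            lemma = solve-∀

        partial-there : ∀ i j u → row i j ≢ u → partial i (suc j) u ≡ partial i j u
        partial-there i j u ne = cong (λ y → coverage (τ HIT) i u + (1 ∸ τ HIT i) * y)
          (trans (cong (occurrences j i u +_) (eq01-elim (row i j) u (_≡ 0) (λ e → ⊥-elim (ne e)) (λ _ → refl))) (+-identityʳ _))

        partial≤ : ∀ i j u → i < F → j ≤ s → partial i j u ≤ F
        partial≤ i j u i<F j≤s = ≤-trans (+-monoʳ-≤ (coverage (τ HIT) i u) (*-monoʳ-≤ (1 ∸ τ HIT i) (sum-mono-range _ j≤s)))
          (≤-trans (coverage-bound (τ HIT) u (suc i) i<F) i<F)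

    run-choose : ∀ {τ} → Bounded τ → Env τ →
      Run choose τ (suc n) (λ τ′ → τ′ PIVOT 0 < n × (∀ u → u < n → τ COUNT u ≤ τ COUNT (τ′ PIVOT 0)))
    run-choose {τ} bd env =
      assign-then 0 0 refl refl z≤n (s≤s z≤n) bd λ bd₁ →
      relax (s≤s (≤-reflexive (*-identityʳ n)))
        (run-for-uniform n (λ i σ′ → σ′ PIVOT 0 < n × (∀ u → u < i → τ COUNT u ≤ τ COUNT (σ′ PIVOT 0))) refl n≤V bd₁
          (λ σ′ fr → trans (same fr INP refl 0) (n≡ env))
          (1≤n , λ _ ()) 1 ≤-refl
          λ i σ′ i<n at bd′ fr (p<n , best) →
            let c≡ = cong₂ _∸_ (trans (cong (σ′ COUNT) at) (same fr COUNT refl i)) (same fr COUNT refl (σ′ PIVOT 0)) in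
            run-if ≤-refl bd′
              (λ nz → run-assign 0 i refl at (≤-trans (<⇒≤ i<n) n≤V) ≤-refl bd′
                (i<n , λ u → below-suc (λ u → τ COUNT u ≤ τ COUNT i)
                  (λ u u<i → ≤-trans (best u u<i) (<⇒≤ (≰⇒> λ le → nz (trans c≡ (m≤n⇒m∸n≡0 le))))) ≤-refl))
              (λ z → run-skip ≤-refl bd′ (p<n , λ u → below-suc (λ u → τ COUNT u ≤ τ COUNT (σ′ PIVOT 0))
                  best (m∸n≡0⇒m≤n (trans (sym c≡) z)))))

    Spans : ℕ → ℕ → ℕ → Set
    Spans p M δ = ∀ v → v < n → ∃[ k ] k ≤ M × Path (Arc δ) p v k

    run-explore : ∀ {τ} p → p < n → Bounded τ → Env τ → τ LIM 0 ≡ w → τ PIVOT 0 ≡ p → τ OUT 0 ≤ D →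
      Run explore τ exploreWork (λ τ′ → τ OUT 0 ≤ τ′ OUT 0 × τ′ OUT 0 ≤ D × (∀ δ → δ < 2 → Spans p (τ′ OUT 0) δ))
    run-explore {τ} p p<n bd env lim≡ p≡ out≤ =
      run-for-uniform 2 (λ δ σ′ → τ OUT 0 ≤ σ′ OUT 0 × σ′ OUT 0 ≤ D × (∀ δ′ → δ′ < δ → Spans p (σ′ OUT 0) δ′)) refl 2≤V bd
        (λ _ _ → refl) (≤-refl , out≤ , λ _ ()) (suc (n + w)) (s≤s z≤n)
        λ δ σ₁ δ<2 at₁ bd₁ fr₁ (lo , hi , sp) →
      let env₁ = env-frame fr₁ refl refl refl refl refl env in
      run-seq (run-build δ w bd₁ env₁ at₁ (trans (same fr₁ LIM refl 0) lim≡)) λ σ₂ bd₂ fr₂ L →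
      let env₂ = env-frame fr₂ refl refl refl refl refl env₁ in
      assign-then 0 p refl (trans (same fr₂ PIVOT refl 0) (trans (same fr₁ PIVOT refl 0) p≡)) (≤-trans (<⇒≤ p<n) n≤V) (s≤s z≤n) bd₂ λ bd₃ →
      run-seq (relax (s≤s (≤-trans (+-monoˡ-≤ n (Lists.Lists.total L)) (≤-reflexive (+-comm w n))))
                (RunBFS.run-bfs p bd₃ (n≡ env₂) (w≡ env₂) refl p<n
                  (SearchLists.nb<n n w w (pick δ tl hd) (pick δ hd tl) (edges-pick E δ) L p<n))) λ σ₄ bd₄ fr₄ R →
      let env₄ = env-frame fr₄ refl refl refl refl refl env₂
          out≡ = trans (same fr₄ OUT refl 0) (same fr₂ OUT refl 0)
          dist = λ {v} {k} → SearchLists.distance n w w (pick δ tl hd) (pick δ hd tl) (edges-pick E δ) L p<n ≤-refl R {v} {k}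
          dist≤D = λ v v<n → let k , k≤D , P = connected δ p v p<n v<n in ≤-trans (proj₁ (dist P)) k≤D
      in
      weaken (s≤s (≤-trans (≤-reflexive (*-identityʳ n)) (m≤m+n n w)))
        (λ σ′ (lo′ , hi′ , far) → ≤-trans lo lo′ , hi′ ,
          λ δ′ → below-suc (Spans p (σ′ OUT 0))
            (λ δ′ δ′<δ v v<n → let k , k≤ , P = sp δ′ δ′<δ v v<n in k , ≤-trans k≤ lo′ , P)
            (λ v v<n → let k , _ , P = connected δ p v p<n v<n in σ₄ DIST v ∸ 1 , far v v<n , proj₂ (dist P)))
        (run-for-uniform n (λ v σ′ → σ₁ OUT 0 ≤ σ′ OUT 0 × σ′ OUT 0 ≤ D × (∀ v′ → v′ < v → σ₄ DIST v′ ∸ 1 ≤ σ′ OUT 0)) refl n≤V bd₄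
          (λ σ′ fr → trans (same fr INP refl 0) (n≡ env₄))
          (≤-reflexive (sym out≡) , ≤-trans (≤-reflexive out≡) hi , λ _ ()) 1 ≤-refl
          λ v σ₅ v<n at₅ bd₅ fr₅ (lo₅ , hi₅ , far₅) →
            let d≡ = trans (cong (σ₅ DIST) at₅) (same fr₅ DIST refl v) in
            run-assign 0 _ refl (cong (λ y → σ₅ OUT 0 + ((y ∸ 1) ∸ σ₅ OUT 0)) d≡)
              (max≤ (bd₅ OUT 0) (≤-trans (m∸n≤m _ 1) (bd₄ DIST v))) ≤-refl bd₅
              (≤-trans lo₅ (m≤m+n _ _) , max≤ hi₅ (dist≤D v v<n) ,
               λ v′ → below-suc (λ v′ → σ₄ DIST v′ ∸ 1 ≤ σ₅ OUT 0 + ((σ₄ DIST v ∸ 1) ∸ σ₅ OUT 0))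
                 (λ v′ v′<v → ≤-trans (far₅ v′ v′<v) (m≤m+n _ _)) (m≤n+m∸n _ (σ₅ OUT 0))))

    -- Two directions for two uses: unmarked rows avoid `p`, which feeds `progress`, and marked rows
    -- contain a pivot, which feeds the approximation guarantee.
    Marked : (p : ℕ) (hit hit′ : ℕ → ℕ) (j i : ℕ) → Set
    Marked p hit hit′ j i =
      (hit′ i ≡ 0 → hit i ≡ 0 × (∀ j′ → j′ < j → row i j′ ≢ p)) ×
      (hit′ i ≢ 0 → hit i ≢ 0 ⊎ (∃[ j′ ] j′ < s × row i j′ ≡ p))

    run-mark : ∀ {τ} p → Bounded τ → Env τ → SameBalls τ → τ PIVOT 0 ≡ p →
      Run mark τ sweepWork (λ τ′ → τ′ MISSED 0 ≡ missed (τ′ HIT) F × (∀ i → i < F → Marked p (τ HIT) (τ′ HIT) s i))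
    run-mark {τ} p bd env sb p≡ =
      assign-then 0 0 refl refl z≤n (s≤s z≤n) bd λ bd₀ →
      weaken ≤-refl (λ σ′ (a , b , _) → a , b)
        (run-for-uniform F (λ i σ′ → σ′ MISSED 0 ≡ missed (σ′ HIT) i × (∀ i′ → i′ < i → Marked p (τ HIT) (σ′ HIT) s i′) ×
                     (∀ i′ → i ≤ i′ → σ′ HIT i′ ≡ τ HIT i′)) refl 2n≤V bd₀
          (λ σ′ fr → cong₂ _+_ (trans (same fr INP refl 0) (n≡ env)) (trans (same fr INP refl 0) (n≡ env)))
          (refl , (λ _ ()) , λ _ _ → refl) (suc s) (s≤s z≤n)
          λ i σ₁ i<F at₁ bd₁ fr₁ (m≡ , mk , rest) →
            let env₁ = env-frame fr₁ refl refl refl refl refl env in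
            run-seq
              (relax (s≤s (≤-reflexive (*-identityʳ s)))
                (run-for-uniform s (λ j σ′ → (∀ i′ → i ≢ i′ → σ′ HIT i′ ≡ σ₁ HIT i′) × Marked p (τ HIT) (σ′ HIT) j i) refl s≤V bd₁
                  (λ σ′ fr → trans (same fr S refl 0) (s≡ env₁))
                  ((λ _ _ → refl) , (λ z → trans (sym (rest i ≤-refl)) z , λ _ ()) ,
                    λ nz → inj₁ λ z → nz (trans (rest i ≤-refl) z)) 1 ≤-refl
                  λ j σ₂ j<s at₂ bd₂ fr₂ (oth , no-hit , yes-hit) →
                    let env₂ = env-frame fr₂ refl refl refl refl refl env₁
                        row≡ = trans (same fr₂ ROW refl 0) at₁
                        b≡ = entry≡ {σ₂} env₂ (λ a → trans (same fr₂ BALL refl a) (trans (same fr₁ BALL refl a) (sb a))) row≡ at₂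
                        pv≡ = trans (same fr₂ PIVOT refl 0) (trans (same fr₁ PIVOT refl 0) p≡)
                    in
                    run-if ≤-refl bd₂
                      (λ nz → run-skip ≤-refl bd₂ (oth ,
                        (λ z → proj₁ (no-hit z) , λ j′ → below-suc (λ j′ → row i j′ ≢ p) (proj₂ (no-hit z))
                           (λ e → differ≢0 nz (trans pv≡ (trans (sym e) (sym b≡))))) , yes-hit))
                      (λ z → run-assign i 1 row≡ refl 1≤V ≤-refl bd₂
                        ((λ i′ ne → trans (upd-other (σ₂ HIT) {i} 1 {i′} ne) (oth i′ ne)) ,
                         (λ z′ → ⊥-elim (1≢0 (trans (sym (upd-same (σ₂ HIT) i 1)) z′))) ,
                         λ _ → inj₂ (j , j<s , trans (sym b≡) (trans (sym (differ≡0 z)) pv≡))))))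
              λ σ₃ bd₃ fr₃ (oth , mk₃) →
            let h≡ = cong (σ₃ HIT) (trans (same fr₃ ROW refl 0) at₁)
                m₃≡ : σ₃ MISSED 0 ≡ missed (σ₃ HIT) i
                m₃≡ = trans (same fr₃ MISSED refl 0) (trans m≡ (sum-cong i λ i′ i′<i → cong (1 ∸_) (sym (oth i′ λ e → <⇒≢ i′<i (sym e)))))
            in
            run-assign 0 (missed (σ₃ HIT) (suc i)) refl (cong₂ _+_ m₃≡ (cong (1 ∸_) h≡))
              (≤-trans (missed≤ (σ₃ HIT) (suc i)) (≤-trans i<F 2n≤V)) (s≤s z≤n) bd₃
              (refl , (λ i′ → below-suc (Marked p (τ HIT) (σ₃ HIT) s)
                         (λ i′ i′<i → let e = oth i′ (λ e → <⇒≢ i′<i (sym e)) in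
                            (λ z → proj₁ (mk i′ i′<i) (trans (sym e) z)) , (λ nz → proj₂ (mk i′ i′<i) λ z → nz (trans e z))) mk₃) ,
               λ i′ i<i′ → trans (oth i′ (<⇒≢ i<i′)) (rest i′ (<⇒≤ i<i′))))
      where
        1≢0 : 1 ≢ 0
        1≢0 ()
        missed≤ : ∀ hit k → missed hit k ≤ k
        missed≤ hit k = ≤-trans (sum-bound k 1 λ i _ → m∸n≤m 1 (hit i)) (≤-reflexive (*-identityʳ k))

    Hit : Store → Set
    Hit τ = ∀ i → i < F → τ HIT i ≢ 0 → ∃[ j ] j < s × Central (row i j) (τ OUT 0)

    -- The budget is the price of one round times the potential `harmonic n MISSED / s`, which drops
    -- by at least 1 per round because the harmonic sum drops by `s`.
    Greedily : ℕ → Store → Set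
    Greedily k τ = τ MISSED 0 ≡ missed (τ HIT) F × Hit τ × τ OUT 0 ≤ D × k ≡ roundWork * (harmonic n (τ MISSED 0) / s)

    run-round : ∀ k τ → Bounded τ → Env τ → τ LIM 0 ≡ w → SameBalls τ → τ MISSED 0 ≢ 0 → Greedily k τ →
      Run (count ⨟ choose ⨟ explore ⨟ mark) τ roundWork (λ τ′ → ∃[ k′ ] roundWork + k′ ≤ k × Greedily k′ τ′)
    run-round k τ bd env lim≡ sb nz (m≡ , hit , out≤ , refl) =
      run-seq (relax (m≤n+m sweepWork exploreWork) (run-count bd env sb)) λ σ₁ bd₁ fr₁ cov →
      let env₁ = env-frame fr₁ refl refl refl refl refl env in
      run-seq (relax (≤-trans (s≤s n≤sweep) (m≤n+m sweepWork exploreWork)) (run-choose bd₁ env₁)) λ σ₂ bd₂ fr₂ (p<n , best) →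
      let env₂ = env-frame fr₂ refl refl refl refl refl env₁
          p = σ₂ PIVOT 0
          out₂ = trans (same fr₂ OUT refl 0) (same fr₁ OUT refl 0)
      in
      run-seq (relax (m≤m+n exploreWork sweepWork)
                (run-explore p p<n bd₂ env₂ (trans (same fr₂ LIM refl 0) (trans (same fr₁ LIM refl 0) lim≡)) refl
                  (≤-trans (≤-reflexive out₂) out≤))) λ σ₃ bd₃ fr₃ (lo , hi , spans) →
      let env₃ = env-frame fr₃ refl refl refl refl refl env₂
          hit₃ : ∀ i → σ₃ HIT i ≡ τ HIT i
          hit₃ i = trans (same fr₃ HIT refl i) (trans (same fr₂ HIT refl i) (same fr₁ HIT refl i))
          lo′ : τ OUT 0 ≤ σ₃ OUT 0
          lo′ = ≤-trans (≤-reflexive (sym out₂)) lo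
      in
      weaken-frame (m≤n+m sweepWork exploreWork)
        (λ σ₄ fr₄ (m₄≡ , mk) →
          let out₄ = same fr₄ OUT refl 0
              cover-best : ∀ u → u < n → coverage (τ HIT) F u ≤ coverage (τ HIT) F p
              cover-best u u<n = subst₂ _≤_ (cov u u<n) (cov p p<n) (best u u<n)
              avg : τ MISSED 0 * s ≤ n * coverage (τ HIT) F p
              avg = ≤-trans (≤-reflexive (cong (_* s) m≡)) (average (τ HIT) p cover-best)
              fewer : σ₄ MISSED 0 + coverage (τ HIT) F p ≤ τ MISSED 0
              fewer = subst₂ (λ a b → a + coverage (τ HIT) F p ≤ b) (sym m₄≡) (sym m≡)
                (progress (τ HIT) (σ₄ HIT) p λ i i<F z → trans (sym (hit₃ i)) (proj₁ (proj₁ (mk i i<F) z)) , proj₂ (proj₁ (mk i i<F) z))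
              central : ∀ {q} → q ≡ p → Central q (σ₄ OUT 0)
              central = λ { refl → record
                { from = λ v v<n → subst (λ M → ∃[ k ] k ≤ M × Path (Arc 0) p v k) (sym out₄) (spans 0 (s≤s z≤n) v v<n)
                ; into = λ v v<n → subst (λ M → ∃[ k ] k ≤ M × Path (Arc 1) p v k) (sym out₄) (spans 1 (s≤s (s≤s z≤n)) v v<n) } }
              hit₄ : Hit σ₄
              hit₄ i i<F nz₄ = [ (λ nz₃ → let j , j<s , C = hit i i<F (λ z → nz₃ (trans (hit₃ i) z)) in
                                              j , j<s , central-mono (≤-trans lo′ (≤-reflexive (sym out₄))) C)
                                        , (λ (j , j<s , e) → j , j<s , central e) ] (proj₂ (mk i i<F) nz₄)
          in
          roundWork * (harmonic n (σ₄ MISSED 0) / s) ,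
          budget (harmonic-step n s (τ MISSED 0) (σ₄ MISSED 0) (coverage (τ HIT) F p) {{≢-nonZero nz}} fewer avg) ,
          m₄≡ , hit₄ , ≤-trans (≤-reflexive out₄) hi , refl)
        (run-mark p bd₃ env₃ (λ a → trans (same fr₃ BALL refl a) (trans (same fr₂ BALL refl a) (trans (same fr₁ BALL refl a) (sb a))))
          (same fr₃ PIVOT refl 0))
      where
        budget : ∀ {a b} → a + s ≤ b → roundWork + roundWork * (a / s) ≤ roundWork * (b / s)
        budget {a} {b} le = begin
          roundWork + roundWork * (a / s) ≡⟨ sym (*-suc roundWork (a / s)) ⟩
          roundWork * suc (a / s)         ≡⟨ cong (λ y → roundWork * y) (trans (+-comm 1 (a / s)) (cong (a / s +_) (sym (n/n≡1 s)))) ⟩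
          roundWork * (a / s + s / s)     ≡⟨ cong (roundWork *_) (sym (+-distrib-/-∣ʳ a ∣-refl)) ⟩
          roundWork * ((a + s) / s)       ≤⟨ *-monoʳ-≤ roundWork (/-monoˡ-≤ s le) ⟩
          roundWork * (b / s)             ∎
          where open ≤-Reasoning

    run-greedy : ∀ {σ} → Bounded σ → Env σ → SameBalls σ → (∀ i → i < F → σ HIT i ≡ 0) → σ OUT 0 ≤ D →
      Run greedy σ greedyWork (λ τ → τ OUT 0 ≤ D × (∀ i → i < F → ∃[ j ] j < s × Central (row i j) (τ OUT 0)))
    run-greedy {σ} bd env sb fresh out≤ =
      assign-then 0 w refl (w≡ env) w≤V (s≤s z≤n) bd λ bd₁ →
      assign-then 0 F refl (cong₂ _+_ (n≡ env) (n≡ env)) 2n≤V (s≤s z≤n) bd₁ λ bd₂ →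
      weaken ≤-refl
        (λ τ (z , k , m≡ , hit , out≤′ , _) → out≤′ ,
          λ i i<F → hit i i<F λ h → <⇒≱ (≤-trans (≤-reflexive (cong (1 ∸_) (sym h))) (term≤sum F (λ i → 1 ∸ τ HIT i) i<F))
                                       (≤-reflexive (trans (sym m≡) z)))
        (run-while Greedily (roundWork * (harmonic n F / s)) bd₂
          (sym (trans (sum-cong F λ i i<F → cong (1 ∸_) (fresh i i<F)) (trans (sum-const F 1) (*-identityʳ F))) ,
           (λ i i<F nz → ⊥-elim (nz (fresh i i<F))) , out≤ , refl)
          λ k τ bdτ fr nz inv → roundWork , s≤s z≤n ,
            run-round k τ bdτ (env-frame fr refl refl refl refl refl env) (same fr LIM refl 0)
              (λ a → trans (same fr BALL refl a) (sb a)) nz inv)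

    -- Estimates for all pairs

    rowIn : ℕ → ℕ → ℕ
    rowIn y j = (n + y) * s + j

    outRadius inRadius : ℕ → ℕ
    outRadius x = ρ (x * s + (s ∸ 1))
    inRadius y  = ρ (rowIn y (s ∸ 1))

    outBall : ∀ {x} → x < n → Ball (Arc 0) n s x (row x) (λ j → ρ (x * s + j))
    outBall x<n = Bs 0 _ x<n (<-≤-trans x<n (m≤m+n n _))

    inBall : ∀ {y} → y < n → Ball (flip (Arc 0)) n s y (λ j → β (rowIn y j)) (λ j → ρ (rowIn y j))
    inBall {y} y<n = ball-map (λ (e , e<w , p , q) → e , e<w , q , p) (λ (e , e<w , p , q) → e , e<w , q , p)
      (subst (λ r → Ball (Arc 1) n s y (λ j → β (r * s + j)) (λ j → ρ (r * s + j))) (cong (_+ y) (+-identityʳ n))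
        (Bs 1 y y<n (<-≤-trans (+-monoʳ-< (1 * n) y<n) (≤-reflexive (+-comm (1 * n) n)))))

    last<s : s ∸ 1 < s
    last<s = ≤-reflexive (trans (+-comm 1 (s ∸ 1)) (m∸n+n≡m 1≤s))

    Judged : (x y M : ℕ) → Set
    Judged x y M = x ≢ y → ∃[ e ] e ≤ M × (e ≡ outRadius x + inRadius y ⊎ Path (Arc 0) x y e)

    judged-mono : ∀ {x y M M′} → M ≤ M′ → Judged x y M → Judged x y M′
    judged-mono le jd ne = let e , e≤ , r = jd ne in e , ≤-trans e≤ le , r

    record Tables (ball rad mat : ℕ → ℕ) : Set where
      field
        ball≡ : ∀ a → ball a ≡ β a
        rad≡  : ∀ a → rad a ≡ ρ a
        mat✓  : EdgeMatrix mat
    open Tables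

    tables-frame : ∀ {c σ σ′} → Frame c σ σ′ → writes c BALL ≡ false → writes c RAD ≡ false → writes c MAT ≡ false →
      Tables (σ BALL) (σ RAD) (σ MAT) → Tables (σ′ BALL) (σ′ RAD) (σ′ MAT)
    tables-frame fr a b c tb = record
      { ball≡ = λ i → trans (same fr BALL a i) (ball≡ tb i)
      ; rad≡  = λ i → trans (same fr RAD b i) (rad≡ tb i)
      ; mat✓  = λ u v u<n v<n → subst (λ m → (m ≢ 0 → Arc 0 u v) × (Arc 0 u v → m ≢ 0)) (sym (same fr MAT c _)) (mat✓ tb u v u<n v<n)
      }

    run-pair : ∀ {τ} x y → x < n → y < n → x ≢ y → Bounded τ → Env τ → Tables (τ BALL) (τ RAD) (τ MAT) →
      τ CENTRE 0 ≡ x → τ Y 0 ≡ y → τ OUT 0 ≤ D →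
      Run pair τ pairWork (λ σ′ → τ OUT 0 ≤ σ′ OUT 0 × σ′ OUT 0 ≤ D × Judged x y (σ′ OUT 0))
    run-pair {τ} x y x<n y<n x≢y bd env tb x≡ y≡ out≤ =
      assign-then 0 (outRadius x + inRadius y) refl
        (cong₂ _+_ (trans (rad≡ tb _) (cong ρ (cong₂ _+_ (cong₂ _*_ x≡ (s≡ env)) (cong (_∸ 1) (s≡ env)))))
                   (trans (rad≡ tb _) (cong ρ (cong₂ _+_ (cong₂ _*_ (cong₂ _+_ (n≡ env) y≡) (s≡ env)) (cong (_∸ 1) (s≡ env))))))
        (≤-trans (+-mono-≤ (Ball.dist≤n (outBall x<n) _ last<s) (Ball.dist≤n (inBall y<n) _ last<s)) 2n≤V) (s≤s z≤n) bd λ bd₁ →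
      run-seq
        (run-for-uniform s (λ i σ′ → Est (λ i′ _ → i′ < i) (σ′ EST 0)) refl s≤V bd₁
          (λ σ′ fr → trans (same fr S refl 0) (s≡ env))
          (record { cap = ≤-refl ; tried = λ _ _ () ; real = inj₁ refl })
          (suc s) (s≤s z≤n)
          λ i σ₂ i<s at₂ bd₂ fr₂ est₂ →
            let env₂ = env-frame fr₂ refl refl refl refl refl env
                tb₂ = tables-frame fr₂ refl refl refl tb
            in
            weaken (s≤s (≤-reflexive (*-identityʳ s)))
              (λ σ′ → estimate-weaken λ i′ j′ _ j′<s i′<1+i → below-suc (λ i′ → i′ < i ⊎ (i′ ≡ i × j′ < s)) (λ _ → inj₁) (inj₂ (refl , j′<s)) i′<1+i)
              (run-for-uniform s (λ j σ′ → Est (λ i′ j′ → i′ < i ⊎ (i′ ≡ i × j′ < j)) (σ′ EST 0)) refl s≤V bd₂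
                (λ σ′ fr → trans (same fr S refl 0) (s≡ env₂))
                (estimate-weaken (λ { i′ j′ _ _ (inj₁ p) → p ; i′ j′ _ _ (inj₂ (_ , ())) }) est₂)
                1 ≤-refl
                λ j σ₃ j<s at₃ bd₃ fr₃ est₃ →
                  let env₃ = env-frame fr₃ refl refl refl refl refl env₂
                      tb₃ = tables-frame fr₃ refl refl refl tb₂
                      out≡ : σ₃ CENTRE 0 * σ₃ S 0 + σ₃ ROW 0 ≡ x * s + i
                      out≡ = cong₂ _+_ (cong₂ _*_ (trans (same fr₃ CENTRE refl 0) (trans (same fr₂ CENTRE refl 0) x≡)) (s≡ env₃))
                               (trans (same fr₃ ROW refl 0) at₂)
                      in≡ : (σ₃ INP 0 + σ₃ Y 0) * σ₃ S 0 + σ₃ COL 0 ≡ rowIn y j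
                      in≡ = cong₂ _+_ (cong₂ _*_ (cong₂ _+_ (n≡ env₃) (trans (same fr₃ Y refl 0) (trans (same fr₂ Y refl 0) y≡))) (s≡ env₃)) at₃
                      mat = σ₃ MAT (row x i * n + β (rowIn y j))
                      mat✓₃ = mat✓ tb₃ _ _ (Ball.row<n (outBall x<n) i i<s) (Ball.row<n (inBall y<n) j j<s)
                      e = σ₃ EST 0
                      c≡ : ⟦ candidate ⟧ σ₃ ≡ ρ (x * s + i) + ρ (rowIn y j) + 1 + (1 ∸ mat) * e
                      c≡ = cong₂ (λ a b → a + 1 + (1 ∸ σ₃ MAT b) * e)
                             (cong₂ _+_ (trans (rad≡ tb₃ _) (cong ρ out≡)) (trans (rad≡ tb₃ _) (cong ρ in≡)))
                             (cong₂ _+_ (cong₂ _*_ (trans (ball≡ tb₃ _) (cong β out≡)) (n≡ env₃)) (trans (ball≡ tb₃ _) (cong β in≡)))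
                  in
                  run-assign 0 _ refl (cong (λ c → e ∸ (e ∸ c)) c≡) (≤-trans (m∸n≤m e (e ∸ (ρ (x * s + i) + ρ (rowIn y j) + 1 + (1 ∸ mat) * e))) (bd₃ EST 0)) ≤-refl bd₃
                    (estimate-weaken
                      (λ { i′ j′ _ _ (inj₁ p) → inj₁ (inj₁ p)
                         ; i′ j′ _ _ (inj₂ (refl , j′<)) → below-suc (λ j′ → (i′ < i ⊎ (i′ ≡ i × j′ < j)) ⊎ (i′ ≡ i × j′ ≡ j))
                              (λ _ j′<j → inj₁ (inj₂ (refl , j′<j))) (inj₂ (refl , refl)) j′< })
                      (estimate-step {mat = mat} (outBall x<n) (inBall y<n) i<s j<s (proj₁ mat✓₃) (proj₂ mat✓₃) est₃))))
        λ σ₄ bd₄ fr₄ est →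
      let out≡ = same fr₄ OUT refl 0
          e = σ₄ EST 0
          k , k≤D , P = connected 0 x y x<n y<n
          -- The estimate is at most the length of every walk from `x` to `y`, so one walk of length
          -- at most `D` suffices.
          e≤D = ≤-trans (estimate-valid (outBall x<n) (inBall y<n) x≢y (λ i j i<s _ → i<s) est k P) k≤D
      in
      run-assign 0 _ refl refl (max≤ (bd₄ OUT 0) (bd₄ EST 0)) (s≤s z≤n) bd₄
        (≤-trans (≤-reflexive (sym out≡)) (m≤m+n _ _) , max≤ (≤-trans (≤-reflexive out≡) out≤) e≤D ,
         λ _ → e , m≤n+m∸n e (σ₄ OUT 0) , Estimate.real est)
      where
        Est : (ℕ → ℕ → Set) → ℕ → Set
        Est = Estimate (Arc 0) s x y (row x) (λ j → ρ (x * s + j)) (λ j → β (rowIn y j)) (λ j → ρ (rowIn y j))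

    run-pairs : ∀ {τ} → Bounded τ → Env τ → Tables (τ BALL) (τ RAD) (τ MAT) → τ OUT 0 ≤ D →
      Run pairs τ pairsWork (λ σ′ → τ OUT 0 ≤ σ′ OUT 0 × σ′ OUT 0 ≤ D × (∀ x y → x < n → y < n → Judged x y (σ′ OUT 0)))
    run-pairs {τ} bd env tb out≤ =
      run-for-uniform n (λ x σ′ → τ OUT 0 ≤ σ′ OUT 0 × σ′ OUT 0 ≤ D × (∀ x′ y → x′ < x → y < n → Judged x′ y (σ′ OUT 0))) refl n≤V bd
        (λ σ′ fr → trans (same fr INP refl 0) (n≡ env))
        (≤-refl , out≤ , λ _ _ ()) _ (s≤s z≤n)
        λ x σ₁ x<n at₁ bd₁ fr₁ (lo , hi , jd) →
          let env₁ = env-frame fr₁ refl refl refl refl refl env in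
          weaken ≤-refl
            (λ σ′ (lo′ , hi′ , jd′) → ≤-trans lo lo′ , hi′ ,
              λ x′ y x′< y<n → below-suc (λ x′ → Judged x′ y (σ′ OUT 0)) (λ x′ x′<x → judged-mono lo′ (jd x′ y x′<x y<n)) (jd′ y y<n) x′<)
            (run-for-uniform n (λ y σ′ → σ₁ OUT 0 ≤ σ′ OUT 0 × σ′ OUT 0 ≤ D × (∀ y′ → y′ < y → Judged x y′ (σ′ OUT 0))) refl n≤V bd₁
              (λ σ′ fr → trans (same fr INP refl 0) (n≡ env₁))
              (≤-refl , hi , λ _ ()) pairWork (s≤s z≤n)
              λ y σ₂ y<n at₂ bd₂ fr₂ (lo₂ , hi₂ , jd₂) →
                let x≡ = trans (same fr₂ CENTRE refl 0) at₁ in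
                run-if (s≤s z≤n) bd₂
                  (λ nz → weaken ≤-refl
                    (λ σ′ (lo′ , hi′ , jd′) → ≤-trans lo₂ lo′ , hi′ ,
                      λ y′ → below-suc (λ y′ → Judged x y′ (σ′ OUT 0)) (λ y′ y′<y → judged-mono lo′ (jd₂ y′ y′<y)) jd′)
                    (run-pair x y x<n y<n (λ e → differ≢0 nz (trans x≡ (trans e (sym at₂)))) bd₂
                      (env-frame fr₂ refl refl refl refl refl env₁)
                      (tables-frame fr₂ refl refl refl (tables-frame fr₁ refl refl refl tb)) x≡ at₂ hi₂))
                  (λ z → run-skip (s≤s z≤n) bd₂ (lo₂ , hi₂ ,
                    λ y′ → below-suc (λ y′ → Judged x y′ (σ₂ OUT 0)) jd₂
                      (λ ne → ⊥-elim (ne (trans (sym x≡) (trans (differ≡0 z) at₂)))))))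

    -- The lower bound on the output

    split : ∀ h z → 2 * h + z + h ≡ 3 * h + z
    split = solve-∀

    lower : ∀ {M a b} h z → a < n → b < n → (∀ k → Path (Arc 0) a b k → D ≤ k) → D ≡ 3 * h + z → z ≤ 2 →
      (∀ i → i < F → ∃[ j ] j < s × Central (row i j) M) → Judged a b M → 2 * h + z ≤ M
    lower {M} {a} {b} h z a<n b<n far refl z≤2 central judged with a ≟ b
    -- The empty walk forces `D` to be 0.
    ... | yes refl = ≤-trans weaker (≤-trans (far 0 nil) z≤n)
      where
        weaker : 2 * h + z ≤ 3 * h + z
        weaker = +-monoˡ-≤ z (*-monoˡ-≤ h {2} {3} (s≤s (s≤s z≤n)))
    ... | no a≢b with outRadius a ≤? h | inRadius b ≤? h
    ...   | yes Ra≤h | _ = +-cancelʳ-≤ h _ _ (≤-trans (≤-reflexive (split h z)) (≤-trans (far _ (P ++ᵖ P′)) (+-mono-≤ k≤M l≤h)))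
      where
        c = central a (<-≤-trans a<n (m≤m+n n n))
        P = Ball.walk (outBall a<n) (proj₁ c) (proj₁ (proj₂ c))
        l≤h = ≤-trans (Ball.radius (outBall a<n) (proj₁ c) (proj₁ (proj₂ c))) Ra≤h
        to-b = Central.from (proj₂ (proj₂ c)) b b<n
        k≤M = proj₁ (proj₂ to-b)
        P′ = proj₂ (proj₂ to-b)
    -- The pivot lies in row `n + b`; both walks come from reversed searches and are turned round.
    ...   | no _ | yes Rb≤h = +-cancelʳ-≤ h _ _ (≤-trans (≤-reflexive (split h z)) (≤-trans (far _ (P′ ++ᵖ P))
              (≤-trans (+-mono-≤ l≤h k≤M) (≤-reflexive (+-comm h M)))))
      where
        c = central (n + b) (+-monoʳ-< n b<n)
        P = path-reverse (Ball.walk (inBall b<n) (proj₁ c) (proj₁ (proj₂ c)))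
        l≤h = ≤-trans (Ball.radius (inBall b<n) (proj₁ c) (proj₁ (proj₂ c))) Rb≤h
        to-a = Central.into (proj₂ (proj₂ c)) a a<n
        k≤M = proj₁ (proj₂ to-a)
        P′ = path-map (λ (e , e<w , p , q) → e , e<w , q , p) (path-reverse (proj₂ (proj₂ to-a)))
    ...   | no Ra≰h | no Rb≰h with judged a≢b
    ...     | e , e≤M , inj₂ P = ≤-trans (+-monoˡ-≤ z (*-monoˡ-≤ h {2} {3} (s≤s (s≤s z≤n)))) (≤-trans (far e P) e≤M)
    -- Both radii are at least `h + 1`, which gives `2h + 2`; this is where `z ≤ 2` enters.
    ...     | e , e≤M , inj₁ refl = ≤-trans (+-monoʳ-≤ (2 * h) z≤2) (≤-trans (≤-reflexive (double h))
                (≤-trans (+-mono-≤ (≰⇒> Ra≰h) (≰⇒> Rb≰h)) e≤M))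
      where
        double : ∀ h → 2 * h + 2 ≡ suc h + suc h
        double = solve-∀

  -- Loading the arcs and the adjacency matrix

  prepareWork : ℕ
  prepareWork = suc w

  EdgeCells : (m : ℕ) (end₁ end₂ : ℕ → ℕ) → Set
  EdgeCells m end₁ end₂ =
    (∀ e → e < w → e < m → end₁ e ≡ tl e × end₂ e ≡ hd e) ×
    (∀ e → e < w → m ≤ e → end₂ (e ∸ m) ≡ tl e × end₁ (e ∸ m) ≡ hd e)

  run-prepare : ∀ {σ} m → Bounded σ → σ INP 0 ≡ n → σ INP 1 ≡ m → σ W 0 ≡ w → σ S 0 ≡ s →
    EdgeCells m (σ END₁) (σ END₂) → (∀ a → σ MAT a ≡ 0) →
    Run prepare σ prepareWork (λ τ → Env τ × EdgeMatrix (τ MAT))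
  run-prepare {σ} m bd n≡₀ m≡₀ w≡₀ s≡₀ (lower-half , upper-half) mat₀ =
    run-seq
      (relax (s≤s (≤-reflexive (*-identityʳ w)))
        (run-for-uniform w (λ e σ′ → ∀ f → f < e → σ′ TL f ≡ tl f × σ′ HD f ≡ hd f) refl w≤V bd
          (λ σ′ fr → trans (same fr W refl 0) w≡₀)
          (λ _ ()) 1 ≤-refl
          λ e σ₁ e<w at bd₁ fr inv →
            let m≡ = trans (same fr INP refl 1) m≡₀
                tl≤V = ≤-trans (<⇒≤ (EdgeList.tl<n E e e<w)) n≤V
                hd≤V = ≤-trans (<⇒≤ (EdgeList.hd<n E e e<w)) n≤V
                done = λ f → below-suc (λ f → upd (σ₁ TL) e (tl e) f ≡ tl f × upd (σ₁ HD) e (hd e) f ≡ hd f)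
                  (λ f f<e → let ne = λ eq → <⇒≢ f<e (sym eq) in
                     trans (upd-other (σ₁ TL) {e} (tl e) {f} ne) (proj₁ (inv f f<e)) ,
                     trans (upd-other (σ₁ HD) {e} (hd e) {f} ne) (proj₂ (inv f f<e)))
                  (upd-same (σ₁ TL) e (tl e) , upd-same (σ₁ HD) e (hd e))
            in
            run-if ≤-refl bd₁
              (λ nz →
                let e<m = ≰⇒> λ m≤e → nz (trans (cong₂ _∸_ m≡ at) (m≤n⇒m∸n≡0 m≤e)) in
                assign-then e (tl e) at
                  (trans (cong (σ₁ END₁) at) (trans (same fr END₁ refl e) (proj₁ (lower-half e e<w e<m)))) tl≤V ≤-refl bd₁ λ bd₂ →
                run-assign e (hd e) at
                  (trans (cong (σ₁ END₂) at) (trans (same fr END₂ refl e) (proj₂ (lower-half e e<w e<m)))) hd≤V ≤-refl bd₂ done)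
              (λ z →
                let m≤e = m∸n≡0⇒m≤n (trans (sym (cong₂ _∸_ m≡ at)) z)
                    i≡ = cong₂ _∸_ at m≡
                in
                assign-then e (tl e) at
                  (trans (cong (σ₁ END₂) i≡) (trans (same fr END₂ refl (e ∸ m)) (proj₁ (upper-half e e<w m≤e)))) tl≤V ≤-refl bd₁ λ bd₂ →
                run-assign e (hd e) at
                  (trans (cong (σ₁ END₁) i≡) (trans (same fr END₁ refl (e ∸ m)) (proj₂ (upper-half e e<w m≤e)))) hd≤V ≤-refl bd₂ done)))
      λ σ₁ bd₁ fr₁ filled →
    let env₁ : Env σ₁
        env₁ = record { n≡ = trans (same fr₁ INP refl 0) n≡₀ ; w≡ = trans (same fr₁ W refl 0) w≡₀
                      ; s≡ = trans (same fr₁ S refl 0) s≡₀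
                      ; tl≡ = λ e e<w → proj₁ (filled e e<w) ; hd≡ = λ e e<w → proj₂ (filled e e<w) }
    in
    weaken-frame (s≤s (≤-reflexive (*-identityʳ w)))
      (λ τ fr mat → env-frame fr refl refl refl refl refl env₁ , mat)
      -- Asymmetric on purpose: a nonzero cell is justified by any of the `w` arcs, so only the
      -- converse has to grow with `e`.
      (run-for-uniform w (λ e σ′ → ∀ u v → u < n → v < n →
            (σ′ MAT (u * n + v) ≢ 0 → ∃[ f ] f < w × tl f ≡ u × hd f ≡ v) ×
            ((∃[ f ] f < e × tl f ≡ u × hd f ≡ v) → σ′ MAT (u * n + v) ≢ 0)) refl w≤V bd₁
        (λ σ′ fr → trans (same fr W refl 0) (w≡ env₁))
        (λ u v _ _ → (λ nz → ⊥-elim (nz (trans (same fr₁ MAT refl _) (mat₀ _)))) , λ { (_ , () , _) })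
        1 ≤-refl
        λ e σ₂ e<w at bd₂ fr inv →
          let env₂ = env-frame fr refl refl refl refl refl env₁
              t≡ = trans (cong (σ₂ TL) at) (tl≡ env₂ e e<w)
              h≡ = trans (cong (σ₂ HD) at) (hd≡ env₂ e e<w)
              a = tl e * n + hd e
          in
          run-assign a 1 (cong₂ _+_ (cong₂ _*_ t≡ (n≡ env₂)) h≡) refl 1≤V ≤-refl bd₂
            λ u v u<n v<n →
              upd-elim (σ₂ MAT) a 1 (u * n + v)
                (λ y → (y ≢ 0 → ∃[ f ] f < w × tl f ≡ u × hd f ≡ v) × ((∃[ f ] f < suc e × tl f ≡ u × hd f ≡ v) → y ≢ 0))
                (λ eq → let p , q = row-injective n {tl e} {u} (EdgeList.hd<n E e e<w) v<n eq in
                   (λ _ → e , e<w , p , q) , λ _ ())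
                (λ ne → proj₁ (inv u v u<n v<n) ,
                   λ (f , f< , p , q) → below-suc (λ f → tl f ≡ u → hd f ≡ v → σ₂ MAT (u * n + v) ≢ 0)
                     (λ f f<e p q → proj₂ (inv u v u<n v<n) (f , f<e , p , q))
                     (λ p q → ⊥-elim (ne (cong₂ (λ t h → t * n + h) p q))) f< p q))

  mainWork : ℕ
  mainWork = prepareWork + (ballWork + (greedyWork + pairsWork))

  -- The extremal pair and the decomposition of `D` are quantified inside the postcondition, since
  -- the execution does not depend on them.
  run-main : ∀ {σ} m → Bounded σ → σ INP 0 ≡ n → σ INP 1 ≡ m → σ W 0 ≡ w → σ S 0 ≡ s →
    EdgeCells m (σ END₁) (σ END₂) → (∀ a → σ MAT a ≡ 0) → (∀ a → σ HIT a ≡ 0) → σ OUT 0 ≡ 0 →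
    Run (prepare ⨟ balls ⨟ greedy ⨟ pairs) σ mainWork
      (λ τ → τ OUT 0 ≤ D × (∀ a b h z → a < n → b < n → (∀ k → Path (Arc 0) a b k → D ≤ k) → D ≡ 3 * h + z → z ≤ 2 →
                              2 * h + z ≤ τ OUT 0))
  run-main {σ} m bd n≡₀ m≡₀ w≡₀ s≡₀ cells mat₀ hit₀ out₀ =
    run-seq (relax (m≤m+n _ _) (run-prepare m bd n≡₀ m≡₀ w≡₀ s≡₀ cells mat₀)) λ σ₁ bd₁ fr₁ (env₁ , mat₁) →
    run-seq (relax (≤-trans (m≤m+n _ _) (m≤n+m _ prepareWork)) (run-balls bd₁ env₁)) λ σ₂ bd₂ fr₂ Bs →
    let module R = Rounds (σ₂ BALL) (σ₂ RAD) Bs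
        env₂ = env-frame fr₂ refl refl refl refl refl env₁
        out₂ : σ₂ OUT 0 ≡ 0
        out₂ = trans (same fr₂ OUT refl 0) (trans (same fr₁ OUT refl 0) out₀)
        mat₂ : EdgeMatrix (σ₂ MAT)
        mat₂ u v u<n v<n = subst (λ y → (y ≢ 0 → Arc 0 u v) × (Arc 0 u v → y ≢ 0)) (sym (same fr₂ MAT refl _)) (mat₁ u v u<n v<n)
        tb₂ : R.Tables (σ₂ BALL) (σ₂ RAD) (σ₂ MAT)
        tb₂ = record { ball≡ = λ _ → refl ; rad≡ = λ _ → refl ; mat✓ = mat₂ }
    in
    run-seq (relax (≤-trans (m≤m+n _ _) (≤-trans (m≤n+m _ ballWork) (m≤n+m _ prepareWork)))
              (R.run-greedy bd₂ env₂ (λ _ → refl) (λ i _ → trans (same fr₂ HIT refl i) (trans (same fr₁ HIT refl i) (hit₀ i)))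
                (≤-trans (≤-reflexive out₂) z≤n))) λ σ₃ bd₃ fr₃ (hi₃ , central) →
    weaken (≤-trans (m≤n+m _ greedyWork) (≤-trans (m≤n+m _ ballWork) (m≤n+m _ prepareWork)))
      (λ τ (lo , hi , judged) → hi , λ a b h z a<n b<n far D≡ z≤2 →
        R.lower h z a<n b<n far D≡ z≤2
          (λ i i<F → let j , j<s , C = central i i<F in j , j<s , central-mono lo C) (judged a b a<n b<n))
      (R.run-pairs bd₃ (env-frame fr₃ refl refl refl refl refl env₂) (R.tables-frame fr₃ refl refl refl tb₂) hi₃)

-- The choice of the ball size

record BallSize (n w s : ℕ) : Set where
  field
    2≤s    : 2 ≤ s
    s≤n    : s ≤ n
    large  : w ≤ s * s * s * n
    least  : ∀ j → 2 ≤ j → j < s → j * j * j * n < w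
    small  : s * s * s * n ≤ 8 * w

cube-mono : ∀ {i j} n → i ≤ j → i * i * i * n ≤ j * j * j * n
cube-mono n i≤j = *-monoˡ-≤ n (*-mono-≤ (*-mono-≤ i≤j i≤j) i≤j)

-- The search from 2 ends by `n`, because `n³ n` exceeds `n² ≥ w`. Passing from `j` to `j + 1 ≤ 2 j`
-- multiplies the cube by at most 8, and the previous value was below `w`; this gives `small`.
ballSize : ∀ n w → 2 ≤ n → n ≤ w → w ≤ n * n → ∃[ s ] BallSize n w s
ballSize n w 2≤n n≤w w≤n² = search n 2 ≤-refl 2≤n (m≤m+n n 2) (λ j 2≤j j<2 → ⊥-elim (<⇒≱ j<2 2≤j)) (*-monoʳ-≤ 8 n≤w)
  where
    search : ∀ fuel j → 2 ≤ j → j ≤ n → n ≤ fuel + j → (∀ i → 2 ≤ i → i < j → i * i * i * n < w) →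
      j * j * j * n ≤ 8 * w → ∃[ s ] BallSize n w s
    search fuel j 2≤j j≤n n≤ below small with w ≤? j * j * j * n
    ... | yes big = j , record { 2≤s = 2≤j ; s≤n = j≤n ; large = big ; least = below ; small = small }
    search zero j 2≤j j≤n n≤ below small | no ¬big =
      ⊥-elim (¬big (≤-trans w≤n² (*-monoˡ-≤ n (≤-trans n≤ (≤-trans (≤-reflexive (sym (*-identityˡ j)))
        (*-monoˡ-≤ j (*-mono-≤ (<⇒≤ 2≤j) (<⇒≤ 2≤j))))))))
    search (suc fuel) j 2≤j j≤n n≤ below small | no ¬big =
      search fuel (suc j) (m≤n⇒m≤1+n 2≤j) j<n (≤-trans n≤ (≤-reflexive (sym (+-suc fuel j))))
        (λ i 2≤i i<1+j → below-suc (λ i → 2 ≤ i → i * i * i * n < w) (λ i i<j 2≤i → below i 2≤i i<j) (λ _ → ≰⇒> ¬big) i<1+j 2≤i)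
        (begin
          suc j * suc j * suc j * n             ≤⟨ cube-mono n (≤-trans (≤-reflexive (+-comm 1 j)) (+-monoʳ-≤ j (<⇒≤ 2≤j))) ⟩
          (j + j) * (j + j) * (j + j) * n       ≡⟨ lemma j n ⟩
          8 * (j * j * j * n)                   ≤⟨ *-monoʳ-≤ 8 (<⇒≤ (≰⇒> ¬big)) ⟩
          8 * w                                 ∎)
      where
        open ≤-Reasoning
        lemma : ∀ j n → (j + j) * (j + j) * (j + j) * n ≡ 8 * (j * j * j * n)
        lemma = solve-∀
        j<n : j < n
        j<n = ≰⇒> λ n≤j → ¬big (≤-trans w≤n² (*-monoˡ-≤ n (≤-trans n≤j (≤-trans (≤-reflexive (sym (*-identityˡ j)))
          (*-monoˡ-≤ j (*-mono-≤ (<⇒≤ 2≤j) (<⇒≤ 2≤j)))))))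

module Run-parameters (V ℓ : ℕ) (V≤2^ℓ : V ≤ 2 ^ ℓ) (1≤ℓ : 1 ≤ ℓ) where
  open Logic V ℓ V≤2^ℓ 1≤ℓ

  run-parameters : ∀ {σ} n w s → BallSize n w s → w ≤ V → n ≤ V → Bounded σ → σ INP 0 ≡ n →
    σ INP 1 + σ INP 2 * σ INP 1 ≡ w → Run parameters σ (suc s) (λ τ → τ W 0 ≡ w × τ S 0 ≡ s)
  run-parameters {σ} n w s size w≤V n≤V bd n≡ w≡ =
    assign-then 0 w refl w≡ w≤V (s≤s z≤n) bd λ bd₁ →
    assign-then 0 2 refl refl (≤-trans 2≤s s≤V) (s≤s z≤n) bd₁ λ bd₂ →
    weaken (s≤s (m∸n≤m s 2)) finish
      (run-while Inv (s ∸ 2) bd₂ (≤-refl , 2≤s , m∸n+n≡m 2≤s , refl , n≡) step)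
    where
      open BallSize size
      s≤V = ≤-trans s≤n n≤V
      Inv : ℕ → Store → Set
      Inv k τ = 2 ≤ τ S 0 × τ S 0 ≤ s × k + τ S 0 ≡ s × τ W 0 ≡ w × τ INP 0 ≡ n
      guard : Expr
      guard = # W ⊖ # S ⊛ # S ⊛ # S ⊛ #n
      finish : ∀ τ → (⟦ guard ⟧ τ ≡ 0 × ∃[ k ] Inv k τ) → τ W 0 ≡ w × τ S 0 ≡ s
      finish τ (z , k , 2≤j , j≤s , _ , refl , refl) with m≤n⇒m<n∨m≡n j≤s
      ... | inj₂ j≡s = refl , j≡s
      ... | inj₁ j<s = ⊥-elim (<⇒≱ (least _ 2≤j j<s) (m∸n≡0⇒m≤n z))
      step : ∀ k τ → Bounded τ → _ → ⟦ guard ⟧ τ ≢ 0 → Inv k τ →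
        ∃[ x ] 1 ≤ x × Run (S ≔ # S ⊕ lit 1) τ x (λ τ′ → ∃[ k′ ] x + k′ ≤ k × Inv k′ τ′)
      step k τ bdτ _ nz (2≤j , j≤s , k≡ , refl , refl) with m≤n⇒m<n∨m≡n j≤s
      ... | inj₂ j≡s = ⊥-elim (nz (m≤n⇒m∸n≡0 (≤-trans large (≤-reflexive (cong (λ j → j * j * j * n) (sym j≡s))))))
      ... | inj₁ j<s = 1 , ≤-refl ,
              run-assign 0 (suc (τ S 0)) refl (+-comm (τ S 0) 1) (≤-trans j<s s≤V) ≤-refl bdτ
                (s ∸ suc (τ S 0) ,
                 +-cancelʳ-≤ (τ S 0) _ _ (≤-reflexive (trans (sym (+-suc (s ∸ suc (τ S 0)) (τ S 0))) (trans (m∸n+n≡m j<s) (sym k≡)))) ,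
                 m≤n⇒m≤1+n 2≤j , j<s , m∸n+n≡m j<s , refl , refl)

input-bounded : ∀ {κ n m V} (G : Graph κ n m) → n ≤ V → m ≤ V → 1 ≤ V → ∀ a i → input G a i ≤ V
input-bounded {κ} G n≤V m≤V 1≤V 0 0 = n≤V
input-bounded {κ} G n≤V m≤V 1≤V 0 1 = m≤V
input-bounded {directed}   G n≤V m≤V 1≤V 0 2 = z≤n
input-bounded {undirected} G n≤V m≤V 1≤V 0 2 = 1≤V
input-bounded G n≤V m≤V 1≤V 0 (suc (suc (suc i))) = z≤n
input-bounded G n≤V m≤V 1≤V 1 i = cells-bound (toℕ ∘ proj₁ ∘ ends G) (λ e → ≤-trans (<⇒≤ (toℕ<n _)) n≤V) i
input-bounded G n≤V m≤V 1≤V 2 i = cells-bound (toℕ ∘ proj₂ ∘ ends G) (λ e → ≤-trans (<⇒≤ (toℕ<n _)) n≤V) i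
input-bounded G n≤V m≤V 1≤V (suc (suc (suc a))) i = z≤n

-- Arithmetic of the running time

module WorkBound (n w s L : ℕ) .{{_ : NonZero s}} (1≤n : 1 ≤ n) (1≤s : 1 ≤ s) (1≤L : 1 ≤ L)
    (w≤n² : w ≤ n * n) (w≤s³n : w ≤ s * s * s * n) (2n≤ : n + n ≤ 2 ^ suc L) where
  open ≤-Reasoning

  -- The cost of scanning all pairs of balls, to which the other phases are charged, the greedy
  -- phase with an extra factor `L`.
  area : ℕ
  area = n * n * (s * s)

  1≤n² = *-mono-≤ 1≤n 1≤n
  1≤s² = *-mono-≤ 1≤s 1≤s

  grow : ∀ {x} y → 1 ≤ y → x ≤ x * y
  grow {x} y 1≤y = ≤-trans (≤-reflexive (sym (*-identityʳ x))) (*-monoʳ-≤ x 1≤y)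

  1≤area : 1 ≤ area
  1≤area = *-mono-≤ 1≤n² 1≤s²

  n²≤area : n * n ≤ area
  n²≤area = grow (s * s) 1≤s²

  n≤area : n ≤ area
  n≤area = ≤-trans (grow n 1≤n) n²≤area

  n²s≤area : n * n * s ≤ area
  n²s≤area = *-monoʳ-≤ (n * n) (grow s 1≤s)

  s≤area : s ≤ area
  s≤area = ≤-trans (≤-trans (≤-reflexive (sym (*-identityˡ s))) (*-monoˡ-≤ s 1≤n²)) n²s≤area

  w≤area : w ≤ area
  w≤area = ≤-trans w≤n² n²≤area

  searches≤ : suc (2 * (suc (n * suc (n * s + n)) + suc (n + w))) ≤ 15 * area
  searches≤ = begin
    suc (2 * (suc (n * suc (n * s + n)) + suc (n + w)))  ≡⟨ expand n w s ⟩
    5 * 1 + 2 * (n * n * s) + 2 * (n * n) + 4 * n + 2 * w ≤⟨ +-mono-≤ (+-mono-≤ (+-mono-≤ (+-mono-≤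
                                                              (*-monoʳ-≤ 5 1≤area) (*-monoʳ-≤ 2 n²s≤area)) (*-monoʳ-≤ 2 n²≤area))
                                                              (*-monoʳ-≤ 4 n≤area)) (*-monoʳ-≤ 2 w≤area) ⟩
    5 * area + 2 * area + 2 * area + 4 * area + 2 * area  ≡⟨ collect area ⟩
    15 * area                                             ∎
    where
      expand : ∀ n w s → suc (2 * (suc (n * suc (n * s + n)) + suc (n + w))) ≡ 5 * 1 + 2 * (n * n * s) + 2 * (n * n) + 4 * n + 2 * w
      expand = solve-∀
      collect : ∀ a → 5 * a + 2 * a + 2 * a + 4 * a + 2 * a ≡ 15 * a
      collect = solve-∀

  pairs≤ : suc (n * suc (n * suc (s * suc s))) ≤ 5 * area
  pairs≤ = begin
    suc (n * suc (n * suc (s * suc s)))         ≡⟨ expand n s ⟩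
    1 + n + n * n + n * n * s + n * n * (s * s) ≤⟨ +-monoˡ-≤ area (+-mono-≤ (+-mono-≤ (+-mono-≤ 1≤area n≤area) n²≤area) n²s≤area) ⟩
    area + area + area + area + area            ≡⟨ collect area ⟩
    5 * area                                    ∎
    where
      expand : ∀ n s → suc (n * suc (n * suc (s * suc s))) ≡ 1 + n + n * n + n * n * s + n * n * (s * s)
      expand = solve-∀
      collect : ∀ a → a + a + a + a + a ≡ 5 * a
      collect = solve-∀

  -- A round searches the whole graph, which `w ≤ s³ n` absorbs, and sweeps the balls at cost `n s`.
  round≤ : suc (2 * suc (n + w)) + suc ((n + n) * suc s) ≤ 12 * (s * s * s * n)
  round≤ = begin
    suc (2 * suc (n + w)) + suc ((n + n) * suc s) ≡⟨ expand n w s ⟩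
    4 * 1 + 4 * n + 2 * w + 2 * (s * n)           ≤⟨ +-mono-≤ (+-mono-≤ (+-mono-≤ (*-monoʳ-≤ 4 (*-mono-≤ 1≤s³ 1≤n)) (*-monoʳ-≤ 4 n≤t)) (*-monoʳ-≤ 2 w≤s³n)) (*-monoʳ-≤ 2 sn≤t) ⟩
    4 * t + 4 * t + 2 * t + 2 * t                 ≡⟨ collect t ⟩
    12 * t                                        ∎
    where
      t = s * s * s * n
      1≤s³ = *-mono-≤ 1≤s² 1≤s
      n≤t : n ≤ t
      n≤t = ≤-trans (≤-reflexive (sym (*-identityˡ n))) (*-monoˡ-≤ n 1≤s³)
      sn≤t : s * n ≤ t
      sn≤t = *-monoˡ-≤ n (≤-trans (≤-reflexive (sym (*-identityˡ s))) (*-monoˡ-≤ s 1≤s²))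
      expand : ∀ n w s → suc (2 * suc (n + w)) + suc ((n + n) * suc s) ≡ 4 * 1 + 4 * n + 2 * w + 2 * (s * n)
      expand = solve-∀
      collect : ∀ a → 4 * a + 4 * a + 2 * a + 2 * a ≡ 12 * a
      collect = solve-∀

  -- About `n L / s` rounds at `s³ n` each. With `s³ n ≈ w` the pivots cost as much as the pairs up
  -- to the factor `L`, the balance behind the choice of `s`.
  rounds≤ : (suc (2 * suc (n + w)) + suc ((n + n) * suc s)) * (harmonic n (n + n) / s) ≤ 60 * (area * L)
  rounds≤ = begin
    (suc (2 * suc (n + w)) + suc ((n + n) * suc s)) * (H / s) ≤⟨ *-monoˡ-≤ (H / s) round≤ ⟩
    12 * (s * s * s * n) * (H / s)                            ≡⟨ regroup n s (H / s) ⟩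
    12 * (s * s * n) * (H / s * s)                            ≤⟨ *-monoʳ-≤ (12 * (s * s * n)) (≤-trans (m/n*n≤m H s) H≤) ⟩
    12 * (s * s * n) * (n * (5 * L))                          ≡⟨ collect n s L ⟩
    60 * (area * L)                                           ∎
    where
      H = harmonic n (n + n)
      H≤ : H ≤ n * (5 * L)
      H≤ = begin
        H                         ≤⟨ harmonic-bound n (n + n) (suc L) 2n≤ ⟩
        n * suc (suc L) + (n + n) ≡⟨ sum-up n L ⟩
        n * (4 * 1 + L)           ≤⟨ *-monoʳ-≤ n (≤-trans (+-monoˡ-≤ L (*-monoʳ-≤ 4 1≤L)) (≤-reflexive (five L))) ⟩
        n * (5 * L)               ∎
        where
          sum-up : ∀ n L → n * suc (suc L) + (n + n) ≡ n * (4 * 1 + L)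
          sum-up = solve-∀
          five : ∀ L → 4 * L + L ≡ 5 * L
          five = solve-∀
      regroup : ∀ n s q → 12 * (s * s * s * n) * q ≡ 12 * (s * s * n) * (q * s)
      regroup = solve-∀
      collect : ∀ n s L → 12 * (s * s * n) * (n * (5 * L)) ≡ 60 * (n * n * (s * s) * L)
      collect = solve-∀

  -- The left side is `suc s + mainWork` unfolded. The constant is 15 for the balls, 60 for the
  -- greedy rounds, 5 for the pairs and 5 for lower-order terms.
  total≤ : suc s + (suc w + (suc (2 * (suc (n * suc (n * s + n)) + suc (n + w))) +
      (suc ((suc (2 * suc (n + w)) + suc ((n + n) * suc s)) * (harmonic n (n + n) / s)) +
       suc (n * suc (n * suc (s * suc s)))))) ≤ 85 * (area * L)
  total≤ = ≤-trans
    (+-mono-≤ (+-mono-≤ 1≤A (≤-trans s≤area area≤A))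
      (+-mono-≤ (+-mono-≤ 1≤A (≤-trans w≤area area≤A))
        (+-mono-≤ (≤-trans searches≤ (*-monoʳ-≤ 15 area≤A))
          (+-mono-≤ (+-mono-≤ 1≤A rounds≤) (≤-trans pairs≤ (*-monoʳ-≤ 5 area≤A))))))
    (≤-reflexive (collect (area * L)))
    where
      area≤A : area ≤ area * L
      area≤A = grow L 1≤L
      1≤A : 1 ≤ area * L
      1≤A = ≤-trans 1≤area area≤A
      collect : ∀ a → a + a + (a + a + (15 * a + (a + 60 * a + 5 * a))) ≡ 85 * a
      collect = solve-∀

-- Cubing clears the fractional exponents: `(n² s²)³ = n⁴ (s³ n)²`, and `s³ n ≤ 16 m`, whence 256.
-- The 255 is 85 times 3, from `suc (2 * L) ≤ 3 * L`. Two logarithms, one for the rounds and one for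
-- the price of an operation, become `L ^ 6`.
cubic : ∀ f t n m s L X → t ≤ f * X * suc (2 * L) → X ≤ 85 * (n * n * (s * s) * L) → 1 ≤ L →
  s * s * s * n ≤ 16 * m → t ^ 3 ≤ (f * 255) ^ 3 * 256 * (m ^ 2 * n ^ 4) * L ^ 6
cubic f t n m s L X t≤ X≤ 1≤L s³n≤ = begin
  t ^ 3                                           ≤⟨ ^-monoˡ-≤ 3 t≤′ ⟩
  (f * 255 * (n * n * (s * s) * (L * L))) ^ 3     ≡⟨ regroup (f * 255) n s L ⟩
  (f * 255) ^ 3 * (n ^ 4 * (s * s * s * n) ^ 2) * L ^ 6 ≤⟨ *-monoˡ-≤ (L ^ 6) (*-monoʳ-≤ ((f * 255) ^ 3) (*-monoʳ-≤ (n ^ 4) (^-monoˡ-≤ 2 s³n≤))) ⟩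
  (f * 255) ^ 3 * (n ^ 4 * (16 * m) ^ 2) * L ^ 6  ≡⟨ cong (_* L ^ 6) (square ((f * 255) ^ 3) (n ^ 4) m) ⟩
  (f * 255) ^ 3 * 256 * (m ^ 2 * n ^ 4) * L ^ 6   ∎
  where
    open ≤-Reasoning
    regroup : ∀ g n s L → (g * (n * n * (s * s) * (L * L))) ^ 3 ≡ g ^ 3 * (n ^ 4 * (s * s * s * n) ^ 2) * L ^ 6
    regroup = regroup′
      where
        regroup′ : ∀ g n s L →
          (g * (n * n * (s * s) * (L * L))) * ((g * (n * n * (s * s) * (L * L))) * ((g * (n * n * (s * s) * (L * L))) * 1))
          ≡ g * (g * (g * 1)) * (n * (n * (n * (n * 1))) * ((s * s * s * n) * ((s * s * s * n) * 1))) * (L * (L * (L * (L * (L * (L * 1))))))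
        regroup′ = solve-∀
    square : ∀ g q m → g * (q * (16 * m) ^ 2) ≡ g * 256 * (m ^ 2 * q)
    square = square′
      where
        square′ : ∀ g q m → g * (q * ((16 * m) * ((16 * m) * 1))) ≡ g * 256 * (m * (m * 1) * q)
        square′ = solve-∀
    t≤′ : t ≤ f * 255 * (n * n * (s * s) * (L * L))
    t≤′ = begin
      t                                                       ≤⟨ t≤ ⟩
      f * X * suc (2 * L)                                     ≤⟨ *-mono-≤ (*-monoʳ-≤ f X≤) (+-monoˡ-≤ (2 * L) 1≤L) ⟩
      f * (85 * (n * n * (s * s) * L)) * (L + 2 * L)          ≡⟨ collect f n s L ⟩
      f * 255 * (n * n * (s * s) * (L * L))                   ∎
      where
        collect : ∀ f n s L → f * (85 * (n * n * (s * s) * L)) * (L + 2 * L) ≡ f * 255 * (n * n * (s * s) * (L * L))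
        collect = solve-∀

trivial-diameter : ∀ {κ m D} (G : Graph κ 1 m) → IsDiameter G D → D ≡ 0
trivial-diameter G (_ , Fin.zero , Fin.zero , _ , shortest) = n≤0⇒n≡0 (shortest 0 Graph.[])

-- Abstract, since conversion checking would otherwise unfold the numeral in unary.
abstract
  timeFactor : ℕ
  timeFactor = factor program

  factor≡timeFactor : factor program ≡ timeFactor
  factor≡timeFactor = refl

-- Assembly for graphs with at least two vertices

module Large {κ : Kind} {n m : ℕ} (G : Graph κ n m) (2≤n : 2 ≤ n) {D : ℕ} (diam : IsDiameter G D) where
  open Arcs G

  -- `n * n` dominates all stored numbers: the number of arcs by simplicity, and counters up to
  -- `n + n` by `2 ≤ n`.
  L V ℓ : ℕ
  L = ⌈log₂ n ⌉
  V = n * n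
  ℓ = 2 * L

  1≤n : 1 ≤ n
  1≤n = <⇒≤ 2≤n

  1≤L : 1 ≤ L
  1≤L = ⌈log₂⌉-mono-≤ 2≤n

  V≤2^ℓ : V ≤ 2 ^ ℓ
  V≤2^ℓ = ≤-trans (*-mono-≤ (n≤2^⌈log₂n⌉ n) (n≤2^⌈log₂n⌉ n))
    (≤-reflexive (trans (sym (^-distribˡ-+-* 2 L L)) (cong (λ y → 2 ^ (L + y)) (sym (+-identityʳ L)))))

  1≤ℓ : 1 ≤ ℓ
  1≤ℓ = ≤-trans 1≤L (m≤m+n L _)

  2n≤V : n + n ≤ V
  2n≤V = ≤-trans (≤-reflexive (cong (n +_) (sym (+-identityʳ n)))) (*-monoˡ-≤ n 2≤n)

  arcs≤V : arcs ≤ V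
  arcs≤V = edges≤square edgeList

  n≤arcs : n ≤ arcs
  n≤arcs = vertices≤edges 2≤n λ x y x<n y<n → let k , _ , p = connected diam x y x<n y<n in k , p

  s : ℕ
  s = proj₁ (ballSize n arcs 2≤n n≤arcs arcs≤V)

  size-s : BallSize n arcs s
  size-s = proj₂ (ballSize n arcs 2≤n n≤arcs arcs≤V)

  open BallSize size-s
  open Algorithm V ℓ V≤2^ℓ 1≤ℓ n arcs s tl hd edgeList 2≤s s≤n 2n≤V arcs≤V D (connected diam)
    using (mainWork; run-main; EdgeCells; 1≤s)
  open Logic V ℓ V≤2^ℓ 1≤ℓ
  open Run-parameters V ℓ V≤2^ℓ 1≤ℓ

  n≤V : n ≤ V
  n≤V = ≤-trans (m≤m+n n n) 2n≤V

  input-cells : EdgeCells m end₁ end₂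
  input-cells =
    (λ e _ e<m → sym (glue-below {m} {end₁} {end₂} e<m) , sym (glue-below {m} {end₂} {end₁} e<m)) ,
    (λ e _ m≤e → sym (glue-above {m} {end₁} {end₂} m≤e) , sym (glue-above {m} {end₂} {end₁} m≤e))

  edge-cells-cong : ∀ {f f′ g g′ : ℕ → ℕ} → (∀ e → f′ e ≡ f e) → (∀ e → g′ e ≡ g e) → EdgeCells m f g → EdgeCells m f′ g′
  edge-cells-cong p q (lo , hi) =
    (λ e e<w e<m → trans (p e) (proj₁ (lo e e<w e<m)) , trans (q e) (proj₂ (lo e e<w e<m))) ,
    (λ e e<w m≤e → trans (q _) (proj₁ (hi e e<w m≤e)) , trans (p _) (proj₂ (hi e e<w m≤e)))

  run-program : Run program (input G) (suc s + mainWork)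
    (λ τ → τ OUT 0 ≤ D × (∀ h z → D ≡ 3 * h + z → z ≤ 2 → 2 * h + z ≤ τ OUT 0))
  run-program = run-if (s≤s z≤n) bd
    (λ _ → run-seq (relax (m≤m+n (suc s) mainWork)
        (run-parameters n arcs s size-s arcs≤V n≤V bd refl refl)) λ σ₁ bd₁ fr₁ (w≡ , s≡) →
      weaken (m≤n+m mainWork (suc s))
        (λ τ (hi , lo) → hi , λ h z D≡ z≤2 → let u , v , dist = proj₂ diam in
          lo (toℕ u) (toℕ v) h z (toℕ<n u) (toℕ<n v) (extremal dist) D≡ z≤2)
        (run-main m bd₁ (same fr₁ INP refl 0) (same fr₁ INP refl 1) w≡ s≡
          (edge-cells-cong (same fr₁ END₁ refl) (same fr₁ END₂ refl) input-cells)
          (same fr₁ MAT refl) (same fr₁ HIT refl) (same fr₁ OUT refl 0)))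
    (λ z → ⊥-elim (<⇒≱ 2≤n (m∸n≡0⇒m≤n z)))
    where
      bd : Bounded (input G)
      bd = input-bounded G n≤V (≤-trans (m≤m+n m _) arcs≤V) (≤-trans 1≤n n≤V)

  fast : ∀ {t} → t ≼ factor program * (suc s + mainWork) →
    t ^ 3 ≤ (timeFactor * 255) ^ 3 * 256 * (m ^ 2 * n ^ 4) * L ^ 6
  fast {t} (≼-intro t≤) = cubic timeFactor t n m s L (suc s + mainWork)
    (subst (λ f → t ≤ f * (suc s + mainWork) * suc ℓ) factor≡timeFactor t≤)
    (WorkBound.total≤ n arcs s L {{>-nonZero 1≤s}} 1≤n 1≤s 1≤L arcs≤V large 2n≤2^) 1≤L
    -- 8 from the ball size and 2 from doubling the edges make the 16 in `cubic`.
    (≤-trans small (≤-trans (*-monoʳ-≤ 8 arcs≤2m) (≤-reflexive (sym (*-assoc 8 2 m)))))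
    where
      2n≤2^ : n + n ≤ 2 ^ suc L
      2n≤2^ = ≤-trans (≤-reflexive (cong (n +_) (sym (+-identityʳ n)))) (*-monoʳ-≤ 2 (n≤2^⌈log₂n⌉ n))

  solution : ∀ h z → z ≤ 2 → D ≡ 3 * h + z →
    Σ[ σ ∈ Store ] Σ[ t ∈ ℕ ]
    (⟨ program , input G ⟩⇓ σ ∣ t
    × 2 * h + z ≤ output σ
    × output σ ≤ D
    × t ^ 3 ≤ (timeFactor * 255) ^ 3 * 256 * (m ^ 2 * n ^ 4) * ⌈log₂ n ⌉ ^ 6)
  solution h z z≤2 D≡ = final , time , exec , proj₂ post h z D≡ z≤2 , proj₁ post , fast time≤
    where open Run run-program

-- The time bound is stated for the cube, which keeps all exponents integral. The threshold `N = 2`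
-- leaves out the single vertex, for which `⌈log₂ n⌉` is 0 while every run takes positive time.
theorem4 : Σ[ P ∈ Cmd ] Σ[ C ∈ ℕ ] Σ[ k ∈ ℕ ] Σ[ N ∈ ℕ ]
    ((κ : Kind) (n m : ℕ) (G : Graph κ n m) (D h z : ℕ) →
    z ≤ 2 → D ≡ 3 * h + z → IsDiameter G D →
    Σ[ σ ∈ Store ] Σ[ t ∈ ℕ ]
    (⟨ P , input G ⟩⇓ σ ∣ t
    × 2 * h + z ≤ output σ
    × output σ ≤ D
    × (N ≤ n → t ^ 3 ≤ C * (m ^ 2 * n ^ 4) * ⌈log₂ n ⌉ ^ k)))
theorem4 = program , (timeFactor * 255) ^ 3 * 256 , 6 , 2 , correct
  where
    correct : (κ : Kind) (n m : ℕ) (G : Graph κ n m) (D h z : ℕ) →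
      z ≤ 2 → D ≡ 3 * h + z → IsDiameter G D →
      Σ[ σ ∈ Store ] Σ[ t ∈ ℕ ]
      (⟨ program , input G ⟩⇓ σ ∣ t
      × 2 * h + z ≤ output σ
      × output σ ≤ D
      × (2 ≤ n → t ^ 3 ≤ (timeFactor * 255) ^ 3 * 256 * (m ^ 2 * n ^ 4) * ⌈log₂ n ⌉ ^ 6))
    correct κ 0 m G D h z z≤2 D≡ (_ , () , _)
    correct κ 1 m G D h z z≤2 D≡ diam = input G , _ , ⇓else refl ⇓skip ,
      ≤-trans (+-monoˡ-≤ z (*-monoˡ-≤ h {2} {3} (s≤s (s≤s z≤n)))) (≤-reflexive (trans (sym D≡) (trivial-diameter G diam))) ,
      z≤n , λ { (s≤s ()) }
    correct κ n@(suc (suc _)) m G D h z z≤2 D≡ diam =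
      let σ , t , run , lower , upper , quick = Large.solution G (s≤s (s≤s z≤n)) diam h z z≤2 D≡
      in σ , t , run , lower , upper , λ _ → quick
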